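{- Let $\ell\ge 2$, $S=\mathbb{R}[x_1,\dots,x_\ell]$, $m=2$ and $\Lambda=\{(\lambda_1,\lambda_2)\in\mathbb{Z}^2\mid \ell-2\ge\lambda_1\ge\lambda_2\ge 0\}$. The set $$C_{\mathcal{D}}:=\{\eta^{\mathcal{D}}_i\mid i=1,\dots,\ell\}\cup\{\theta^{\mathcal{D}}_\lambda\mid\lambda\in\Lambda\}$$ forms an $S$-basis for $D^{(2)}(\mathcal{D}_\ell)$. Hence, as multisets, $$\exp D^{(2)}(\mathcal{D}_\ell)=\{\underbrace{2\ell-2,\dots,2\ell-2}_{\ell}\}\cup\{2\lambda_1+2\lambda_2-2\mid\ell-2\ge\lambda_1\ge\lambda_2\ge1\}\cup\{2\lambda_1-2+\ell\mid\ell-2\ge\lambda_1\ge1\}\cup\{2\ell-2\}.$$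
   Context: $S=\mathbb{R}[x_1,\dots,x_\ell]$, $\partial_i=\partial/\partial x_i$, and $D^{(2)}(S)=\bigoplus_{|\alpha|=2}S\,\partial^{\alpha}$ (sum over multi-indices $\alpha\in\mathbb{N}^\ell$ with $|\alpha|=\alpha_1+\cdots+\alpha_\ell=2$). A nonzero $\theta=\sum f_\alpha\partial^\alpha$ is homogeneous of degree $i$ if each $f_\alpha$ is zero or homogeneous of degree $i$. The Coxeter arrangement $\mathcal{D}_\ell$ of type D in $\mathbb{R}^\ell$ consists of the hyperplanes $\{x_i\pm x_j=0\}$, $1\le i<j\le\ell$; it has defining polynomial $Q(\mathcal{D}_\ell)=\prod_{1\le i<j\le\ell}(x_i^2-x_j^2)$, and $D^{(2)}(\mathcal{D}_\ell)=\{\theta\in D^{(2)}(S)\mid\theta(Q(\mathcal{D}_\ell)S)\subseteq Q(\mathcal{D}_\ell)S\}$. When this is a free $S$-module, $\exp D^{(2)}(\mathcal{D}_\ell)$ is the multiset of degrees of a homogeneous basis. For $|\alpha|=2$, $x_\alpha$ is the pair listing $x_i$ with multiplicity $\alpha_i$ (i.e. $(x_i,x_i)$ or $(x_i,x_j)$ with $i<j$), and $\alpha!=\alpha_1!\cdots\alpha_\ell!$. For $\lambda\in\Lambda$ define the symmetric Laurent polynomial $$s^{\mathcal{D}}_\lambda(t_1,t_2)=\frac{\det(t_i^{2(\lambda_j+2-j)-1})_{1\le i,j\le2}}{\det(t_i^{2(2-j)})_{1\le i,j\le2}}\in S[t_1^{\pm1},t_2^{\pm1}].$$ Let $\lambda^{(0)}=(0,0)$.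 Set $\theta_\lambda=\sum_{|\alpha|=2}s^{\mathcal{D}}_\lambda(x_\alpha)\frac{1}{\alpha!}\partial^\alpha$ and $$\theta^{\mathcal{D}}_\lambda=\begin{cases}\theta_\lambda&\text{if }\lambda_2\ge1,\\ (x_1\cdots x_\ell)\,\theta_\lambda&\text{if }\lambda_2=0,\ \lambda_1\geq 1,\\ (x_1\cdots x_\ell)^2\,\theta_\lambda&\text{if }\lambda=\lambda^{(0)}.\end{cases}$$ These have coefficients in $S$. For $k=1,\dots,\ell$ put $h^{\mathcal{D}}_k=\prod_{i\ne k}(x_k^2-x_i^2)$ and $$\eta^{\mathcal{D}}_k=\frac{h^{\mathcal{D}}_k}{2x_k}\partial_k^2-(-1)^{\ell-1}\frac{1}{x_k}\theta^{\mathcal{D}}_{\lambda^{(0)}},$$ which also has coefficients in $S$.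
   Formalization: The ℓ exponents belonging to the η_k are proved to be 2ℓ−3 instead of the stated 2ℓ−2: h_k/(2x_k) and θ_{(0,0)}/x_k have degree 2ℓ−3, and for ℓ=2 the true exponents are 1, 1, 2, not 2, 2, 2. -}

module Defs where

open import Algebra.Bundles using (CommutativeRing; Semiring)
open import Algebra.Structures using (IsCommutativeRing)
import Algebra.Consequences.Setoid as Consequences
import Algebra.Definitions.RawSemiring as RawSemiringDefs
import Algebra.Properties.Monoid.Sum as MonoidSum
import Algebra.Properties.CommutativeSemigroup as CommutativeSemigroupProperties
import Algebra.Properties.Semiring.Exp as ExpProperties
import Algebra.Properties.Ring as RingProperties
open import Data.Bool.Base using (if_then_else_)
open import Data.Empty using (⊥)
open import Data.Fin.Base as Fin using (Fin; zero; suc)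
import Data.Fin.Properties as Fin
open import Data.Integer.Base as ℤ using (ℤ; +_; -[1+_])
open import Data.List.Base
  using (List; []; _∷_; _++_; [_]; map; foldr; filter; length; lookup;
         allFin; upTo; replicate; cartesianProduct)
open import Data.List.Relation.Binary.Permutation.Propositional using (_↭_)
open import Data.List.Relation.Binary.Pointwise using (Pointwise)
open import Data.List.Relation.Unary.All using (All)
open import Data.Nat.Base as ℕ using (ℕ; zero; suc; _∸_; _!)
import Data.Nat.Properties as ℕ
open import Data.Product.Base using (∃; _×_; _,_; proj₁; proj₂)
open import Data.Rational.Base as ℚ using (ℚ; 0ℚ; 1ℚ; ½; ∣_∣; _<_; 1/_)
import Data.Rational.Properties as ℚ
import Data.Rational.Solver as ℚSolver
open import Data.Sum.Base using (_⊎_; inj₁; inj₂)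
open import Data.Vec.Base as Vec using (Vec; []; _∷_)
import Data.Vec.Properties as Vec
open import Function.Base using (_∘_)
open import Level using (0ℓ)
open import Relation.Binary.Bundles using (Setoid)
open import Relation.Binary.Core using (Rel)
open import Relation.Binary.Structures using (IsEquivalence)
import Relation.Binary.Reasoning.Setoid as SetoidReasoning
open import Relation.Binary.PropositionalEquality
  using (_≡_; refl; sym; trans; cong; cong₂; subst; subst₂)
open import Relation.Nullary using (¬_; does)
open import Relation.Nullary.Decidable using (_×-dec_; ¬?)
open import Relation.Unary using (Pred)

CRing : Set₁
CRing = CommutativeRing 0ℓ 0ℓ

------------------------------------------------------------------------
-- The real numbers: Cauchy sequences of rationals (with modulus), where
-- two sequences are equal when their difference tends to 0.

-- A single partial equivalence relation gives both notions: x ∼ x says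
-- that x is Cauchy, and for Cauchy x and y, x ∼ y says that x - y → 0.

infix 4 _∼_

_∼_ : Rel (ℕ → ℚ) 0ℓ
x ∼ y = ∀ {ε} → 0ℚ < ε →
  ∃ λ N → ∀ {m n} → N ℕ.≤ m → N ℕ.≤ n → ∣ x m ℚ.- y n ∣ < ε

record ℝ : Set where
  constructor _,_
  field
    seq    : ℕ → ℚ
    cauchy : seq ∼ seq
open ℝ public

infix 4 _≈ℝ_

_≈ℝ_ : Rel ℝ 0ℓ
x ≈ℝ y = seq x ∼ seq y

private
  variable
    x y z u v : ℕ → ℚ

  ½-pos : ∀ {ε} → 0ℚ < ε → 0ℚ < ½ ℚ.* ε
  ½-pos {ε} 0<ε = subst (_< ½ ℚ.* ε) (ℚ.*-zeroʳ ½) (ℚ.*-monoʳ-<-pos ½ 0<ε)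

  halves : ∀ ε → ½ ℚ.* ε ℚ.+ ½ ℚ.* ε ≡ ε
  halves ε = trans (sym (ℚ.*-distribʳ-+ ε ½ ½)) (ℚ.*-identityˡ ε)

  ∣+∣< : ∀ {a b ε} → ∣ a ∣ < ½ ℚ.* ε → ∣ b ∣ < ½ ℚ.* ε → ∣ a ℚ.+ b ∣ < ε
  ∣+∣< {a} {b} {ε} p q =
    subst (∣ a ℚ.+ b ∣ <_) (halves ε)
      (ℚ.≤-<-trans (ℚ.∣p+q∣≤∣p∣+∣q∣ a b) (ℚ.+-mono-< p q))

  ⊔ˡ : ∀ {a b k} → a ℕ.⊔ b ℕ.≤ k → a ℕ.≤ k
  ⊔ˡ {a} {b} = ℕ.≤-trans (ℕ.m≤m⊔n a b)

  ⊔ʳ : ∀ {a b k} → a ℕ.⊔ b ℕ.≤ k → b ℕ.≤ k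
  ⊔ʳ {a} {b} = ℕ.≤-trans (ℕ.m≤n⊔m a b)

  flip-- : ∀ p q → ∣ p ℚ.- q ∣ ≡ ∣ q ℚ.- p ∣
  flip-- p q = trans (sym (ℚ.∣-p∣≡∣p∣ (p ℚ.- q)))
    (cong ∣_∣ (solve 2 (λ p q → :- (p :- q) := q :- p) refl p q))
    where open ℚSolver.+-*-Solver

  ∼-sym : x ∼ y → y ∼ x
  ∼-sym {x} {y} p 0<ε = let N , h = p 0<ε in
    N , λ {m} {n} N≤m N≤n →
      subst (_< _) (flip-- (x n) (y m)) (h N≤n N≤m)

  ∼-trans : x ∼ y → y ∼ z → x ∼ z
  ∼-trans {x} {y} {z} p q 0<ε =
    let N , h = p (½-pos 0<ε)
        K , k = q (½-pos 0<ε)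
    in N ℕ.⊔ K , λ {m} {n} hm hn →
      subst (λ w → ∣ w ∣ < _)
        (solve 3 (λ a b c → (a :- b) :+ (b :- c) := a :- c) refl (x m) (y m) (z n))
        (∣+∣< (h (⊔ˡ hm) (⊔ˡ hm)) (k (⊔ʳ hm) (⊔ʳ hn)))
    where open ℚSolver.+-*-Solver

  ∼-pointwise : x ∼ x → (∀ n → x n ≡ y n) → x ∼ y
  ∼-pointwise {x} p e 0<ε = let N , h = p 0<ε in
    N , λ {m} {n} hm hn → subst (λ w → ∣ x m ℚ.- w ∣ < _) (e n) (h hm hn)

  ∼-const : ∀ q → (λ _ → q) ∼ (λ _ → q)
  ∼-const q 0<ε = 0 , λ _ _ →
    subst (λ w → ∣ w ∣ < _) (sym (ℚ.+-inverseʳ q)) 0<ε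

  ∼-+ : x ∼ y → u ∼ v → (λ n → x n ℚ.+ u n) ∼ (λ n → y n ℚ.+ v n)
  ∼-+ {x} {y} {u} {v} p q 0<ε =
    let N , h = p (½-pos 0<ε)
        K , k = q (½-pos 0<ε)
    in N ℕ.⊔ K , λ {m} {n} hm hn →
      subst (λ w → ∣ w ∣ < _)
        (solve 4 (λ a b c d → (a :- b) :+ (c :- d) := (a :+ c) :- (b :+ d))
          refl (x m) (y n) (u m) (v n))
        (∣+∣< (h (⊔ˡ hm) (⊔ˡ hn)) (k (⊔ʳ hm) (⊔ʳ hn)))
    where open ℚSolver.+-*-Solver

  ∼-neg : x ∼ y → (λ n → ℚ.- x n) ∼ (λ n → ℚ.- y n)
  ∼-neg {x} {y} p 0<ε = let N , h = p 0<ε in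
    N , λ {m} {n} hm hn →
      subst (_< _)
        (trans (flip-- (x m) (y n))
          (cong ∣_∣ (solve 2 (λ a b → b :- a := (:- a) :- (:- b)) refl (x m) (y n))))
        (h hm hn)
    where open ℚSolver.+-*-Solver

  Bounded : (ℕ → ℚ) → Set
  Bounded x = ∃ λ B → 0ℚ < B × ∃ λ N → ∀ {n} → N ℕ.≤ n → ∣ x n ∣ < B

  bounded : x ∼ x → Bounded x
  bounded {x} p =
    let N , h = p (ℚ.positive⁻¹ 1ℚ)
        B = 1ℚ ℚ.+ ∣ x N ∣
        0<B = subst (_< B) (ℚ.+-identityˡ 0ℚ)
                (ℚ.+-mono-<-≤ (ℚ.positive⁻¹ 1ℚ) (ℚ.0≤∣p∣ (x N)))
    in B , 0<B , N , λ {n} N≤n →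
      subst (λ w → ∣ w ∣ < B)
        (solve 2 (λ a b → (a :- b) :+ b := a) refl (x n) (x N))
        (ℚ.≤-<-trans (ℚ.∣p+q∣≤∣p∣+∣q∣ (x n ℚ.- x N) (x N))
          (ℚ.+-monoˡ-< ∣ x N ∣ (h N≤n ℕ.≤-refl)))
    where open ℚSolver.+-*-Solver

  -- If ∣ b ∣ < B then ∣ a ∣ < ε / B suffices for ∣ a * b ∣ < ε.
  quotient : ∀ {ε B} → 0ℚ < ε → 0ℚ < B → ∃ λ δ → 0ℚ < δ ×
    (∀ {a b} → ∣ a ∣ < δ → ∣ b ∣ < B → ∣ a ℚ.* b ∣ < ε)
  quotient {ε} {B} 0<ε 0<B = δ , 0<δ , bound
    where
    instance
      _ = ℚ.positive 0<ε
      _ = ℚ.positive 0<B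
      _ = ℚ.pos⇒nonZero B
      _ = ℚ.1/pos⇒pos B
      _ = ℚ.pos⇒nonNeg B
    δ = ε ℚ.* 1/ B
    0<δ : 0ℚ < δ
    0<δ = ℚ.positive⁻¹ δ {{ℚ.pos*pos⇒pos ε (1/ B)}}
    δB≡ε : δ ℚ.* B ≡ ε
    δB≡ε = trans (ℚ.*-assoc ε (1/ B) B)
      (trans (cong (ε ℚ.*_) (ℚ.*-inverseˡ B)) (ℚ.*-identityʳ ε))
    bound : ∀ {a b} → ∣ a ∣ < δ → ∣ b ∣ < B → ∣ a ℚ.* b ∣ < ε
    bound {a} {b} a<δ b<B =
      subst₂ _<_ (sym (ℚ.∣p*q∣≡∣p∣*∣q∣ a b)) δB≡ε
        (ℚ.≤-<-trans
          (ℚ.*-monoˡ-≤-nonNeg ∣ a ∣ {{ℚ.∣-∣-nonNeg a}} (ℚ.<⇒≤ b<B))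
          (ℚ.*-monoˡ-<-pos B a<δ))

  ∼-* : x ∼ y → u ∼ v → (λ n → x n ℚ.* u n) ∼ (λ n → y n ℚ.* v n)
  ∼-* {x} {y} {u} {v} p q 0<ε =
    let B , 0<B , N₁ , b = bounded {u} (∼-trans {u} {v} {u} q (∼-sym {u} {v} q))
        C , 0<C , N₂ , c = bounded {y} (∼-trans {y} {x} {y} (∼-sym {x} {y} p) p)
        δ , 0<δ , f = quotient (½-pos 0<ε) 0<B
        η , 0<η , g = quotient (½-pos 0<ε) 0<C
        N₃ , h = p 0<δ
        N₄ , k = q 0<η
    in (N₁ ℕ.⊔ N₂) ℕ.⊔ (N₃ ℕ.⊔ N₄) , λ {m} {n} hm hn →
      subst (λ w → ∣ w ∣ < _)
        (solve 4 (λ a b c d → (a :- b) :* c :+ (c :- d) :* b := a :* c :- b :* d)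
          refl (x m) (y n) (u m) (v n))
        (∣+∣<
          (f {x m ℚ.- y n} {u m}
            (h (⊔ˡ (⊔ʳ {N₁ ℕ.⊔ N₂} hm)) (⊔ˡ (⊔ʳ {N₁ ℕ.⊔ N₂} hn)))
            (b (⊔ˡ {N₁} (⊔ˡ hm))))
          (g {u m ℚ.- v n} {y n}
            (k (⊔ʳ (⊔ʳ {N₁ ℕ.⊔ N₂} hm)) (⊔ʳ (⊔ʳ {N₁ ℕ.⊔ N₂} hn)))
            (c (⊔ʳ {N₁} (⊔ˡ hn)))))
    where open ℚSolver.+-*-Solver

fromℚ : ℚ → ℝ
fromℚ q = (λ _ → q) , ∼-const q

infixl 6 _+ℝ_
infixl 7 _*ℝ_
infix  8 -ℝ_

_+ℝ_ _*ℝ_ : ℝ → ℝ → ℝ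
(x , p) +ℝ (y , q) = (λ n → x n ℚ.+ y n) , ∼-+ {x} {x} {y} {y} p q
(x , p) *ℝ (y , q) = (λ n → x n ℚ.* y n) , ∼-* {x} {x} {y} {y} p q

-ℝ_ : ℝ → ℝ
-ℝ (x , p) = (λ n → ℚ.- x n) , ∼-neg {x} {x} p

private
  pointwise : ∀ a b → (∀ n → seq a n ≡ seq b n) → a ≈ℝ b
  pointwise a b = ∼-pointwise {seq a} {seq b} (cauchy a)

  ℝ-isCommutativeRing : IsCommutativeRing _≈ℝ_ _+ℝ_ _*ℝ_ -ℝ_ (fromℚ 0ℚ) (fromℚ 1ℚ)
  ℝ-isCommutativeRing = record
    { isRing = record
      { +-isAbelianGroup = record
        { isGroup = record
          { isMonoid = record
            { isSemigroup = record
              { isMagma = record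
                { isEquivalence = record
                  { refl  = λ {a} → cauchy a
                  ; sym   = λ {a} {b} → ∼-sym {seq a} {seq b}
                  ; trans = λ {a} {b} {c} → ∼-trans {seq a} {seq b} {seq c}
                  }
                ; ∙-cong = λ {a} {b} {c} {d} → ∼-+ {seq a} {seq b} {seq c} {seq d}
                }
              ; assoc = λ a b c → pointwise (a +ℝ b +ℝ c) (a +ℝ (b +ℝ c))
                  (λ n → ℚ.+-assoc (seq a n) (seq b n) (seq c n))
              }
            ; identity =
                (λ a → pointwise (fromℚ 0ℚ +ℝ a) a (λ n → ℚ.+-identityˡ (seq a n))) ,
                (λ a → pointwise (a +ℝ fromℚ 0ℚ) a (λ n → ℚ.+-identityʳ (seq a n)))
            }
          ; inverse =
              (λ a → pointwise (-ℝ a +ℝ a) (fromℚ 0ℚ) (λ n → ℚ.+-inverseˡ (seq a n))) ,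
              (λ a → pointwise (a +ℝ -ℝ a) (fromℚ 0ℚ) (λ n → ℚ.+-inverseʳ (seq a n)))
          ; ⁻¹-cong = λ {a} {b} → ∼-neg {seq a} {seq b}
          }
        ; comm = λ a b → pointwise (a +ℝ b) (b +ℝ a)
            (λ n → ℚ.+-comm (seq a n) (seq b n))
        }
      ; *-cong = λ {a} {b} {c} {d} → ∼-* {seq a} {seq b} {seq c} {seq d}
      ; *-assoc = λ a b c → pointwise (a *ℝ b *ℝ c) (a *ℝ (b *ℝ c))
          (λ n → ℚ.*-assoc (seq a n) (seq b n) (seq c n))
      ; *-identity =
          (λ a → pointwise (fromℚ 1ℚ *ℝ a) a (λ n → ℚ.*-identityˡ (seq a n))) ,
          (λ a → pointwise (a *ℝ fromℚ 1ℚ) a (λ n → ℚ.*-identityʳ (seq a n)))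
      ; distrib =
          (λ a b c → pointwise (a *ℝ (b +ℝ c)) (a *ℝ b +ℝ a *ℝ c)
            (λ n → ℚ.*-distribˡ-+ (seq a n) (seq b n) (seq c n))) ,
          (λ a b c → pointwise ((b +ℝ c) *ℝ a) (b *ℝ a +ℝ c *ℝ a)
            (λ n → ℚ.*-distribʳ-+ (seq a n) (seq b n) (seq c n)))
      }
    ; *-comm = λ a b → pointwise (a *ℝ b) (b *ℝ a)
        (λ n → ℚ.*-comm (seq a n) (seq b n))
    }

ℝ-ring : CRing
ℝ-ring = record { isCommutativeRing = ℝ-isCommutativeRing }

------------------------------------------------------------------------
-- The commutative R-algebra presented by generators X and relations E:
-- ring expressions modulo the least congruence containing E, the
-- commutative ring axioms and the ring operations of R.

infixl 6 _⊕_
infixl 7 _⊗_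
infix  8 ⊝_

data Term (A X : Set) : Set where
  con     : A → Term A X
  var     : X → Term A X
  _⊕_ _⊗_ : (p q : Term A X) → Term A X
  ⊝_      : (p : Term A X) → Term A X

module Presentation (R : CRing) (X : Set)
                    (E : Rel (Term (CommutativeRing.Carrier R) X) 0ℓ) where

  open CommutativeRing R using (Carrier; _≈_; _+_; _*_; 0#; 1#)

  infix 4 _≋_

  data _≋_ : Rel (Term Carrier X) 0ℓ where
    relation  : ∀ {p q} → E p q → p ≋ q
    ≋-refl    : ∀ {p} → p ≋ p
    ≋-sym     : ∀ {p q} → p ≋ q → q ≋ p
    ≋-trans   : ∀ {p q r} → p ≋ q → q ≋ r → p ≋ r
    ⊕-cong    : ∀ {p q r s} → p ≋ q → r ≋ s → p ⊕ r ≋ q ⊕ s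
    ⊗-cong    : ∀ {p q r s} → p ≋ q → r ≋ s → p ⊗ r ≋ q ⊗ s
    ⊝-cong    : ∀ {p q} → p ≋ q → ⊝ p ≋ ⊝ q
    con-cong  : ∀ {a b} → a ≈ b → con a ≋ con b
    con-+     : ∀ a b → con (a + b) ≋ con a ⊕ con b
    con-*     : ∀ a b → con (a * b) ≋ con a ⊗ con b
    ⊕-assoc   : ∀ p q r → (p ⊕ q) ⊕ r ≋ p ⊕ (q ⊕ r)
    ⊕-comm    : ∀ p q → p ⊕ q ≋ q ⊕ p
    ⊕-idˡ     : ∀ p → con 0# ⊕ p ≋ p
    ⊝-invˡ    : ∀ p → ⊝ p ⊕ p ≋ con 0#
    ⊗-assoc   : ∀ p q r → (p ⊗ q) ⊗ r ≋ p ⊗ (q ⊗ r)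
    ⊗-comm    : ∀ p q → p ⊗ q ≋ q ⊗ p
    ⊗-idˡ     : ∀ p → con 1# ⊗ p ≋ p
    distribˡ  : ∀ p q r → p ⊗ (q ⊕ r) ≋ (p ⊗ q) ⊕ (p ⊗ r)

  algebra : CRing
  algebra = record
    { Carrier = Term Carrier X
    ; _≈_ = _≋_ ; _+_ = _⊕_ ; _*_ = _⊗_ ; -_ = ⊝_
    ; 0# = con 0# ; 1# = con 1#
    ; isCommutativeRing = record
      { isRing = record
        { +-isAbelianGroup = record
          { isGroup = record
            { isMonoid = record
              { isSemigroup = record
                { isMagma = record
                  { isEquivalence = ≋-isEquivalence ; ∙-cong = ⊕-cong }
                ; assoc = ⊕-assoc }
              ; identity = C.comm∧idˡ⇒id ⊕-comm ⊕-idˡ }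
            ; inverse = C.comm∧invˡ⇒inv ⊕-comm ⊝-invˡ
            ; ⁻¹-cong = ⊝-cong }
          ; comm = ⊕-comm }
        ; *-cong = ⊗-cong
        ; *-assoc = ⊗-assoc
        ; *-identity = C.comm∧idˡ⇒id ⊗-comm ⊗-idˡ
        ; distrib = C.comm∧distrˡ⇒distr ⊕-cong ⊗-comm distribˡ }
      ; *-comm = ⊗-comm } }
    where
    ≋-isEquivalence : IsEquivalence _≋_
    ≋-isEquivalence = record { refl = ≋-refl ; sym = ≋-sym ; trans = ≋-trans }
    ≋-setoid : Setoid 0ℓ 0ℓ
    ≋-setoid = record { isEquivalence = ≋-isEquivalence }
    module C = Consequences ≋-setoid

-- R[x₁,…,xₙ]
polynomialRing : CRing → ℕ → CRing
polynomialRing R n = Presentation.algebra R (Fin n) (λ _ _ → ⊥)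

data Inverse {A I : Set} (one : A) : Rel (Term A (I ⊎ I)) 0ℓ where
  inverse : ∀ i → Inverse one (var (inj₁ i) ⊗ var (inj₂ i)) (con one)

-- R[x₁^±¹,…,xₙ^±¹]: the generator inj₁ i is xᵢ and inj₂ i is xᵢ⁻¹.
laurentRing : CRing → ℕ → CRing
laurentRing R n =
  Presentation.algebra R (Fin n ⊎ Fin n) (Inverse (CommutativeRing.1# R))

evaluate : ∀ {A X} (B : CRing) → let open CommutativeRing B in
           (A → Carrier) → (X → Carrier) → Term A X → Carrier
evaluate B f ρ = go
  where
  open CommutativeRing B
  go : Term _ _ → Carrier
  go (con a) = f a
  go (var i) = ρ i
  go (p ⊕ q) = go p + go q
  go (p ⊗ q) = go p * go q
  go (⊝ p)   = - go p

module Ring (R : CRing) where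
  open CommutativeRing R public
    renaming (refl to ≈-refl; sym to ≈-sym; trans to ≈-trans) hiding (zero)
  open Semiring semiring using (rawSemiring)
  open RawSemiringDefs rawSemiring public using (_^_)
  open MonoidSum +-monoid public using (sum)

  Σ[_] Π[_] : List Carrier → Carrier
  Σ[ ps ] = foldr _+_ 0# ps
  Π[ ps ] = foldr _*_ 1# ps

  det₂ : (Fin 2 → Fin 2 → Carrier) → Carrier
  det₂ M = M zero zero * M (suc zero) (suc zero) - M zero (suc zero) * M (suc zero) zero

S : ℕ → CRing
S ℓ = polynomialRing ℝ-ring ℓ

-- The Laurent polynomial ring in x₁,…,x_ℓ, containing S via ι.
L : ℕ → CRing
L ℓ = laurentRing ℝ-ring ℓ

∣S∣ ∣L∣ : ℕ → Set
∣S∣ ℓ = CommutativeRing.Carrier (S ℓ)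
∣L∣ ℓ = CommutativeRing.Carrier (L ℓ)

ι : ∀ {ℓ} → ∣S∣ ℓ → ∣L∣ ℓ
ι {ℓ} = evaluate (L ℓ) con (var ∘ inj₁)

∂ : ∀ {ℓ} → Fin ℓ → ∣S∣ ℓ → ∣S∣ ℓ
∂ i (con _) = con (fromℚ 0ℚ)
∂ i (var j) = if does (i Fin.≟ j) then con (fromℚ 1ℚ) else con (fromℚ 0ℚ)
∂ i (p ⊕ q) = ∂ i p ⊕ ∂ i q
∂ i (p ⊗ q) = (∂ i p ⊗ q) ⊕ (p ⊗ ∂ i q)
∂ i (⊝ p)   = ⊝ ∂ i p

------------------------------------------------------------------------
-- Multi-indices α ∈ ℕ^ℓ with ∣α∣ = d: 0∷ α has first exponent 0, and
-- 1+ α is α with its first exponent increased by one.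

data MultiIndex : ℕ → ℕ → Set where
  []  : MultiIndex 0 0
  0∷_ : ∀ {ℓ d} → MultiIndex ℓ d → MultiIndex (suc ℓ) d
  1+_ : ∀ {ℓ d} → MultiIndex (suc ℓ) d → MultiIndex (suc ℓ) (suc d)

exponents : ∀ {ℓ d} → MultiIndex ℓ d → Vec ℕ ℓ
exponents []     = []
exponents (0∷ α) = 0 ∷ exponents α
exponents (1+ α) = suc (Vec.head (exponents α)) ∷ Vec.tail (exponents α)

-- The indices i listed in increasing order, each αᵢ times.
indices : ∀ {ℓ d} → MultiIndex ℓ d → Vec (Fin ℓ) d
indices []     = []
indices (0∷ α) = Vec.map suc (indices α)
indices (1+ α) = zero ∷ indices α

multiIndices : ∀ ℓ d → List (MultiIndex ℓ d)
multiIndices zero    zero    = [ [] ]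
multiIndices zero    (suc d) = []
multiIndices (suc ℓ) zero    = map 0∷_ (multiIndices ℓ zero)
multiIndices (suc ℓ) (suc d) =
  map 0∷_ (multiIndices ℓ (suc d)) ++ map 1+_ (multiIndices (suc ℓ) d)

reciprocalFactorial : ∀ {ℓ d} → MultiIndex ℓ d → ℝ
reciprocalFactorial α = fromℚ (Vec.foldr _ ℚ._*_ 1ℚ (Vec.map 1/! (exponents α)))
  where
  1/! : ℕ → ℚ
  1/! k = ℚ._/_ (+ 1) (k !) {{k ℕ.!≢0}}

------------------------------------------------------------------------
-- D^(m): the operators Σ_{∣α∣=m} f_α ∂^α, given by their coefficients

Operator : ℕ → ℕ → Set → Set
Operator ℓ m A = MultiIndex ℓ m → A

module _ {ℓ m : ℕ} where
  open Ring (S ℓ)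

  ∂^ : MultiIndex ℓ m → ∣S∣ ℓ → ∣S∣ ℓ
  ∂^ α f = Vec.foldr _ ∂ f (indices α)

  infixr 7 _•_
  _•_ : Operator ℓ m (∣S∣ ℓ) → ∣S∣ ℓ → ∣S∣ ℓ
  θ • f = Σ[ map (λ α → θ α * ∂^ α f) (multiIndices ℓ m) ]

  monomial : ∀ {d} → MultiIndex ℓ d → ∣S∣ ℓ
  monomial β = Vec.foldr _ _*_ 1# (Vec.map var (indices β))

  -- D^(m)(𝒜) for the arrangement with defining polynomial Q
  Preserves : ∣S∣ ℓ → Pred (Operator ℓ m (∣S∣ ℓ)) 0ℓ
  Preserves Q θ = ∀ f → ∃ λ g → θ • (Q * f) ≈ Q * g

  -- f is zero or homogeneous of degree d
  HomogeneousOrZero : ℕ → ∣S∣ ℓ → Set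
  HomogeneousOrZero d f = ∃ λ (c : MultiIndex ℓ d → ℝ) →
    f ≈ Σ[ map (λ β → con (c β) * monomial β) (multiIndices ℓ d) ]

  IsHomogeneous : Operator ℓ m (∣S∣ ℓ) → ℕ → Set
  IsHomogeneous θ d = ¬ (∀ α → θ α ≈ 0#) × (∀ α → HomogeneousOrZero d (θ α))

  combination : (B : List (Operator ℓ m (∣S∣ ℓ))) →
                (Fin (length B) → ∣S∣ ℓ) → Operator ℓ m (∣S∣ ℓ)
  combination B c α = sum (λ i → c i * lookup B i α)

  -- B, as a family, is a basis of the S-submodule M of D^(m)(S).
  record IsBasis (M : Pred (Operator ℓ m (∣S∣ ℓ)) 0ℓ)
                 (B : List (Operator ℓ m (∣S∣ ℓ))) : Set where
    field
      belongs     : All M B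
      spans       : ∀ θ → M θ → ∃ λ c → ∀ α → θ α ≈ combination B c α
      independent : ∀ c → (∀ α → combination B c α ≈ 0#) → ∀ i → c i ≈ 0#

  IsHomogeneousBasis : Pred (Operator ℓ m (∣S∣ ℓ)) 0ℓ →
                       List (Operator ℓ m (∣S∣ ℓ)) → List ℕ → Set
  IsHomogeneousBasis M B ds = IsBasis M B × Pointwise IsHomogeneous B ds

  -- exp M = ds, as multisets: a homogeneous basis with degrees ds exists, and
  -- the degrees do not depend on the homogeneous basis.
  record HasExponents (M : Pred (Operator ℓ m (∣S∣ ℓ)) 0ℓ) (ds : List ℕ) : Set where
    field
      exists : ∃ λ B → IsHomogeneousBasis M B ds
      unique : ∀ B ds′ → IsHomogeneousBasis M B ds′ → ds′ ↭ ds

  -- θ ∈ D^(m)(S) is the operator χ with Laurent polynomial coefficients.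
  _Represents_ : Operator ℓ m (∣S∣ ℓ) → Operator ℓ m (∣L∣ ℓ) → Set
  θ Represents χ = ∀ α → CommutativeRing._≈_ (L ℓ) (ι (θ α)) (χ α)

------------------------------------------------------------------------
-- The arrangement of type D

module _ (ℓ : ℕ) where
  open Ring (S ℓ)

  -- xᵢ² - xⱼ²
  factor : Fin ℓ → Fin ℓ → ∣S∣ ℓ
  factor i j = var i ^ 2 - var j ^ 2

  Q𝒟 : ∣S∣ ℓ
  Q𝒟 = Π[ map (λ (i , j) → factor i j)
             (filter (λ (i , j) → i Fin.<? j) (cartesianProduct (allFin ℓ) (allFin ℓ))) ]

  D²𝒟 : Pred (Operator ℓ 2 (∣S∣ ℓ)) 0ℓ
  D²𝒟 = Preserves Q𝒟

  h𝒟 : Fin ℓ → ∣S∣ ℓ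
  h𝒟 k = Π[ map (factor k) (filter (λ i → ¬? (i Fin.≟ k)) (allFin ℓ)) ]

-- Pairs (λ₁ , λ₂); all entries that occur are non-negative.
Λ : ℕ → List (ℕ × ℕ)
Λ ℓ = filter (λ (λ₁ , λ₂) → (λ₁ ℕ.≤? ℓ ∸ 2) ×-dec (λ₂ ℕ.≤? λ₁))
             (cartesianProduct (upTo ℓ) (upTo ℓ))

------------------------------------------------------------------------
-- In a commutative ring T - U divides T^p U^q - T^q U^p.

module _ (R : CRing) where
  open Ring R
  open RingProperties ring
  open CommutativeSemigroupProperties *-commutativeSemigroup using (interchange)
  open SetoidReasoning setoid

  private
    telescope : ∀ a b c → (a - b) + (b - c) ≈ a - c
    telescope a b c = begin
      (a - b) + (b - c)     ≈⟨ +-assoc a (- b) (b - c) ⟩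
      a + (- b + (b - c))   ≈⟨ +-congˡ (+-assoc (- b) b (- c)) ⟨
      a + ((- b + b) - c)   ≈⟨ +-congˡ (+-congʳ (-‿inverseˡ b)) ⟩
      a + (0# - c)          ≈⟨ +-congˡ (+-identityˡ (- c)) ⟩
      a - c                 ∎

    minus-cong : ∀ {a b c d} → a ≈ b → c ≈ d → a - c ≈ b - d
    minus-cong p q = +-cong p (-‿cong q)

    powers : ∀ T U n → ∃ λ g → g * (T - U) ≈ T ^ n - U ^ n
    powers T U zero    = 0# , ≈-trans (zeroˡ (T - U)) (≈-sym (-‿inverseʳ 1#))
    powers T U (suc n) = let g , eq = powers T U n in T ^ n + U * g , (begin
      (T ^ n + U * g) * (T - U)                  ≈⟨ distribʳ (T - U) (T ^ n) (U * g) ⟩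
      T ^ n * (T - U) + U * g * (T - U)          ≈⟨ +-cong (x[y-z]≈xy-xz (T ^ n) T U) (*-assoc U g (T - U)) ⟩
      (T ^ n * T - T ^ n * U) + U * (g * (T - U)) ≈⟨ +-congˡ (*-congˡ eq) ⟩
      (T ^ n * T - T ^ n * U) + U * (T ^ n - U ^ n) ≈⟨ +-cong (minus-cong (*-comm (T ^ n) T) (*-comm (T ^ n) U)) (x[y-z]≈xy-xz U (T ^ n) (U ^ n)) ⟩
      (T * T ^ n - U * T ^ n) + (U * T ^ n - U * U ^ n) ≈⟨ telescope _ _ _ ⟩
      T * T ^ n - U * U ^ n ∎)

  alternating : ∀ T U p q → ∃ λ g → g * (T - U) ≈ T ^ p * U ^ q - T ^ q * U ^ p
  alternating T U zero q = let g , eq = powers T U q in - g , (begin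
    - g * (T - U)               ≈⟨ -‿distribˡ-* g (T - U) ⟨
    - (g * (T - U))             ≈⟨ -‿cong eq ⟩
    - (T ^ q - U ^ q)           ≈⟨ ⁻¹-anti-homo‿- (T ^ q) (U ^ q) ⟩
    U ^ q - T ^ q               ≈⟨ minus-cong (*-identityˡ (U ^ q)) (*-identityʳ (T ^ q)) ⟨
    1# * U ^ q - T ^ q * 1#     ∎)
  alternating T U (suc p) zero = let g , eq = powers T U (suc p) in g ,
    ≈-trans eq (≈-sym (minus-cong (*-identityʳ _) (*-identityˡ _)))
  alternating T U (suc p) (suc q) =
    let g , eq = alternating T U p q in T * U * g , (begin
    T * U * g * (T - U)                        ≈⟨ *-assoc (T * U) g (T - U) ⟩
    T * U * (g * (T - U))                      ≈⟨ *-congˡ eq ⟩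
    T * U * (T ^ p * U ^ q - T ^ q * U ^ p)    ≈⟨ x[y-z]≈xy-xz (T * U) _ _ ⟩
    T * U * (T ^ p * U ^ q) - T * U * (T ^ q * U ^ p)
      ≈⟨ minus-cong (interchange T U _ _) (interchange T U _ _) ⟩
    T ^ suc p * U ^ suc q - T ^ suc q * U ^ suc p ∎)

------------------------------------------------------------------------
-- The symmetric Laurent polynomials s_λ, over a ring R of constants

module Schur (R : CRing) where
  open Ring (laurentRing R 2)
  open RingProperties ring
  open ExpProperties semiring using (^-assocʳ)
  open CommutativeSemigroupProperties *-commutativeSemigroup using (interchange)
  open SetoidReasoning setoid

  t t⁻¹ : Fin 2 → Carrier
  t   i = var (inj₁ i)
  t⁻¹ i = var (inj₂ i)

  infix 8 t_^ᶻ_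
  t_^ᶻ_ : Fin 2 → ℤ → Carrier
  t i ^ᶻ (+ n)    = t i ^ n
  t i ^ᶻ -[1+ n ] = t⁻¹ i ^ suc n

  part : ℕ × ℕ → Fin 2 → ℕ
  part (λ₁ , λ₂) zero       = λ₁
  part (λ₁ , λ₂) (suc zero) = λ₂

  -- 2 - j, where the column j : Fin 2 counts from 0 instead of 1.
  2-_ : Fin 2 → ℕ
  2- j = 1 ∸ Fin.toℕ j

  numerator : ℕ × ℕ → Carrier
  numerator lam = det₂ λ i j → t i ^ᶻ (+ (2 ℕ.* (part lam j ℕ.+ 2- j)) ℤ.- + 1)

  denominator : Carrier
  denominator = det₂ λ i j → t i ^ᶻ (+ (2 ℕ.* 2- j))

  private
    t-inverse : ∀ i → t i * t⁻¹ i ≈ 1#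
    t-inverse i = Presentation.relation (inverse i)

    odd-power : ∀ i e → t i ^ᶻ (+ (2 ℕ.* e) ℤ.- + 1) ≈ (t i ^ 2) ^ e * t⁻¹ i
    odd-power i e = ≈-trans (lower (2 ℕ.* e)) (*-congʳ (≈-sym (^-assocʳ (t i) 2 e)))
      where
      lower : ∀ n → t i ^ᶻ (+ n ℤ.- + 1) ≈ t i ^ n * t⁻¹ i
      lower zero    = *-comm (t⁻¹ i) 1#
      lower (suc n) = begin
        t i ^ n                       ≈⟨ *-identityʳ (t i ^ n) ⟨
        t i ^ n * 1#                  ≈⟨ *-congˡ (t-inverse i) ⟨
        t i ^ n * (t i * t⁻¹ i)       ≈⟨ *-assoc _ _ _ ⟨
        t i ^ n * t i * t⁻¹ i         ≈⟨ *-congʳ (*-comm (t i ^ n) (t i)) ⟩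
        t i ^ suc n * t⁻¹ i           ∎

  -- The denominator is not a zero divisor, so the quotient s_λ is unique.
  quotient-exists : ∀ lam → ∃ λ s → s * denominator ≈ numerator lam
  quotient-exists lam =
    let T = t zero ^ 2
        U = t (suc zero) ^ 2
        τ = t⁻¹ zero
        υ = t⁻¹ (suc zero)
        p = part lam zero ℕ.+ 1
        q = part lam (suc zero) ℕ.+ 0
        g , eq = alternating (laurentRing R 2) T U p q
    in τ * υ * g , (begin
      τ * υ * g * denominator
        ≈⟨ *-congˡ (+-cong (*-identityʳ T) (-‿cong (*-identityˡ U))) ⟩
      τ * υ * g * (T - U)
        ≈⟨ *-assoc (τ * υ) g (T - U) ⟩
      τ * υ * (g * (T - U))
        ≈⟨ *-congˡ eq ⟩
      τ * υ * (T ^ p * U ^ q - T ^ q * U ^ p)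
        ≈⟨ *-comm _ _ ⟩
      (T ^ p * U ^ q - T ^ q * U ^ p) * (τ * υ)
        ≈⟨ [y-z]x≈yx-zx _ _ _ ⟩
      T ^ p * U ^ q * (τ * υ) - T ^ q * U ^ p * (τ * υ)
        ≈⟨ +-cong (interchange _ _ _ _) (-‿cong (interchange _ _ _ _)) ⟩
      T ^ p * τ * (U ^ q * υ) - T ^ q * τ * (U ^ p * υ)
        ≈⟨ +-cong (*-cong (odd-power zero p) (odd-power (suc zero) q))
             (-‿cong (*-cong (odd-power zero q) (odd-power (suc zero) p))) ⟨
      numerator lam ∎)

  s : ℕ × ℕ → Carrier
  s lam = proj₁ (quotient-exists lam)

------------------------------------------------------------------------
-- The operators θ_λ and η_k, with coefficients in L

module _ (ℓ : ℕ) where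
  open Ring (L ℓ)

  X : Carrier
  X = Π[ map (var ∘ inj₁) (allFin ℓ) ]

  -- s_λ(x_α)
  s[_]at_ : ℕ × ℕ → MultiIndex ℓ 2 → Carrier
  s[ lam ]at α = evaluate (L ℓ) ι at (Schur.s (S ℓ) lam)
    where
    at : Fin 2 ⊎ Fin 2 → Carrier
    at (inj₁ i) = var (inj₁ (Vec.lookup (indices α) i))
    at (inj₂ i) = var (inj₂ (Vec.lookup (indices α) i))

  θ : ℕ × ℕ → Operator ℓ 2 Carrier
  θ lam α = s[ lam ]at α * con (reciprocalFactorial α)

  θ𝒟 : ℕ × ℕ → Operator ℓ 2 Carrier
  θ𝒟 lam@(_     , suc _) α = θ lam α
  θ𝒟 lam@(suc _ , zero)  α = X * θ lam α
  θ𝒟 lam@(zero  , zero)  α = X ^ 2 * θ lam α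

  -- ∂ₖ²
  ∂²[_] : Fin ℓ → Operator ℓ 2 Carrier
  ∂²[ k ] α = if does (Vec.≡-dec Fin._≟_ (indices α) (k ∷ k ∷ [])) then 1# else 0#

  η𝒟 : Fin ℓ → Operator ℓ 2 Carrier
  η𝒟 k α = ι (h𝒟 ℓ k) * (con (fromℚ ½) * xₖ⁻¹) * ∂²[ k ] α
             - (- 1#) ^ (ℓ ∸ 1) * xₖ⁻¹ * θ𝒟 (0 , 0) α
    where xₖ⁻¹ = var (inj₂ k)

  C𝒟 : List (Operator ℓ 2 Carrier)
  C𝒟 = map η𝒟 (allFin ℓ) ++ map θ𝒟 (Λ ℓ)

-- η_k has degree 2ℓ - 3: h_k has degree 2ℓ - 2 and is divided by x_k.
exponents𝒟 : ℕ → List ℕ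
exponents𝒟 ℓ =
     replicate ℓ (2 ℕ.* ℓ ∸ 3)
  ++ map (λ (λ₁ , λ₂) → 2 ℕ.* λ₁ ℕ.+ 2 ℕ.* λ₂ ∸ 2) (filter (λ (_ , λ₂) → 1 ℕ.≤? λ₂) (Λ ℓ))
  ++ map (λ λ₁ → 2 ℕ.* λ₁ ∸ 2 ℕ.+ ℓ)
         (filter (λ λ₁ → (1 ℕ.≤? λ₁) ×-dec (λ₁ ℕ.≤? ℓ ∸ 2)) (upTo ℓ))
  ++ [ 2 ℕ.* ℓ ∸ 2 ]

{-# OPTIONS --safe #-}
module Submission where

open import Defs
open import Data.Nat.Base using (ℕ; _≤_)
open import Data.Product.Base using (∃; _×_)
open import Data.List.Relation.Binary.Pointwise using (Pointwise)

open import Algebra.Bundles using (CommutativeRing; RawRing)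
import Algebra.Properties.AbelianGroup as AbelianGroupProperties
import Algebra.Properties.CommutativeSemigroup as CommutativeSemigroupProperties
import Algebra.Properties.Ring as RingProperties
import Algebra.Properties.Semiring.Mult.TCOptimised as SemiringMult
import Algebra.Properties.Semiring.Sum as SemiringSum
import Algebra.Solver.Ring as RingSolver
open import Algebra.Solver.Ring.AlmostCommutativeRing
  using (fromCommutativeRing; _-Raw-AlmostCommutative⟶_)
open import Data.Bool.Base using (true; false; if_then_else_)
open import Data.Empty using (⊥; ⊥-elim)
open import Data.Fin.Base as Fin using (Fin; zero; suc; toℕ; punchIn; punchOut)
import Data.Fin.Properties as Fin
open import Data.List.Base
  using (List; []; _∷_; [_]; _++_; map; filter; length; lookup; tabulate;
         allFin; upTo; replicate; cartesianProduct)
open import Data.List.Membership.Propositional using (_∈_)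
open import Data.List.Membership.Propositional.Properties
  using (∈-allFin; ∈-lookup; ∈-upTo⁺; ∈-map⁺; ∈-map⁻; ∈-filter⁺; ∈-++⁺ˡ; ∈-++⁺ʳ;
         ∈-cartesianProduct⁺; ∈-∃++)
import Data.List.Properties as List
open import Data.List.Relation.Binary.Permutation.Propositional as Perm using (_↭_)
import Data.List.Relation.Binary.Permutation.Propositional.Properties as Perm
open import Data.List.Relation.Binary.Pointwise as Pointwise using ([]; _∷_)
open import Data.List.Relation.Unary.All as All using (All; []; _∷_)
import Data.List.Relation.Unary.All.Properties as All
open import Data.List.Relation.Unary.AllPairs as AllPairs using (AllPairs; []; _∷_)
import Data.List.Relation.Unary.AllPairs.Properties as AllPairs
open import Data.List.Relation.Unary.Any as Any using (here; there)
import Data.List.Relation.Unary.Any.Properties as Any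
open import Data.List.Relation.Unary.Unique.Propositional using (Unique)
import Data.List.Relation.Unary.Unique.Propositional.Properties as Unique
open import Data.Maybe.Base using (Maybe; just; nothing)
open import Data.Nat.Base as ℕ using (zero; suc; 2+; s≤s; z≤n)
import Data.Nat.Properties as ℕ
import Data.Nat.Solver as ℕ
open import Data.Product.Base using (_,_; proj₁; proj₂)
open import Data.Rational.Base as ℚ using (0ℚ; 1ℚ)
import Data.Rational.Properties as ℚ
open import Data.Sum.Base using (_⊎_; inj₁; inj₂)
open import Data.Vec.Base as Vec using (Vec; []; _∷_)
import Data.Vec.Properties as Vec
open import Function.Base using (_∘_)
open import Level using (0ℓ)
open import Relation.Binary.Core using (Rel)
open import Relation.Binary.Definitions using (tri<; tri≈; tri>)
open import Relation.Binary.PropositionalEquality as ≡ using (_≡_; _≢_)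
import Relation.Binary.Reasoning.Setoid as SetoidReasoning
open import Relation.Nullary using (¬_; Dec; yes; no; does)
open import Relation.Nullary.Decidable
  using (_×-dec_; ¬?; dec-true; dec-false; map′; toWitness)

-- Let Gᵢⱼ be the symmetric matrix with 2θ = Σ Gᵢⱼ ∂ᵢ∂ⱼ and put uᵢⱼ = xᵢ xⱼ Gᵢⱼ, Tᵢ = xᵢ². Then
-- θ belongs to D²(𝒟) iff Tᵢ - Tⱼ divides uᵢₖ - uⱼₖ for all i, j, k. Newton interpolation at the
-- points Tᵢ expresses the off-diagonal part of such a matrix as a unique S-linear combination of
-- the Schur polynomials in (Tᵢ , Tⱼ) indexed by Λ, and what then remains at the place (k , k) is
-- divisible by h_k. The further condition that xᵢ xⱼ divides uᵢⱼ forces the coefficients with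
-- λ₂ = 0 to be divisible by x₁⋯x_ℓ, and relates the one of λ = (0 , 0) to those of h_k modulo x_k:
-- this is the correction term of η_k.
--
-- By Euler's formula the matrix relating two homogeneous bases is, at x = 0, block diagonal by
-- degree; a block and its inverse have a product whose trace counts the basis elements of that
-- degree, so both bases have equally many.

-- The rings `S ℓ` and `L ℓ` consist of terms modulo a congruence, over reals without decidable
-- equality, so degrees, coefficients and prime factors cannot be read off. Their role is taken by
-- `Regular m d`: d is not a zero divisor modulo m. Divisibility by products and cancellation modulo
-- a factor follow from it. Regularity itself comes from the substitutions xᵢ := 0 and xᵢ := ± xⱼ,
-- each paired with a twisted derivation that divides by xᵢ - a. The factor xᵢ xⱼ in uᵢⱼ has the
-- following origin: for p = Tᵢ - Tⱼ and f = xₖ, the product of xₖ with θ(p f) - θ(p) f - p θ(f) is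
-- 2 (uᵢₖ - uⱼₖ). Conditions on θ thus become congruences between values at the points Tᵢ, which is
-- what interpolation accepts. The way back to coefficients is division by xᵢ xⱼ α!, a regular
-- element of `S ℓ` and a unit of `L ℓ`. Spanning and independence are shown directly, for an
-- arbitrary enumeration of Λ, because the list of exponents follows another order than Λ.

-- Integer coefficients are kept as differences a - b of naturals (a , b).
module Solver (R : CRing) where
  open Ring R
  open RingProperties ring
  open AbelianGroupProperties +-abelianGroup using (⁻¹-∙-comm)
  open SemiringMult semiring renaming (_×_ to _·_)
  open SetoidReasoning setoid
  open CommutativeSemigroupProperties +-commutativeSemigroup using (interchange)

  private
    ⟪_⟫ : ℕ × ℕ → Carrier
    ⟪ a , b ⟫ = a · 1# - b · 1#

    +-homo : ∀ a b c d → ⟪ a ℕ.+ c , b ℕ.+ d ⟫ ≈ ⟪ a , b ⟫ + ⟪ c , d ⟫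
    +-homo a b c d = begin
      (a ℕ.+ c) · 1# - (b ℕ.+ d) · 1#
        ≈⟨ +-cong (×-homo-+ 1# a c) (-‿cong (×-homo-+ 1# b d)) ⟩
      (a · 1# + c · 1#) - (b · 1# + d · 1#)
        ≈⟨ +-congˡ (⁻¹-∙-comm _ _) ⟨
      (a · 1# + c · 1#) + (- (b · 1#) - d · 1#)
        ≈⟨ interchange _ _ _ _ ⟩
      ⟪ a , b ⟫ + ⟪ c , d ⟫ ∎

    -‿homo : ∀ a b → ⟪ b , a ⟫ ≈ - ⟪ a , b ⟫
    -‿homo a b = ≈-sym (⁻¹-anti-homo‿- _ _)

    scale : ∀ a c d → ⟪ a ℕ.* c , a ℕ.* d ⟫ ≈ a · 1# * ⟪ c , d ⟫
    scale a c d = ≈-trans (+-cong (×1-homo-* a c) (-‿cong (×1-homo-* a d)))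
                          (≈-sym (x[y-z]≈xy-xz _ _ _))

    *-homo : ∀ a b c d →
             ⟪ a ℕ.* c ℕ.+ b ℕ.* d , a ℕ.* d ℕ.+ b ℕ.* c ⟫ ≈ ⟪ a , b ⟫ * ⟪ c , d ⟫
    *-homo a b c d = begin
      ⟪ a ℕ.* c ℕ.+ b ℕ.* d , a ℕ.* d ℕ.+ b ℕ.* c ⟫
        ≈⟨ +-homo (a ℕ.* c) (a ℕ.* d) (b ℕ.* d) (b ℕ.* c) ⟩
      ⟪ a ℕ.* c , a ℕ.* d ⟫ + ⟪ b ℕ.* d , b ℕ.* c ⟫
        ≈⟨ +-cong (scale a c d) (≈-trans (scale b d c) (*-congˡ (-‿homo c d))) ⟩
      a · 1# * ⟪ c , d ⟫ + b · 1# * - ⟪ c , d ⟫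
        ≈⟨ +-congˡ (≈-trans (≈-sym (-‿distribʳ-* _ _)) (-‿distribˡ-* _ _)) ⟩
      a · 1# * ⟪ c , d ⟫ + - (b · 1#) * ⟪ c , d ⟫
        ≈⟨ distribʳ _ _ _ ⟨
      ⟪ a , b ⟫ * ⟪ c , d ⟫ ∎

    -- Equal to ⟪_⟫, but definitionally 0# at 0 and 1# at 1.
    ⟦_⟧ : ℕ × ℕ → Carrier
    ⟦ a , zero ⟧  = a · 1#
    ⟦ a , suc b ⟧ = ⟪ a , suc b ⟫

    difference : ∀ a b → ⟦ a , b ⟧ ≈ ⟪ a , b ⟫
    difference a zero    = ≈-sym (≈-trans (+-congˡ -0#≈0#) (+-identityʳ _))
    difference a (suc b) = ≈-refl

    -- Stripping common successors brings a constant equal to 0 or 1 to the pair (0 , 0) or (1 , 0),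
    -- where `⟦_⟧` reduces to `0#` or `1#` itself.
    normalise : ℕ → ℕ → ℕ × ℕ
    normalise (suc a) (suc b) = normalise a b
    normalise a       b       = a , b

    normalise-homo : ∀ a b → ⟦ normalise a b ⟧ ≈ ⟪ a , b ⟫
    normalise-homo zero    b       = difference zero b
    normalise-homo (suc a) zero    = difference (suc a) zero
    normalise-homo (suc a) (suc b) = ≈-trans (normalise-homo a b) (≈-sym (begin
      ⟪ suc a , suc b ⟫         ≡⟨ ≡.cong₂ (λ m n → ⟪ m , n ⟫) (ℕ.+-comm 1 a) (ℕ.+-comm 1 b) ⟩
      ⟪ a ℕ.+ 1 , b ℕ.+ 1 ⟫     ≈⟨ +-homo a b 1 1 ⟩
      ⟪ a , b ⟫ + ⟪ 1 , 1 ⟫     ≈⟨ +-congˡ (-‿inverseʳ _) ⟩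
      ⟪ a , b ⟫ + 0#            ≈⟨ +-identityʳ _ ⟩
      ⟪ a , b ⟫                 ∎))

    coefficients : RawRing _ _
    coefficients = record
      { Carrier = ℕ × ℕ ; _≈_ = _≡_
      ; _+_ = λ (a , b) (c , d) → normalise (a ℕ.+ c) (b ℕ.+ d)
      ; _*_ = λ (a , b) (c , d) → normalise (a ℕ.* c ℕ.+ b ℕ.* d) (a ℕ.* d ℕ.+ b ℕ.* c)
      ; -_ = λ (a , b) → b , a
      ; 0# = 0 , 0 ; 1# = 1 , 0 }

    morphism : coefficients -Raw-AlmostCommutative⟶ fromCommutativeRing R
    morphism = record
      { ⟦_⟧ = ⟦_⟧
      ; +-homo = λ (a , b) (c , d) → ≈-trans (normalise-homo (a ℕ.+ c) (b ℕ.+ d))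
          (≈-trans (+-homo a b c d) (≈-sym (+-cong (difference a b) (difference c d))))
      ; *-homo = λ (a , b) (c , d) →
          ≈-trans (normalise-homo (a ℕ.* c ℕ.+ b ℕ.* d) (a ℕ.* d ℕ.+ b ℕ.* c))
          (≈-trans (*-homo a b c d) (≈-sym (*-cong (difference a b) (difference c d))))
      ; -‿homo = λ (a , b) → ≈-trans (difference b a)
          (≈-trans (-‿homo a b) (≈-sym (-‿cong (difference a b))))
      ; 0-homo = ≈-refl
      ; 1-homo = ≈-refl }

    _≟_ : ∀ x y → Maybe (⟦ x ⟧ ≈ ⟦ y ⟧)
    (a , b) ≟ (c , d) with a ℕ.+ d ℕ.≟ c ℕ.+ b
    ... | no _   = nothing
    ... | yes eq = just (≈-trans (difference a b) (≈-trans (begin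
      ⟪ a , b ⟫                     ≈⟨ +-identityʳ _ ⟨
      ⟪ a , b ⟫ + 0#                ≈⟨ +-congˡ (-‿inverseʳ (d · 1#)) ⟨
      ⟪ a , b ⟫ + ⟪ d , d ⟫         ≈⟨ +-homo a b d d ⟨
      ⟪ a ℕ.+ d , b ℕ.+ d ⟫         ≡⟨ ≡.cong₂ (λ m n → ⟪ m , n ⟫) eq (ℕ.+-comm b d) ⟩
      ⟪ c ℕ.+ b , d ℕ.+ b ⟫         ≈⟨ +-homo c d b b ⟩
      ⟪ c , d ⟫ + ⟪ b , b ⟫         ≈⟨ +-congˡ (-‿inverseʳ (b · 1#)) ⟩
      ⟪ c , d ⟫ + 0#                ≈⟨ +-identityʳ _ ⟩
      ⟪ c , d ⟫                     ∎) (≈-sym (difference c d))))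

  open CommutativeSemigroupProperties *-commutativeSemigroup public
    using () renaming (x∙yz≈y∙xz to *-swapˡ)

  open RingSolver coefficients (fromCommutativeRing R) morphism _≟_ public
    using (solve; _:=_; _:+_; _:*_; _:-_; :-_; Polynomial)
    renaming (con to lit)

  :0 :1 : ∀ {n} → Polynomial n
  :0 = lit (0 , 0)
  :1 = lit (1 , 0)

-- Divisibility and interpolation in commutative rings

-- The summands are explicit, as they cannot be inferred from a sum.
module Sums (R : CRing) where
  open Ring R
  open RingProperties ring using (-0#≈0#)
  open Solver R
  private module Σ = SemiringSum semiring

  sum-cong : ∀ {n} (f g : Fin n → Carrier) → (∀ i → f i ≈ g i) → sum f ≈ sum g
  sum-cong {zero}  f g eq = ≈-refl
  sum-cong {suc n} f g eq = +-cong (eq zero) (sum-cong (f ∘ suc) (g ∘ suc) (eq ∘ suc))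

  sum-zero : ∀ {n} (f : Fin n → Carrier) → (∀ i → f i ≈ 0#) → sum f ≈ 0#
  sum-zero {zero}  f eq = ≈-refl
  sum-zero {suc n} f eq = ≈-trans (+-cong (eq zero) (sum-zero (f ∘ suc) (eq ∘ suc)))
    (+-identityˡ 0#)

  sum-+ : ∀ {n} (f g : Fin n → Carrier) → sum (λ i → f i + g i) ≈ sum f + sum g
  sum-+ = Σ.∑-distrib-+

  sum-neg : ∀ {n} (f : Fin n → Carrier) → sum (λ i → - f i) ≈ - sum f
  sum-neg {zero}  f = ≈-sym -0#≈0#
  sum-neg {suc n} f = ≈-trans (+-congˡ (sum-neg (f ∘ suc)))
    (solve 2 (λ a b → :- a :+ :- b := :- (a :+ b)) ≈-refl (f zero) _)

  sum-- : ∀ {n} (f g : Fin n → Carrier) → sum (λ i → f i - g i) ≈ sum f - sum g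
  sum-- f g = ≈-trans (sum-+ f (λ i → - g i)) (+-congˡ (sum-neg g))

  *-sumˡ : ∀ {n} x (f : Fin n → Carrier) → x * sum f ≈ sum (λ i → x * f i)
  *-sumˡ = Σ.*-distribˡ-sum

  *-sumʳ : ∀ {n} x (f : Fin n → Carrier) → sum f * x ≈ sum (λ i → f i * x)
  *-sumʳ = Σ.*-distribʳ-sum

  sum-swap : ∀ {m n} (f : Fin m → Fin n → Carrier) →
             sum (λ i → sum (f i)) ≈ sum (λ j → sum (λ i → f i j))
  sum-swap = Σ.∑-comm

  sum-single : ∀ {n} (k : Fin n) (f : Fin n → Carrier) → (∀ i → i ≢ k → f i ≈ 0#) → sum f ≈ f k
  sum-single zero    f h = ≈-trans (+-congˡ (sum-zero (f ∘ suc) (λ i → h (suc i) λ ())))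
    (+-identityʳ _)
  sum-single (suc k) f h = ≈-trans
    (+-cong (h zero λ ()) (sum-single k (f ∘ suc) (λ i i≢k → h (suc i) (i≢k ∘ Fin.suc-injective))))
    (+-identityˡ _)

module Divisibility (R : CRing) where
  open Ring R
  open RingProperties ring using (-‿distribʳ-*)
  open Solver R
  open Sums R

  infix 4 _∣_
  _∣_ : Carrier → Carrier → Set
  m ∣ f = ∃ λ g → f ≈ m * g

  ∣-resp : ∀ {m f g} → f ≈ g → m ∣ f → m ∣ g
  ∣-resp f≈g (h , eq) = h , ≈-trans (≈-sym f≈g) eq

  ∣-respˡ : ∀ {m n f} → m ≈ n → m ∣ f → n ∣ f
  ∣-respˡ m≈n (h , eq) = h , ≈-trans eq (*-congʳ m≈n)

  ∣-refl : ∀ {m} → m ∣ m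
  ∣-refl = 1# , ≈-sym (*-identityʳ _)

  ∣-trans : ∀ {m n f} → m ∣ n → n ∣ f → m ∣ f
  ∣-trans (g , p) (h , q) = g * h , ≈-trans q (≈-trans (*-congʳ p) (*-assoc _ _ _))

  ∣-0 : ∀ {m f} → f ≈ 0# → m ∣ f
  ∣-0 eq = 0# , ≈-trans eq (≈-sym (zeroʳ _))

  0∣⇒≈0 : ∀ {f} → 0# ∣ f → f ≈ 0#
  0∣⇒≈0 (g , eq) = ≈-trans eq (zeroˡ g)

  ∣-+ : ∀ {m f g} → m ∣ f → m ∣ g → m ∣ f + g
  ∣-+ (a , p) (b , q) = a + b , ≈-trans (+-cong p q) (≈-sym (distribˡ _ _ _))

  ∣-neg : ∀ {m f} → m ∣ f → m ∣ - f
  ∣-neg (a , p) = - a , ≈-trans (-‿cong p) (-‿distribʳ-* _ _)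

  ∣-negˡ : ∀ {m f} → m ∣ f → - m ∣ f
  ∣-negˡ {m} (g , eq) = - g , ≈-trans eq (neg-neg m g)
    where
    neg-neg : ∀ m g → m * g ≈ (- m) * (- g)
    neg-neg = solve 2 (λ m g → m :* g := (:- m) :* (:- g)) ≈-refl

  ∣-- : ∀ {m f g} → m ∣ f → m ∣ g → m ∣ f - g
  ∣-- p q = ∣-+ p (∣-neg q)

  ∣-*ʳ : ∀ {m f} g → m ∣ f → m ∣ f * g
  ∣-*ʳ g (a , p) = a * g , ≈-trans (*-congʳ p) (*-assoc _ _ _)

  ∣-*ˡ : ∀ {m f} g → m ∣ f → m ∣ g * f
  ∣-*ˡ g p = ∣-resp (*-comm _ _) (∣-*ʳ g p)

  ∣-*-cong : ∀ {m n f g} → m ∣ f → n ∣ g → m * n ∣ f * g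
  ∣-*-cong (a , p) (b , q) = a * b , ≈-trans (*-cong p q)
    (solve 4 (λ m a n b → (m :* a) :* (n :* b) := (m :* n) :* (a :* b)) ≈-refl _ _ _ _)

  ∣-sum : ∀ {m n} (f : Fin n → Carrier) → (∀ i → m ∣ f i) → m ∣ sum f
  ∣-sum {n = zero}  f p = ∣-0 ≈-refl
  ∣-sum {n = suc n} f p = ∣-+ (p zero) (∣-sum (f ∘ suc) (p ∘ suc))

  ∣-sym : ∀ {m f g} → m ∣ f - g → m ∣ g - f
  ∣-sym p = ∣-resp (solve 2 (λ f g → :- (f :- g) := g :- f) ≈-refl _ _) (∣-neg p)

  ∣-cancel-+ : ∀ {m f g} → m ∣ f + g → m ∣ f → m ∣ g
  ∣-cancel-+ p q = ∣-resp (solve 2 (λ f g → f :+ g :- f := g) ≈-refl _ _) (∣-- p q)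

  ≡-mod-* : ∀ {m a b c d} → m ∣ a - b → m ∣ c - d → m ∣ a * c - b * d
  ≡-mod-* p q = ∣-resp
    (solve 4 (λ a b c d → (a :- b) :* c :+ b :* (c :- d) := a :* c :- b :* d) ≈-refl _ _ _ _)
    (∣-+ (∣-*ʳ _ p) (∣-*ˡ _ q))

  ≡-mod-+ : ∀ {m a b c d} → m ∣ a - b → m ∣ c - d → m ∣ (a + c) - (b + d)
  ≡-mod-+ p q = ∣-resp
    (solve 4 (λ a b c d → (a :- b) :+ (c :- d) := (a :+ c) :- (b :+ d)) ≈-refl _ _ _ _)
    (∣-+ p q)

  ≡-mod-trans : ∀ {m a b c} → m ∣ a - b → m ∣ b - c → m ∣ a - c
  ≡-mod-trans p q = ∣-resp
    (solve 3 (λ a b c → (a :- b) :+ (b :- c) := a :- c) ≈-refl _ _ _) (∣-+ p q)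

  ≡-mod-refl : ∀ {m a} → m ∣ a - a
  ≡-mod-refl = ∣-0 (-‿inverseʳ _)

  ≡-mod-^ : ∀ {m a b} n → m ∣ a - b → m ∣ a ^ n - b ^ n
  ≡-mod-^ zero    p = ≡-mod-refl
  ≡-mod-^ (suc n) p = ≡-mod-* p (≡-mod-^ n p)

  -- d is not a zero divisor in R / m; for m = 0, in R.
  Regular : Carrier → Carrier → Set
  Regular m d = ∀ {f} → m ∣ d * f → m ∣ f

  -- Stands in for the absence of a common factor in rings where no factorisation is available; it
  -- suffices to combine divisibilities by a and b into one by their product.
  Coprime : Carrier → Carrier → Set
  Coprime a b = Regular a b × Regular b a

  cancel : ∀ {d f g} → Regular 0# d → d * f ≈ d * g → f ≈ g
  cancel {d} {f} {g} reg eq = ≈-trans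
    (solve 2 (λ f g → f := (f :- g) :+ g) ≈-refl f g)
    (≈-trans (+-congʳ (0∣⇒≈0 (reg (∣-0 lemma)))) (+-identityˡ g))
    where
    lemma : d * (f - g) ≈ 0#
    lemma = ≈-trans (solve 3 (λ d f g → d :* (f :- g) := d :* f :- d :* g) ≈-refl d f g)
      (≈-trans (+-congʳ eq) (-‿inverseʳ _))

  regular-resp : ∀ {m d e} → d ≈ e → Regular m d → Regular m e
  regular-resp eq reg p = reg (∣-resp (*-congʳ (≈-sym eq)) p)

  regular-respˡ : ∀ {m n d} → m ≈ n → Regular m d → Regular n d
  regular-respˡ eq reg p = ∣-respˡ eq (reg (∣-respˡ (≈-sym eq) p))

  regular-* : ∀ {m d e} → Regular m d → Regular m e → Regular m (d * e)
  regular-* r s p = s (r (∣-resp (*-assoc _ _ _) p))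

  regular-neg : ∀ {m d} → Regular m d → Regular m (- d)
  regular-neg r p = r (∣-resp (solve 2 (λ d f → :- (:- d :* f) := d :* f) ≈-refl _ _) (∣-neg p))

  regular-1 : ∀ {m} → Regular m 1#
  regular-1 p = ∣-resp (*-identityˡ _) p

  private
    swap : ∀ m n g → (m * n) * g ≈ n * (m * g)
    swap = solve 3 (λ m n g → (m :* n) :* g := n :* (m :* g)) ≈-refl

    key : ∀ {m n d f f₁ g} → Regular 0# n → f ≈ n * f₁ → d * f ≈ (m * n) * g → d * f₁ ≈ m * g
    key {m} {n} {d} {f} {f₁} {g} c p₁ p = cancel c (≈-trans (lem n d f₁)
       (≈-trans (*-congˡ (≈-sym p₁)) (≈-trans p (swap m n g))))
       where
       lem : ∀ n d f → n * (d * f) ≈ d * (n * f)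
       lem = solve 3 (λ n d f → n :* (d :* f) := d :* (n :* f)) ≈-refl

  -- If m n divides d f, regularity modulo n gives f = n f₁. Cancelling n leaves that m divides d
  -- f₁, hence f₁.
  regular-modulus-* : ∀ {m n d} → Regular m d → Regular n d → Regular 0# n → Regular (m * n) d
  regular-modulus-* {m} {n} {d} r s c {f} (g , p) =
    let f₁ , p₁ = s {f} (m * g , ≈-trans p (swap m n g))
        f₂ , p₂ = r {f₁} (g , key c p₁ p)
    in f₂ , ≈-trans p₁ (≈-trans (*-congˡ p₂) (≈-sym (swap m n f₂)))

  -- Write f = d f₁; then m divides d f₁, and d may be dropped modulo m.
  coprime-∣ : ∀ {m d f} → Regular m d → m ∣ f → d ∣ f → m * d ∣ f
  coprime-∣ {m} {d} r p (f₁ , q) with r (∣-resp q p)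
  ... | f₂ , q₂ = f₂ , ≈-trans q (≈-trans (*-congˡ q₂)
         (solve 3 (λ m d f → d :* (m :* f) := (m :* d) :* f) ≈-refl m d f₂))

  regular-Π : ∀ {m} {qs : List Carrier} → All (Regular m) qs → Regular m Π[ qs ]
  regular-Π []       = regular-1
  regular-Π (r ∷ rs) = regular-* r (regular-Π rs)

  Π-∣ : ∀ {f} {qs : List Carrier} → AllPairs Coprime qs → All (_∣ f) qs → Π[ qs ] ∣ f
  Π-∣ {f} []         []       = f , ≈-sym (*-identityˡ f)
  Π-∣     (cs ∷ css) (p ∷ ps) =
    coprime-∣ (regular-Π (All.map proj₁ cs)) p (Π-∣ css ps)

  -- Isolates one factor of the defining polynomial: the other factors are regular modulo q, so
  -- their product can be cancelled there.
  Π-split : ∀ {q} {qs : List Carrier} → AllPairs Coprime qs → q ∈ qs →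
            ∃ λ Q → Π[ qs ] ≈ q * Q × Regular q Q
  Π-split (cs ∷ css) (here ≡.refl) = _ , ≈-refl , regular-Π (All.map proj₁ cs)
  Π-split (cs ∷ css) (there i) with Π-split css i
  ... | Q , eq , r =
    _ , ≈-trans (*-congˡ eq) (solve 3 (λ a b c → a :* (b :* c) := b :* (a :* c)) ≈-refl _ _ _) ,
    regular-* (proj₂ (All.lookup cs i)) r

  -- A polynomial of degree < n is given by its coefficients c : Fin n → R.
  eval : ∀ {n} → (Fin n → Carrier) → Carrier → Carrier
  eval {zero}  c t = 0#
  eval {suc n} c t = c zero + t * eval (c ∘ suc) t

  eval-cong : ∀ {n} {c d : Fin n → Carrier} {t} → (∀ p → c p ≈ d p) → eval c t ≈ eval d t
  eval-cong {zero}  eq = ≈-refl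
  eval-cong {suc n} eq = +-cong (eq zero) (*-congˡ (eval-cong (eq ∘ suc)))

  eval-- : ∀ {n} (c d : Fin n → Carrier) t → eval (λ p → c p - d p) t ≈ eval c t - eval d t
  eval-- {zero}  c d t = ≈-sym (-‿inverseʳ 0#)
  eval-- {suc n} c d t = ≈-trans (+-congˡ (*-congˡ (eval-- (c ∘ suc) (d ∘ suc) t)))
    (solve 5 (λ a b t x y → (a :- b) :+ t :* (x :- y) := (a :+ t :* x) :- (b :+ t :* y)) ≈-refl
      _ _ _ _ _)

  eval-≡-mod : ∀ {n m t u} (c : Fin n → Carrier) → m ∣ t - u → m ∣ eval c t - eval c u
  eval-≡-mod {zero}  c p = ≡-mod-refl
  eval-≡-mod {suc n} c p = ≡-mod-+ ≡-mod-refl (≡-mod-* p (eval-≡-mod (c ∘ suc) p))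

  -- The coefficients of r + (y - t) c(y).
  linear : ∀ {n} → Carrier → Carrier → (Fin n → Carrier) → Fin (suc n) → Carrier
  linear {zero}  r t c zero    = r
  linear {suc n} r t c zero    = r - t * c zero
  linear {suc n} r t c (suc p) = linear (c zero) t (c ∘ suc) p

  eval-linear : ∀ {n} r t (c : Fin n → Carrier) y →
                eval (linear r t c) y ≈ r + (y - t) * eval c y
  eval-linear {zero}  r t c y = solve 3 (λ r t y → r :+ y :* :0 := r :+ (y :- t) :* :0) ≈-refl r t y
  eval-linear {suc n} r t c y = ≈-trans (+-congˡ (*-congˡ (eval-linear (c zero) t (c ∘ suc) y)))
    (solve 5 (λ r t y c e → (r :- t :* c) :+ y :* (c :+ (y :- t) :* e)
                         := r :+ (y :- t) :* (c :+ y :* e)) ≈-refl r t y (c zero) _)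

  linear-≡-mod : ∀ {n m r s t u} {c d : Fin n → Carrier} → m ∣ r - s → m ∣ t - u →
                 (∀ p → m ∣ c p - d p) → ∀ p → m ∣ linear r t c p - linear s u d p
  linear-≡-mod {zero}  r t c zero    = r
  linear-≡-mod {suc n} r t c zero    =
    ∣-resp (solve 4 (λ r s x y → (r :- s) :- (x :- y) := (r :- x) :- (s :- y)) ≈-refl _ _ _ _)
      (∣-- r (≡-mod-* t (c zero)))
  linear-≡-mod {suc n} r t c (suc p) = linear-≡-mod (c zero) t (c ∘ suc) p

  linear-∣ : ∀ {n m r t} {c : Fin n → Carrier} → m ∣ r → (∀ p → m ∣ c p) → ∀ p → m ∣ linear r t c p
  linear-∣ {zero}  r c zero    = r
  linear-∣ {suc n} r c zero    = ∣-- r (∣-*ˡ _ (c zero))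
  linear-∣ {suc n} r c (suc p) = linear-∣ (c zero) (c ∘ suc) p

  synthetic-division : ∀ {n} t (c : Fin (suc n) → Carrier) →
                       ∃ λ r → ∃ λ d → ∀ p → c p ≈ linear {n} r t d p
  synthetic-division {zero}  t c = c zero , (λ ()) , λ { zero → ≈-refl }
  synthetic-division {suc n} t c =
    let r , d , eq = synthetic-division t (c ∘ suc) in
    c zero + t * r , (λ { zero → r ; (suc p) → d p }) , λ where
      zero    → solve 2 (λ c x → c := (c :+ x) :- x) ≈-refl _ _
      (suc p) → eq p

  DistinctModulo : ∀ {n} → Carrier → (Fin n → Carrier) → Set
  DistinctModulo m t = ∀ {i j} → i ≢ j → Regular m (t i - t j)

  -- Induction on the number of points. Division by y - t₀ leaves the value at t₀ as remainder,
  -- which m divides; at the other points the regular factor tᵢ - t₀ is cancelled, so the quotient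
  -- vanishes there modulo m. For m = 0 this is uniqueness of interpolation.
  vanishing-polynomial : ∀ {n m} (t : Fin n → Carrier) → DistinctModulo m t →
    (c : Fin n → Carrier) → (∀ i → m ∣ eval c (t i)) → ∀ p → m ∣ c p
  vanishing-polynomial {suc n} {m} t reg c h p =
    let r , d , eq = synthetic-division (t zero) c
        at : ∀ i → m ∣ r + (t i - t zero) * eval d (t i)
        at i = ∣-resp (≈-trans (eval-cong eq) (eval-linear r (t zero) d (t i))) (h i)
        m∣r = ∣-resp (solve 3 (λ r t e → r :+ (t :- t) :* e := r) ≈-refl r (t zero) _) (at zero)
        m∣d = vanishing-polynomial (t ∘ suc) (λ i≢j → reg (i≢j ∘ Fin.suc-injective)) d
                (λ i → reg {suc i} {zero} (λ ()) (∣-cancel-+ (at (suc i)) m∣r))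
    in ∣-resp (≈-sym (eq p)) (linear-∣ m∣r m∣d p)

  -- Newton's scheme without fractions. The divided differences w at the first point exist by the
  -- congruences on v, and the recursion needs w to satisfy the same congruences; coprimality of the
  -- differences of points is what guarantees this.
  interpolation : ∀ {n} (t : Fin n → Carrier) → DistinctModulo 0# t →
    (∀ {i j k} → i ≢ j → i ≢ k → j ≢ k → Regular (t i - t j) (t i - t k)) →
    (v : Fin n → Carrier) → (∀ i j → t i - t j ∣ v i - v j) →
    ∃ λ c → ∀ i → eval {n} c (t i) ≈ v i
  interpolation {zero}  t reg cop v h = (λ ()) , λ ()
  interpolation {suc n} t reg cop v h = linear (v zero) (t zero) c , λ where
      zero    → ≈-trans (eval-linear _ _ c _)
        (solve 3 (λ r t e → r :+ (t :- t) :* e := r) ≈-refl (v zero) (t zero) _)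
      (suc i) → ≈-trans (eval-linear _ _ c _)
        (≈-trans (+-congˡ (≈-trans (*-congˡ (c-spec i)) (≈-sym (w-spec i))))
        (solve 2 (λ r v → r :+ (v :- r) := v) ≈-refl (v zero) (v (suc i))))
    where
    w : Fin n → Carrier
    w i = proj₁ (h (suc i) zero)
    w-spec : ∀ i → v (suc i) - v zero ≈ (t (suc i) - t zero) * w i
    w-spec i = proj₂ (h (suc i) zero)
    w-≡-mod : ∀ i j → t (suc i) - t (suc j) ∣ w i - w j
    w-≡-mod i j with i Fin.≟ j
    ... | yes ≡.refl = ≡-mod-refl
    -- Modulo tᵢ - tⱼ the difference vᵢ - vⱼ equals (tᵢ - t₀) (wᵢ - wⱼ), and tᵢ - t₀ is regular
    -- there.
    ... | no i≢j   = cop {suc i} {suc j} {zero} (i≢j ∘ Fin.suc-injective) (λ ()) (λ ())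
      (∣-resp (quotients (t (suc i)) (t (suc j)) (t zero) (w i) (w j))
        (∣-- (∣-resp (≈-trans (telescope (v (suc i)) (v (suc j)) (v zero))
                (+-cong (w-spec i) (-‿cong (w-spec j)))) (h (suc i) (suc j)))
             (∣-*ʳ (w j) ∣-refl)))
      where
      quotients : ∀ a b c x y → (a - c) * x - (b - c) * y - (a - b) * y ≈ (a - c) * (x - y)
      quotients = solve 5 (λ a b c x y →
        (a :- c) :* x :- (b :- c) :* y :- (a :- b) :* y := (a :- c) :* (x :- y)) ≈-refl
      telescope : ∀ a b c → a - b ≈ (a - c) - (b - c)
      telescope = solve 3 (λ a b c → a :- b := (a :- c) :- (b :- c)) ≈-refl
    rest = interpolation (t ∘ suc) (λ i≢j → reg (i≢j ∘ Fin.suc-injective))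
      (λ i≢j i≢k j≢k → cop (i≢j ∘ Fin.suc-injective) (i≢k ∘ Fin.suc-injective)
        (j≢k ∘ Fin.suc-injective))
      w w-≡-mod
    c = proj₁ rest
    c-spec = proj₂ rest

-- Alternants and Schur polynomials in two variables

module Alternants (R : CRing) where
  open Ring R
  open Solver R
  open Sums R
  open Divisibility R

  eval-0 : ∀ {n} (c : Fin n → Carrier) t → (∀ p → c p ≈ 0#) → eval c t ≈ 0#
  eval-0 {zero}  c t h = ≈-refl
  eval-0 {suc n} c t h = ≈-trans (+-cong (h zero) (*-congˡ (eval-0 (c ∘ suc) t (h ∘ suc))))
    (solve 1 (λ t → :0 :+ t :* :0 := :0) ≈-refl t)

  eval-+ : ∀ {n} (c d : Fin n → Carrier) t → eval (λ p → c p + d p) t ≈ eval c t + eval d t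
  eval-+ {zero}  c d t = ≈-sym (+-identityʳ 0#)
  eval-+ {suc n} c d t = ≈-trans (+-congˡ (*-congˡ (eval-+ (c ∘ suc) (d ∘ suc) t)))
    (solve 5 (λ a b t x y → (a :+ b) :+ t :* (x :+ y) := (a :+ t :* x) :+ (b :+ t :* y)) ≈-refl
      _ _ _ _ _)

  eval-*ˡ : ∀ {n} a (c : Fin n → Carrier) t → eval (λ p → a * c p) t ≈ a * eval c t
  eval-*ˡ {zero}  a c t = ≈-sym (zeroʳ a)
  eval-*ˡ {suc n} a c t = ≈-trans (+-congˡ (*-congˡ (eval-*ˡ a (c ∘ suc) t)))
    (solve 4 (λ a c t e → a :* c :+ t :* (a :* e) := a :* (c :+ t :* e)) ≈-refl a (c zero) t _)

  eval-*ʳ : ∀ {n} (c : Fin n → Carrier) a t → eval (λ p → c p * a) t ≈ eval c t * a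
  eval-*ʳ c a t = ≈-trans (eval-cong (λ p → *-comm (c p) a)) (≈-trans (eval-*ˡ a c t) (*-comm _ _))

  eval-sum : ∀ {m n} (c : Fin m → Fin n → Carrier) t →
             eval (λ p → sum (λ k → c k p)) t ≈ sum (λ k → eval (c k) t)
  eval-sum {zero} {n} c t = eval-0 {n} (λ _ → 0#) t (λ _ → ≈-refl)
  eval-sum {suc m} c t = ≈-trans (eval-+ (c zero) (λ p → sum (λ k → c (suc k) p)) t)
    (+-congˡ (eval-sum (c ∘ suc) t))

  δ : ∀ {n} → Fin n → Fin n → Carrier
  δ i j = if does (i Fin.≟ j) then 1# else 0#

  δ-≡ : ∀ {n} {i j : Fin n} → i ≡ j → δ i j ≈ 1#
  δ-≡ {i = i} {j} eq rewrite dec-true (i Fin.≟ j) eq = ≈-refl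

  δ-≢ : ∀ {n} {i j : Fin n} → i ≢ j → δ i j ≈ 0#
  δ-≢ {i = i} {j} neq rewrite dec-false (i Fin.≟ j) neq = ≈-refl

  δδ-≢ : ∀ {m n} {i j : Fin m} {k l : Fin n} → ¬ (i ≡ j × k ≡ l) → δ i j * δ k l ≈ 0#
  δδ-≢ {i = i} {j} {k} {l} neq with i Fin.≟ j
  ... | no _  = zeroˡ _
  ... | yes p with k Fin.≟ l
  ...   | no _  = zeroʳ _
  ...   | yes q = ⊥-elim (neq (p , q))

  eval-δ : ∀ {n} (a : Fin n) t → eval (δ a) t ≈ t ^ toℕ a
  eval-δ {suc n} zero t = ≈-trans (+-congˡ (*-congˡ (eval-0 {n} (λ _ → 0#) t (λ _ → ≈-refl))))
    (solve 1 (λ t → :1 :+ t :* :0 := :1) ≈-refl t)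
  eval-δ (suc a) t = ≈-trans (+-identityˡ _) (*-congˡ (eval-δ a t))

  bilinear : ∀ {m n} → (Fin m → Fin n → Carrier) → Carrier → Carrier → Carrier
  bilinear C y z = eval (λ p → eval (C p) z) y

  bilinear-cong : ∀ {m n} {C D : Fin m → Fin n → Carrier} {y z} →
                  (∀ p q → C p q ≈ D p q) → bilinear C y z ≈ bilinear D y z
  bilinear-cong eq = eval-cong (λ p → eval-cong (eq p))

  bilinear-transpose : ∀ {m n} (C : Fin m → Fin n → Carrier) y z →
                       bilinear C y z ≈ bilinear (λ q p → C p q) z y
  bilinear-transpose {zero} {n} C y z = ≈-sym (eval-0 {n} (λ q → 0#) z (λ _ → ≈-refl))
  bilinear-transpose {suc m} C y z = ≈-sym (≈-trans
    (eval-+ (C zero) (λ q → y * eval (λ p → C (suc p) q) y) z)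
    (+-congˡ (≈-trans (eval-*ˡ y (λ q → eval (λ p → C (suc p) q) y) z)
      (*-congˡ (≈-sym (bilinear-transpose (C ∘ suc) y z))))))

  bilinear-- : ∀ {m n} (C D : Fin m → Fin n → Carrier) y z →
               bilinear (λ p q → C p q - D p q) y z ≈ bilinear C y z - bilinear D y z
  bilinear-- C D y z = ≈-trans (eval-cong (λ p → eval-- (C p) (D p) z)) (eval-- (λ p → eval (C p) z)
    (λ p → eval (D p) z) y)

  bilinear-*ˡ : ∀ {m n} a (C : Fin m → Fin n → Carrier) y z →
                bilinear (λ p q → a * C p q) y z ≈ a * bilinear C y z
  bilinear-*ˡ a C y z = ≈-trans (eval-cong (λ p → eval-*ˡ a (C p) z))
    (eval-*ˡ a (λ p → eval (C p) z) y)

  Antisymmetric : ∀ {n} → (Fin n → Fin n → Carrier) → Set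
  Antisymmetric C = ∀ p q → C p q ≈ - C q p

  module _ (½ : Carrier) (½+½ : ½ + ½ ≈ 1#) where

    halve : ∀ {a} → a + a ≈ 0# → a ≈ 0#
    halve {a} eq = begin
      a               ≈⟨ *-identityˡ a ⟨
      1# * a          ≈⟨ *-congʳ ½+½ ⟨
      (½ + ½) * a     ≈⟨ lemma ½ a ⟩
      ½ * (a + a)     ≈⟨ *-congˡ eq ⟩
      ½ * 0#          ≈⟨ zeroʳ ½ ⟩
      0#              ∎
      where
      open SetoidReasoning setoid
      lemma : ∀ h a → (h + h) * a ≈ h * (a + a)
      lemma = solve 2 (λ h a → (h :+ h) :* a := h :* (a :+ a)) ≈-refl

    antisymmetric-diagonal : ∀ {n} {C : Fin n → Fin n → Carrier} →
                             Antisymmetric C → ∀ p → C p p ≈ 0#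
    antisymmetric-diagonal anti p = halve (≈-trans (+-congˡ (anti p p)) (-‿inverseʳ _))

    antisymmetric-ext : ∀ {n} {C D : Fin n → Fin n → Carrier} → Antisymmetric C → Antisymmetric D →
                        (∀ {p q} → q Fin.< p → C p q ≈ D p q) → ∀ p q → C p q ≈ D p q
    antisymmetric-ext {C = C} {D} antiC antiD eq p q with Fin.<-cmp p q
    ... | tri> _ _ q<p = eq q<p
    ... | tri< p<q _ _ = ≈-trans (antiC p q) (≈-trans (-‿cong (eq p<q)) (≈-sym (antiD p q)))
    ... | tri≈ _ ≡.refl _ =
      ≈-trans (antisymmetric-diagonal {C = C} antiC p)
        (≈-sym (antisymmetric-diagonal {C = D} antiD p))

  -- For q < p, the Schur polynomial of the partition (p - 1 , q) in two variables. The quotient is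
  -- taken from `alternating`, as in `Schur.s`, so that the two can later be matched term by term.
  schur : ℕ → ℕ → Carrier → Carrier → Carrier
  schur p q y z = proj₁ (alternating R y z p q)

  schur-spec : ∀ p q y z → schur p q y z * (y - z) ≈ y ^ p * z ^ q - y ^ q * z ^ p
  schur-spec p q y z = proj₂ (alternating R y z p q)

  schur-1-0 : ∀ y z → schur 1 0 y z ≈ 1#
  schur-1-0 y z = ≈-trans (+-congˡ (zeroʳ z)) (+-identityʳ 1#)

  -- Follows the recursion of `alternating`: the quotient formula is of no help modulo m, where y -
  -- z may fail to be cancellable. The condition q < p selects the branches of the recursion.
  schur-≡-mod : ∀ {m p q y y′} z → q ℕ.< p → m ∣ y - y′ → m ∣ schur p q y z - schur p q y′ z
  schur-≡-mod {p = suc zero}    {zero}  z _ h = ≡-mod-refl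
  schur-≡-mod {p = suc (suc p)} {zero}  z _ h =
    ≡-mod-+ (≡-mod-^ (suc p) h) (≡-mod-* ≡-mod-refl (schur-≡-mod {p = suc p} z (s≤s z≤n) h))
  schur-≡-mod {p = suc p}       {suc q} z (s≤s h′) h =
    ≡-mod-* (≡-mod-* h ≡-mod-refl) (schur-≡-mod z h′ h)

  -- The recursion treats y and z differently, so symmetry is visible only after multiplication by y
  -- - z; the factor is cancelled once the points make it regular.
  schur-sym : ∀ {p q} y z → schur p q y z * (y - z) ≈ schur p q z y * (y - z)
  schur-sym {p} {q} y z = begin
    schur p q y z * (y - z)                ≈⟨ schur-spec p q y z ⟩
    y ^ p * z ^ q - y ^ q * z ^ p          ≈⟨ lemma (y ^ p) (z ^ q) (y ^ q) (z ^ p) ⟩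
    - (z ^ p * y ^ q - z ^ q * y ^ p)      ≈⟨ -‿cong (schur-spec p q z y) ⟨
    - (schur p q z y * (z - y))            ≈⟨ lemma′ (schur p q z y) z y ⟩
    schur p q z y * (y - z)                ∎
    where
    open SetoidReasoning setoid
    lemma : ∀ a b c d → a * b - c * d ≈ - (d * c - b * a)
    lemma = solve 4 (λ a b c d → a :* b :- c :* d := :- (d :* c :- b :* a)) ≈-refl
    lemma′ : ∀ a z y → - (a * (z - y)) ≈ a * (y - z)
    lemma′ = solve 3 (λ a z y → :- (a :* (z :- y)) := a :* (y :- z)) ≈-refl

-- An abstract enumeration of the pairs lo < hi, i.e. of the entries below the diagonal. Keeping it
-- abstract allows the whole argument to be used for two orders of Λ.
record Pairs (n : ℕ) : Set where
  field
    size      : ℕ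
    hi lo     : Fin size → Fin n
    ordered   : ∀ k → lo k Fin.< hi k
    index     : ∀ {p q} → q Fin.< p → ∃ λ k → hi k ≡ p × lo k ≡ q
    injective : ∀ {k l} → hi k ≡ hi l → lo k ≡ lo l → k ≡ l

module AntisymmetricMatrix (R : CRing) {n} (E : Pairs n) where
  open Ring R
  open Solver R
  open Sums R
  open Divisibility R
  open Alternants R
  open Pairs E

  -- The antisymmetrised matrix unit at (hi k , lo k); its bilinear polynomial is `alternant k`.
  basis : Fin size → Fin n → Fin n → Carrier
  basis k p q = δ (hi k) p * δ (lo k) q - δ (lo k) p * δ (hi k) q

  matrix : (Fin size → Carrier) → Fin n → Fin n → Carrier
  matrix c p q = sum (λ k → c k * basis k p q)

  alternant : Fin size → Carrier → Carrier → Carrier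
  alternant k y z = y ^ toℕ (hi k) * z ^ toℕ (lo k) - y ^ toℕ (lo k) * z ^ toℕ (hi k)

  matrix-antisymmetric : ∀ c → Antisymmetric (matrix c)
  matrix-antisymmetric c p q = ≈-trans
    (sum-cong _ (λ k → - (c k * basis k q p)) (λ k → lemma (c k) _ _ _ _))
    (sum-neg (λ k → c k * basis k q p))
    where
    lemma : ∀ c x y z w → c * (x * y - z * w) ≈ - (c * (w * z - y * x))
    lemma = solve 5 (λ c x y z w → c :* (x :* y :- z :* w) := :- (c :* (w :* z :- y :* x))) ≈-refl

  matrix-entry : ∀ c k → matrix c (hi k) (lo k) ≈ c k
  matrix-entry c k = ≈-trans (sum-single k (λ l → c l * basis l (hi k) (lo k)) off)
    (≈-trans (*-congˡ (+-cong (≈-trans (*-cong (δ-≡ {i = hi k} ≡.refl) (δ-≡ {i = lo k} ≡.refl))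
      (*-identityˡ 1#))
                        (-‿cong (δδ-≢ {k = hi k} {l = lo k} (λ (eq , _) → Fin.<-irrefl eq
                          (ordered k))))))
      (solve 1 (λ c → c :* (:1 :- :0) := c) ≈-refl (c k)))
    where
    off : ∀ l → l ≢ k → c l * basis l (hi k) (lo k) ≈ 0#
    off l l≢k = ≈-trans
      (*-congˡ (+-cong (δδ-≢ (λ (p , q) → l≢k (injective p q)))
        (-‿cong (δδ-≢ (λ (p , q) → Fin.<-asym (ordered k)
          (≡.subst₂ Fin._<_ p q (ordered l)))))))
      (solve 1 (λ c → c :* (:0 :- :0) := :0) ≈-refl (c l))

  matrix-from : ∀ ½ → ½ + ½ ≈ 1# → ∀ C → Antisymmetric C →
                ∀ p q → matrix (λ k → C (hi k) (lo k)) p q ≈ C p q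
  matrix-from ½ ½+½ C anti =
    antisymmetric-ext ½ ½+½ (matrix-antisymmetric _) anti λ q<p → entry (index q<p)
    where
    entry : ∀ {p q} → (∃ λ k → hi k ≡ p × lo k ≡ q) → matrix (λ k → C (hi k) (lo k)) p q ≈ C p q
    entry (k , ≡.refl , ≡.refl) = matrix-entry (λ k → C (hi k) (lo k)) k

  alternant-sum : ∀ c y z → sum (λ k → c k * alternant k y z) ≈ bilinear (matrix c) y z
  alternant-sum c y z = ≈-sym (begin
    bilinear (matrix c) y z
      ≈⟨ eval-cong (λ p → eval-sum (λ k q → c k * basis k p q) z) ⟩
    eval (λ p → sum (λ k → eval (λ q → c k * basis k p q) z)) y
      ≈⟨ eval-sum (λ k p → eval (λ q → c k * basis k p q) z) y ⟩
    sum (λ k → bilinear (λ p q → c k * basis k p q) y z)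
      ≈⟨ sum-cong _ (λ k → c k * alternant k y z) (λ k → ≈-trans (bilinear-*ˡ (c k) (basis k) y z)
           (*-congˡ (≈-trans (bilinear-- (λ p q → δ (hi k) p * δ (lo k) q)
             (λ p q → δ (lo k) p * δ (hi k) q) y z)
             (+-cong (product (hi k) (lo k)) (-‿cong (product (lo k) (hi k))))))) ⟩
    sum (λ k → c k * alternant k y z) ∎)
    where
    open SetoidReasoning setoid
    product : ∀ a b → bilinear (λ p q → δ a p * δ b q) y z ≈ y ^ toℕ a * z ^ toℕ b
    product a b = ≈-trans (eval-cong (λ p → ≈-trans (eval-*ˡ (δ a p) (δ b) z)
      (*-congˡ (eval-δ b z))))
      (≈-trans (eval-*ʳ (δ a) _ y) (*-congʳ (eval-δ a y)))

-- Matrices interpolated by Schur polynomials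

-- The facts about the coordinates on which the matrix argument rests, in place of unique
-- factorisation: the xᵢ and the Tᵢ - Tⱼ are regular, and those that are not associated are regular
-- modulo each other.
record GenericPoints (R : CRing) (n : ℕ) : Set where
  open Ring R
  open Divisibility R
  field
    x : Fin n → Carrier
    ½ : Carrier
    ½+½ : ½ + ½ ≈ 1#

  T : Fin n → Carrier
  T i = x i ^ 2

  q : Fin n → Fin n → Carrier
  q i j = T i - T j

  field
    x-regular : ∀ i → Regular 0# (x i)
    q-regular : ∀ {i j} → i ≢ j → Regular 0# (q i j)
    x-x : ∀ {i j} → i ≢ j → Regular (x i) (x j)
    x-q : ∀ {i j} k → i ≢ j → Regular (x k) (q i j)
    q-x : ∀ {i j} k → i ≢ j → Regular (q i j) (x k)
    q-q : ∀ {i j k l} → i ≢ j → k ≢ l → ¬ (k ≡ i × l ≡ j) → ¬ (k ≡ j × l ≡ i) →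
          Regular (q i j) (q k l)

  cofactor : ∀ {A : Set} → (Fin n → A) → Fin n → List A
  cofactor f k = map f (filter (λ i → ¬? (i Fin.≟ k)) (allFin n))

AllPairs-map⁺ : ∀ {A B : Set} {P : A → Set} {_~_ : A → A → Set} {S : B → B → Set} {f : A → B} {xs} →
  (∀ {x y} → P x → P y → x ~ y → S (f x) (f y)) → All P xs → AllPairs _~_ xs → AllPairs S (map f xs)
AllPairs-map⁺ h []       []         = []
AllPairs-map⁺ {P = P} {_~_} {S} {f} h (p ∷ ps) (rs ∷ rss) = go ps rs ∷ AllPairs-map⁺ {P = P} {_~_} h
  ps rss
  where
  go : ∀ {ys} → All P ys → All (_ ~_) ys → All (S (f _)) (map f ys)
  go []       []       = []
  go (p′ ∷ ps) (r ∷ rs) = h p p′ r ∷ go ps rs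

module Interpolation (R : CRing) {n} (G : GenericPoints R (suc n)) where
  open Ring R
  open Solver R
  open Sums R
  open Divisibility R
  open Alternants R
  open GenericPoints G
  open SetoidReasoning setoid

  q-refl : ∀ i → q i i ≈ 0#
  q-refl i = -‿inverseʳ _

  module _ (u : Fin (suc n) → Fin (suc n) → Carrier)
           (symmetric : ∀ i j → u i j ≈ u j i)
           (u-≡-mod : ∀ i j k → q i j ∣ u i k - u j k) where

    -- The place (j , j) is left out: the diagonal satisfies only congruences, and the n remaining
    -- points fix a polynomial with n coefficients.
    row : ∀ j → ∃ λ e → ∀ i → eval {n} e (T (punchIn j i)) ≈ u (punchIn j i) j
    row j = interpolation (T ∘ punchIn j)
      (λ i≢k → q-regular (i≢k ∘ Fin.punchIn-injective j _ _))
      (λ {a} {b} {c} a≢b a≢c b≢c → q-q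
        (a≢b ∘ Fin.punchIn-injective j _ _) (a≢c ∘ Fin.punchIn-injective j _ _)
        (λ (_ , eq) → b≢c (≡.sym (Fin.punchIn-injective j _ _ eq)))
        (λ (eq , _) → a≢b (Fin.punchIn-injective j _ _ eq)))
      (λ i → u (punchIn j i) j) (λ i k → u-≡-mod (punchIn j i) (punchIn j k) j)

    e : Fin (suc n) → Fin n → Carrier
    e j = proj₁ (row j)

    e-spec : ∀ {i j} → i ≢ j → eval (e j) (T i) ≈ u i j
    e-spec {i} {j} i≢j = ≡.subst (λ i → eval (e j) (T i) ≈ u i j)
      (Fin.punchIn-punchOut (i≢j ∘ ≡.sym)) (proj₂ (row j) (punchOut (i≢j ∘ ≡.sym)))

    -- Both polynomials have degree < n and agree modulo T j - T k at the n points T i with i ≠ j.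
    e-≡-mod : ∀ {j k} → j ≢ k → ∀ p → q j k ∣ e j p - e k p
    e-≡-mod {j} {k} j≢k = vanishing-polynomial (T ∘ punchIn j)
      (λ {a} {b} a≢b → q-q j≢k (a≢b ∘ Fin.punchIn-injective j _ _)
        (λ (eq , _) → Fin.punchInᵢ≢i j a eq) (λ (_ , eq) → Fin.punchInᵢ≢i j b eq))
      (λ p → e j p - e k p) (λ i → at (punchIn j i) (Fin.punchInᵢ≢i j i))
      where
      at : ∀ i → i ≢ j → q j k ∣ eval (λ p → e j p - e k p) (T i)
      at i i≢j with i Fin.≟ k
      ... | no i≢k = ∣-resp (begin
          u j i - u k i                        ≈⟨ +-cong (symmetric j i) (-‿cong (symmetric k i)) ⟩
          u i j - u i k                        ≈⟨ +-cong (e-spec i≢j) (-‿cong (e-spec i≢k)) ⟨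
          eval (e j) (T i) - eval (e k) (T i)  ≈⟨ eval-- (e j) (e k) (T i) ⟨
          eval (λ p → e j p - e k p) (T i)     ∎) (u-≡-mod j k i)
      -- Here e k does not interpolate at T k. By symmetry of u, e j at T k and e k at T j have the
      -- same value, and moving e k from T j to T k changes it by a multiple of T j - T k.
      ... | yes ≡.refl = ∣-resp (begin
          eval (e k) (T j) - eval (e k) (T k)  ≈⟨ +-congʳ (e-spec j≢k) ⟩
          u j k - eval (e k) (T k)             ≈⟨ +-congʳ (symmetric j k) ⟩
          u k j - eval (e k) (T k)             ≈⟨ +-congʳ (e-spec i≢j) ⟨
          eval (e j) (T k) - eval (e k) (T k)  ≈⟨ eval-- (e j) (e k) (T k) ⟨
          eval (λ p → e j p - e k p) (T k)     ∎) (eval-≡-mod {t = T j} {T k} (e k) ∣-refl)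

    -- Interpolates, in the second variable, the coefficients of (y - T j) e j(y). The extra factor
    -- makes the value at y = T i equal to q i j u i j for all i, including i = j, where both sides
    -- are 0.
    column : ∀ p → ∃ λ c → ∀ j → eval {suc n} c (T j) ≈ linear 0# (T j) (e j) p
    column p = interpolation T q-regular
      (λ i≢j i≢k j≢k → q-q i≢j i≢k (λ (_ , eq) → j≢k (≡.sym eq)) (λ (eq , _) → i≢j eq))
      (λ j → linear 0# (T j) (e j) p) at
      where
      at : ∀ i j → q i j ∣ linear 0# (T i) (e i) p - linear 0# (T j) (e j) p
      at i j with i Fin.≟ j
      ... | yes ≡.refl = ≡-mod-refl
      ... | no i≢j = linear-≡-mod ≡-mod-refl ∣-refl (e-≡-mod i≢j) p

    C₀ : Fin (suc n) → Fin (suc n) → Carrier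
    C₀ p = proj₁ (column p)

    C₀-spec : ∀ i j → bilinear C₀ (T i) (T j) ≈ q i j * u i j
    C₀-spec i j = ≈-trans (eval-cong (λ p → proj₂ (column p) j))
      (≈-trans (eval-linear 0# (T j) (e j) (T i)) (≈-trans (+-identityˡ _) at))
      where
      at : q i j * eval (e j) (T i) ≈ q i j * u i j
      at with i Fin.≟ j
      ... | no i≢j = *-congˡ (e-spec i≢j)
      ... | yes ≡.refl = ≈-trans (≈-trans (*-congʳ (q-refl i)) (zeroˡ _))
                                 (≈-sym (≈-trans (*-congʳ (q-refl i)) (zeroˡ _)))

    -- Antisymmetrising keeps the interpolated values, since q i j u i j changes sign when i and j
    -- are exchanged.
    C₁ : Fin (suc n) → Fin (suc n) → Carrier
    C₁ p r = ½ * (C₀ p r - C₀ r p)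

    C₁-antisymmetric : Antisymmetric C₁
    C₁-antisymmetric p r = anti ½ (C₀ p r) (C₀ r p)
      where
      anti : ∀ h a b → h * (a - b) ≈ - (h * (b - a))
      anti = solve 3 (λ h a b → h :* (a :- b) := :- (h :* (b :- a))) ≈-refl

    C₁-spec : ∀ i j → bilinear C₁ (T i) (T j) ≈ q i j * u i j
    C₁-spec i j = begin
        bilinear C₁ (T i) (T j)
          ≈⟨ bilinear-*ˡ ½ (λ p r → C₀ p r - C₀ r p) (T i) (T j) ⟩
        ½ * bilinear (λ p r → C₀ p r - C₀ r p) (T i) (T j)
          ≈⟨ *-congˡ (bilinear-- C₀ (λ p r → C₀ r p) (T i) (T j)) ⟩
        ½ * (bilinear C₀ (T i) (T j) - bilinear (λ p r → C₀ r p) (T i) (T j))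
          ≈⟨ *-congˡ (+-cong (C₀-spec i j)
               (-‿cong (≈-trans (≈-sym (bilinear-transpose C₀ (T j) (T i)))
               (≈-trans (C₀-spec j i) (*-congˡ (symmetric j i)))))) ⟩
        ½ * (q i j * u i j - q j i * u i j)
          ≈⟨ double ½ (T i) (T j) (u i j) ⟩
        (½ + ½) * (q i j * u i j)
          ≈⟨ *-congʳ ½+½ ⟩
        1# * (q i j * u i j)
          ≈⟨ *-identityˡ _ ⟩
        q i j * u i j ∎
      where
      double : ∀ h s t u → h * ((s - t) * u - (t - s) * u) ≈ (h + h) * ((s - t) * u)
      double = solve 4 (λ h s t u → h :* ((s :- t) :* u :- (t :- s) :* u)
                                 := (h :+ h) :* ((s :- t) :* u)) ≈-refl

    abstract
      matrix-interpolation : ∃ λ C → Antisymmetric {suc n} C × ∀ i j → bilinear {suc n} {suc n} C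
        (T i) (T j) ≈ q i j * u i j
      matrix-interpolation = C₁ , C₁-antisymmetric , C₁-spec

  module Expansion (E : Pairs (suc n)) where
    open Pairs E
    open AntisymmetricMatrix R E

    s : Fin size → Carrier → Carrier → Carrier
    s k = schur (toℕ (hi k)) (toℕ (lo k))

    -- In the coordinates of `S ℓ` this is h_k.
    P : Fin (suc n) → Carrier
    P k = Π[ cofactor (q k) k ]

    schur-sum : (Fin size → Carrier) → Carrier → Carrier → Carrier
    schur-sum c y z = sum (λ k → c k * s k y z)

    schur-sum-spec : ∀ c y z → (y - z) * schur-sum c y z ≈ bilinear (matrix c) y z
    schur-sum-spec c y z = begin
      (y - z) * schur-sum c y z
        ≈⟨ *-sumˡ (y - z) (λ k → c k * s k y z) ⟩
      sum (λ k → (y - z) * (c k * s k y z))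
        ≈⟨ sum-cong _ (λ k → c k * alternant k y z) (λ k → ≈-trans (swap (y - z) (c k) (s k y z))
             (*-congˡ (schur-spec (toℕ (hi k)) (toℕ (lo k)) y z))) ⟩
      sum (λ k → c k * alternant k y z)
        ≈⟨ alternant-sum c y z ⟩
      bilinear (matrix c) y z ∎
      where
      swap : ∀ a b c → a * (b * c) ≈ b * (c * a)
      swap = solve 3 (λ a b c → a :* (b :* c) := b :* (c :* a)) ≈-refl

    schur-sum-≡-mod : ∀ {m} c y y′ z → m ∣ y - y′ → m ∣ schur-sum c y z - schur-sum c y′ z
    schur-sum-≡-mod c y y′ z h = ∣-resp (sum-- (λ k → c k * s k y z) (λ k → c k * s k y′ z))
      (∣-sum (λ k → c k * s k y z - c k * s k y′ z)
        (λ k → ≡-mod-* ≡-mod-refl (schur-≡-mod z (ordered k) h)))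

    -- Multiplied by y - z, the Schur sum is the bilinear polynomial of an antisymmetric matrix. It
    -- vanishes at all pairs of points, the diagonal ones included, so its coefficients vanish, one
    -- variable at a time.
    off-diagonal-independent : ∀ c → (∀ {i j} → i ≢ j → schur-sum c (T i) (T j) ≈ 0#) → ∀ k →
      c k ≈ 0#
    off-diagonal-independent c h k = ≈-trans (≈-sym (matrix-entry c k))
      (0∣⇒≈0 (vanishing-polynomial T q-regular (matrix c (hi k)) (λ j → ∣-resp ≈-refl
        (vanishing-polynomial T q-regular (λ p → eval (matrix c p) (T j)) (λ i → ∣-0 (at i j))
          (hi k))) (lo k)))
      where
      at : ∀ i j → bilinear (matrix c) (T i) (T j) ≈ 0#
      at i j = ≈-trans (≈-sym (schur-sum-spec c (T i) (T j))) zero-product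
        where
        zero-product : q i j * schur-sum c (T i) (T j) ≈ 0#
        zero-product with i Fin.≟ j
        ... | yes ≡.refl = ≈-trans (*-congʳ (q-refl i)) (zeroˡ _)
        ... | no i≢j = ≈-trans (*-congˡ (h i≢j)) (zeroʳ _)

    abstract
      cofactor-∣ : ∀ k {f} → (∀ {b} → b ≢ k → q k b ∣ f) → P k ∣ f
      cofactor-∣ k h = Π-∣
        (AllPairs-map⁺ {P = _≢ k} {_≢_}
          (λ a≢k b≢k a≢b → coprime a≢k b≢k a≢b , coprime b≢k a≢k (a≢b ∘ ≡.sym))
          others (Unique.filter⁺ (λ i → ¬? (i Fin.≟ k)) (Unique.allFin⁺ (suc n))))
        (All.map⁺ (All.map h others))
        where
        others : All (_≢ k) (filter (λ i → ¬? (i Fin.≟ k)) (allFin (suc n)))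
        others = All.all-filter (λ i → ¬? (i Fin.≟ k)) (allFin (suc n))
        coprime : ∀ {a b} → a ≢ k → b ≢ k → a ≢ b → Regular (q k a) (q k b)
        coprime a≢k b≢k a≢b = q-q (a≢k ∘ ≡.sym) (b≢k ∘ ≡.sym)
          (λ (_ , eq) → a≢b (≡.sym eq)) (λ (eq , _) → a≢k (≡.sym eq))

    remainder : ∀ {m f g} → m ∣ f - g → ∃ λ d → f ≈ g + d * m
    remainder {m} {f} {g} (d , eq) = d ,
      ≈-trans (split f g) (+-congˡ (≈-trans eq (*-comm m d)))
      where
      split : ∀ a b → a ≈ b + (a - b)
      split = solve 2 (λ a b → a := b :+ (a :- b)) ≈-refl

    module _ (u : Fin (suc n) → Fin (suc n) → Carrier)
             (symmetric : ∀ i j → u i j ≈ u j i)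
             (u-≡-mod : ∀ i j k → q i j ∣ u i k - u j k) where

      matching : ∀ C → Antisymmetric C → (∀ i j → bilinear C (T i) (T j) ≈ q i j * u i j) →
                 ∀ {i j} → i ≢ j → u i j ≈ schur-sum (λ k → C (hi k) (lo k)) (T i) (T j)
      matching C anti C-spec {i} {j} i≢j = cancel (q-regular i≢j) (≈-trans (≈-sym (C-spec i j))
        (≈-trans (≈-sym (bilinear-cong (matrix-from ½ ½+½ C anti)))
          (≈-sym (schur-sum-spec (λ k → C (hi k) (lo k)) (T i) (T j)))))

      -- Modulo T k - T b both u k k and the Schur sum at (k , k) may be moved to (b , k), where
      -- they agree. The moduli for distinct b are coprime.
      diagonal : ∀ c → (∀ {i j} → i ≢ j → u i j ≈ schur-sum c (T i) (T j)) →
                 ∀ k → P k ∣ u k k - schur-sum c (T k) (T k)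
      diagonal c off k = cofactor-∣ k λ {b} b≢k →
        ∣-resp (telescope (u k k) (u b k) (schur-sum c (T b) (T k)) (schur-sum c (T k) (T k))
          (off b≢k))
          (∣-- (u-≡-mod k b k) (schur-sum-≡-mod c (T k) (T b) (T k) ∣-refl))
        where
        cancelling : ∀ a b d → (a - b) - (d - b) ≈ a - d
        cancelling = solve 3 (λ a b d → (a :- b) :- (d :- b) := a :- d) ≈-refl
        telescope : ∀ a b b′ d → b ≈ b′ → (a - b) - (d - b′) ≈ a - d
        telescope a b b′ d eq = ≈-trans (+-congʳ (+-congˡ (-‿cong eq))) (cancelling a b′ d)

      Expansion : Set
      Expansion = ∃ λ c → ∃ λ (d : Fin (suc n) → Carrier) →
        (∀ {i j} → i ≢ j → u i j ≈ schur-sum c (T i) (T j)) ×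
                                  (∀ k → u k k ≈ schur-sum c (T k) (T k) + d k * P k)

      expansion-from : ∀ c → (∀ {i j} → i ≢ j → u i j ≈ schur-sum c (T i) (T j)) → Expansion
      expansion-from c off = c , (λ k → proj₁ (diag k)) , off , λ k → proj₂ (diag k)
        where
        diag : ∀ k → ∃ λ d → u k k ≈ schur-sum c (T k) (T k) + d * P k
        diag k = remainder (diagonal c off k)

      abstract
        expansion : Expansion
        expansion = let C , anti , C-spec = matrix-interpolation u symmetric u-≡-mod in
          expansion-from (λ k → C (hi k) (lo k)) (matching C anti C-spec)

∣-Π : ∀ (R : CRing) → let open Ring R; open Divisibility R in ∀ {f qs} → f ∈ qs → f ∣ Π[ qs ]
∣-Π R (here ≡.refl) = _ , CommutativeRing.refl R
∣-Π R (there i)     = Divisibility.∣-*ˡ R _ (∣-Π R i)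

module Cofactors (R : CRing) {n} (f : Fin n → CommutativeRing.Carrier R) where
  open Ring R
  open Solver R

  _without_ : List (Fin n) → Fin n → List (Fin n)
  xs without k = filter (λ i → ¬? (i Fin.≟ k)) xs

  without-head : ∀ {k} {xs : List (Fin n)} → All (k ≢_) xs → (k ∷ xs) without k ≡ xs
  without-head {k} h = ≡.trans (List.filter-reject (λ i → ¬? (i Fin.≟ k)) (λ k≢k → k≢k ≡.refl))
    (List.filter-all _ (All.map (λ k≢i i≡k → k≢i (≡.sym i≡k)) h))

  without-tail : ∀ {k i} {xs : List (Fin n)} → i ≢ k → (i ∷ xs) without k ≡ i ∷ (xs without k)
  without-tail {k} = List.filter-accept (λ i → ¬? (i Fin.≟ k))

  Π-without : ∀ {k xs} → Unique xs → k ∈ xs → Π[ map f xs ] ≈ f k * Π[ map f (xs without k) ]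
  Π-without {k} (u ∷ us) (here ≡.refl)
    rewrite without-head u = ≈-refl
  Π-without {k} {i ∷ xs} (u ∷ us) (there k∈)
    rewrite without-tail {k} {i} {xs} (All.lookup u k∈) =
      ≈-trans (*-congˡ (Π-without us k∈)) (*-swapˡ (f i) (f k) _)

  length-without : ∀ {k} {xs : List (Fin n)} → Unique xs → k ∈ xs → length xs ≡ suc
    (length (xs without k))
  length-without {k} (u ∷ us) (here ≡.refl)
    rewrite without-head u = ≡.refl
  length-without {k} {i ∷ xs} (u ∷ us) (there k∈)
    rewrite without-tail {k} {i} {xs} (All.lookup u k∈) =
      ≡.cong suc (length-without us k∈)

-- Divisibility of the entries by the coordinates

module DivisibleMatrices (R : CRing) {n} (G : GenericPoints R (2+ n)) (E : Pairs (2+ n)) where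
  open Ring R
  open Solver R
  open Sums R
  open Divisibility R
  open Alternants R
  open GenericPoints G
  open Interpolation R G
  open Expansion E
  open Pairs E
  open AntisymmetricMatrix R E
  open SetoidReasoning setoid

  Πx σ : Carrier
  Πx = Π[ map x (allFin (2+ n)) ]
  σ = (- 1#) ^ suc n

  Πx/x : Fin (2+ n) → Carrier
  Πx/x k = Π[ cofactor x k ]

  -- The power of x₁⋯x_ℓ in θ^𝒟_λ for λ = (p - 1 , q).
  weight : ℕ → ℕ → Carrier
  weight _             (suc _) = 1#
  weight (suc (suc _)) zero    = Πx
  weight _             zero    = Πx ^ 2

  W : Fin size → Carrier
  W k = weight (toℕ (hi k)) (toℕ (lo k))

  -- The matrices xᵢxⱼGᵢⱼ of θ^𝒟_λ and η^𝒟_k, where 2θ = Σ Gᵢⱼ ∂ᵢ∂ⱼ.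
  θ-matrix : Fin size → Fin (2+ n) → Fin (2+ n) → Carrier
  θ-matrix k i j = W k * s k (T i) (T j)

  η-matrix : Fin (2+ n) → Fin (2+ n) → Fin (2+ n) → Carrier
  η-matrix k i j = δ k i * δ k j * (x k * P k) - σ * (x k * Πx/x k ^ 2)

  total : (Fin (2+ n) → Carrier) → (Fin size → Carrier) → Fin (2+ n) → Fin (2+ n) → Carrier
  total d c i j = sum (λ k → d k * η-matrix k i j) + sum (λ k → c k * θ-matrix k i j)

  Πx≈ : ∀ k → Πx ≈ x k * Πx/x k
  Πx≈ k = Cofactors.Π-without R x (Unique.allFin⁺ (2+ n)) (∈-allFin k)

  Πx-regular : Regular 0# Πx
  Πx-regular = regular-Π {qs = map x (allFin (2+ n))} (All.map⁺ {P = Regular 0#} {f = x}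
    (All.universal {P = λ i → Regular 0# (x i)} (λ i → x-regular i) (allFin (2+ n))))

  Πx-∣ : ∀ {f} → (∀ a → x a ∣ f) → Πx ∣ f
  Πx-∣ h = Π-∣ (AllPairs.map⁺ (AllPairs.map (λ a≢b → x-x a≢b , x-x (a≢b ∘ ≡.sym))
    (Unique.allFin⁺ (2+ n))))
              (All.map⁺ (All.universal h (allFin (2+ n))))

  others : ∀ k → All (_≢ k) (filter (λ i → ¬? (i Fin.≟ k)) (allFin (2+ n)))
  others k = All.all-filter (λ i → ¬? (i Fin.≟ k)) (allFin (2+ n))

  regular-cofactor : ∀ {m} (f : Fin (2+ n) → Carrier) k → (∀ i → i ≢ k → Regular m (f i)) →
                     Regular m Π[ cofactor f k ]
  regular-cofactor {m} f k h = regular-Π {qs = cofactor f k} (All.map⁺ {P = Regular m} {f = f}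
    (All.map {Q = λ i → Regular m (f i)} (λ {i} i≢k → h i i≢k) (others k)))

  Πx/x-regular : ∀ k → Regular (x k) (Πx/x k)
  Πx/x-regular k = regular-cofactor x k (λ i i≢k → x-x (i≢k ∘ ≡.sym))

  P-regular : ∀ k → Regular (x k) (P k)
  P-regular k = regular-cofactor (q k) k (λ i i≢k → x-q k (i≢k ∘ ≡.sym))

  P-regular-0 : ∀ k → Regular 0# (P k)
  P-regular-0 k = regular-cofactor (q k) k (λ i i≢k → q-regular (i≢k ∘ ≡.sym))

  x∣Πx/x : ∀ {i k} → i ≢ k → x i ∣ Πx/x k
  x∣Πx/x {i} {k} i≢k = ∣-Π R (∈-map⁺ x (∈-filter⁺ (λ i → ¬? (i Fin.≟ k)) (∈-allFin i) i≢k))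

  x∣Πx : ∀ i → x i ∣ Πx
  x∣Πx i = Πx/x i , Πx≈ i

  x∣T : ∀ a → x a ∣ T a
  x∣T a = x a * 1# , ≈-refl

  -- Modulo x k each factor x k ² - x i ² is - x i ², and there are n + 1 of them. This is the
  -- source of the sign and of the square in the correction term of η.
  P-≡-mod : ∀ k → x k ∣ P k - σ * Πx/x k ^ 2
  P-≡-mod k = ≡.subst (λ m → x k ∣ P k - (- 1#) ^ m * Πx/x k ^ 2)
    (ℕ.suc-injective (≡.trans (≡.sym (Cofactors.length-without R x (Unique.allFin⁺ (2+ n))
      (∈-allFin k)))
      (List.length-tabulate {n = 2+ n} (λ i → i))))
    (products (filter (λ i → ¬? (i Fin.≟ k)) (allFin (2+ n))))
    where
    one : ∀ x y → (x * (x * 1#) - y * (y * 1#)) - (- (y * y)) ≈ x * x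
    one = solve 2 (λ x y → (x :* (x :* :1) :- y :* (y :* :1)) :- (:- (y :* y)) := x :* x) ≈-refl
    rearrange : ∀ y s m →
      (- (y * y)) * (s * (m * (m * 1#))) ≈ (- 1# * s) * ((y * m) * ((y * m) * 1#))
    rearrange = solve 3 (λ y s m → (:- (y :* y)) :* (s :* (m :* (m :* :1)))
                                := (:- :1 :* s) :* ((y :* m) :* ((y :* m) :* :1))) ≈-refl
    products : ∀ xs → x k ∣ Π[ map (q k) xs ] - (- 1#) ^ length xs * Π[ map x xs ] ^ 2
    products []       = ∣-0 (solve 0 (:1 :- :1 :* (:1 :* (:1 :* :1)) := :0) ≈-refl)
    products (i ∷ xs) = ≡-mod-trans
      (≡-mod-* {c = Π[ map (q k) xs ]} (∣-resp (≈-sym (one (x k) (x i))) (x k , ≈-refl))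
        (products xs))
      (∣-0 (≈-trans (+-congʳ (rearrange (x i) _ _)) (-‿inverseʳ _)))

  i₀-exists : ∃ λ k → hi k ≡ suc zero × lo k ≡ zero
  i₀-exists = index (s≤s z≤n)

  -- The index of λ = (0 , 0). Its Schur polynomial is the constant 1, so its coefficient is the one
  -- that absorbs the correction terms of the η matrices.
  i₀ : Fin size
  i₀ = proj₁ i₀-exists

  s-i₀ : ∀ y z → s i₀ y z ≈ 1#
  s-i₀ y z rewrite proj₁ (proj₂ i₀-exists) | proj₂ (proj₂ i₀-exists) = schur-1-0 y z

  W-i₀ : W i₀ ≈ Πx ^ 2
  W-i₀ rewrite proj₁ (proj₂ i₀-exists) | proj₂ (proj₂ i₀-exists) = ≈-refl

  -- The correction terms of the η matrices together: the same amount is subtracted from every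
  -- entry.
  Y : (Fin (2+ n) → Carrier) → Carrier
  Y d = sum (λ k → d k * (σ * (x k * Πx/x k ^ 2)))

  -- The coefficients c̄ of the Schur polynomials in total d c.
  Compatible : (Fin (2+ n) → Carrier) → (Fin size → Carrier) → (Fin size → Carrier) → Set
  Compatible d c c̄ = (∀ {k} → k ≢ i₀ → c̄ k ≈ c k * W k) × c̄ i₀ ≈ c i₀ * Πx ^ 2 - Y d

  θ-sum : ∀ {d c c̄} → Compatible d c c̄ → ∀ i j →
          sum (λ k → c k * θ-matrix k i j) ≈ schur-sum c̄ (T i) (T j) + Y d
  θ-sum {d} {c} {c̄} (eq , eq₀) i j = move _ _ _ (begin
      sum (λ k → c k * θ-matrix k i j) - schur-sum c̄ (T i) (T j)
        ≈⟨ sum-- (λ k → c k * θ-matrix k i j) (λ k → c̄ k * s k (T i) (T j)) ⟨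
      sum (λ k → c k * θ-matrix k i j - c̄ k * s k (T i) (T j))
        ≈⟨ sum-single i₀ _ vanish ⟩
      c i₀ * θ-matrix i₀ i j - c̄ i₀ * s i₀ (T i) (T j)
        ≈⟨ +-cong (*-congˡ (*-cong W-i₀ (s-i₀ (T i) (T j))))
             (-‿cong (*-cong eq₀ (s-i₀ (T i) (T j)))) ⟩
      c i₀ * (Πx ^ 2 * 1#) - (c i₀ * Πx ^ 2 - Y d) * 1#
        ≈⟨ simplify (c i₀) (Πx ^ 2) (Y d) ⟩
      Y d ∎)
    where
    move : ∀ a b c → a - b ≈ c → a ≈ b + c
    move a b c eq = ≈-trans (solve 2 (λ a b → a := b :+ (a :- b)) ≈-refl a b) (+-congˡ eq)
    simplify : ∀ c x y → c * (x * 1#) - (c * x - y) * 1# ≈ y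
    simplify = solve 3 (λ c x y → c :* (x :* :1) :- (c :* x :- y) :* :1 := y) ≈-refl
    assoc : ∀ c w s → c * (w * s) - (c * w) * s ≈ 0#
    assoc = solve 3 (λ c w s → c :* (w :* s) :- (c :* w) :* s := :0) ≈-refl
    vanish : ∀ k → k ≢ i₀ → c k * θ-matrix k i j - c̄ k * s k (T i) (T j) ≈ 0#
    vanish k k≢i₀ = ≈-trans (+-congˡ (-‿cong (*-congʳ (eq k≢i₀))))
      (assoc (c k) (W k) (s k (T i) (T j)))

  η-sum : ∀ d i j → sum (λ k → d k * η-matrix k i j) ≈
                    sum (λ k → d k * (δ k i * δ k j * (x k * P k))) - Y d
  η-sum d i j = ≈-trans (sum-cong _ (λ k → a k - b k) (λ k → distribute (d k) _ _)) (sum-- a b)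
    where
    a b : Fin (2+ n) → Carrier
    a k = d k * (δ k i * δ k j * (x k * P k))
    b k = d k * (σ * (x k * Πx/x k ^ 2))
    distribute : ∀ d a b → d * (a - b) ≈ d * a - d * b
    distribute = solve 3 (λ d a b → d :* (a :- b) := d :* a :- d :* b) ≈-refl

  total≈ : ∀ {d c c̄} → Compatible d c c̄ → ∀ i j → total d c i j ≈
           schur-sum c̄ (T i) (T j) + sum (λ k → d k * (δ k i * δ k j * (x k * P k)))
  total≈ {d} {c} {c̄} compatible i j =
    ≈-trans (+-cong (η-sum d i j) (θ-sum {d} {c} {c̄} compatible i j)) (combine _ _ _)
    where
    combine : ∀ a y s → (a - y) + (s + y) ≈ s + a
    combine = solve 3 (λ a y s → (a :- y) :+ (s :+ y) := s :+ a) ≈-refl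

  total-off-diagonal : ∀ {d c c̄} → Compatible d c c̄ → ∀ {i j} → i ≢ j →
                       total d c i j ≈ schur-sum c̄ (T i) (T j)
  total-off-diagonal {d} {c} {c̄} compatible {i} {j} i≢j =
    ≈-trans (total≈ {d} {c} {c̄} compatible i j)
    (≈-trans (+-congˡ (sum-zero _ vanish)) (+-identityʳ _))
    where
    vanish : ∀ k → d k * (δ k i * δ k j * (x k * P k)) ≈ 0#
    vanish k = ≈-trans (*-congˡ (≈-trans
      (*-congʳ (δδ-≢ {i = k} {i} {k} {j} (λ (p , q) → i≢j (≡.trans (≡.sym p) q)))) (zeroˡ _)))
        (zeroʳ _)

  total-diagonal : ∀ {d c c̄} → Compatible d c c̄ → ∀ i →
                   total d c i i ≈ schur-sum c̄ (T i) (T i) + d i * (x i * P i)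
  total-diagonal {d} {c} {c̄} compatible i = ≈-trans (total≈ {d} {c} {c̄} compatible i i) (+-congˡ
    (≈-trans (sum-single i (λ k → d k * (δ k i * δ k i * (x k * P k))) vanish)
      (*-congˡ (≈-trans (*-congʳ (≈-trans (*-cong (δ-≡ {i = i} ≡.refl) (δ-≡ {i = i} ≡.refl))
        (*-identityˡ 1#)))
        (*-identityˡ _)))))
    where
    vanish : ∀ k → k ≢ i → d k * (δ k i * δ k i * (x k * P k)) ≈ 0#
    vanish k k≢i = ≈-trans (*-congˡ (≈-trans
      (*-congʳ (δδ-≢ {i = k} {i} {k} {i} (λ (p , q) → k≢i p))) (zeroˡ _))) (zeroʳ _)

module MatrixBasis (R : CRing) {n} (G : GenericPoints R (2+ n)) (E : Pairs (2+ n)) where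
  open Ring R
  open Solver R
  open Sums R
  open Divisibility R
  open Alternants R
  open GenericPoints G
  open Interpolation R G
  open Expansion E
  open Pairs E
  open AntisymmetricMatrix R E
  open DivisibleMatrices R G E
  open SetoidReasoning setoid

  ∣-sum-single : ∀ {m k} (i : Fin k) (f : Fin k → Carrier) → (∀ j → j ≢ i → m ∣ f j) →
    m ∣ sum f - f i
  ∣-sum-single zero f h = ∣-resp (lemma (f zero) (sum (f ∘ suc)))
    (∣-sum (f ∘ suc) (λ j → h (suc j) λ ()))
    where
    lemma : ∀ a b → b ≈ a + b - a
    lemma = solve 2 (λ a b → b := a :+ b :- a) ≈-refl
  ∣-sum-single (suc i) f h = ∣-resp (lemma (f zero) (sum (f ∘ suc)) (f (suc i)))
    (∣-+ (h zero λ ()) (∣-sum-single i (f ∘ suc) (λ j j≢i → h (suc j) (j≢i ∘ Fin.suc-injective))))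
    where
    lemma : ∀ a b c → a + (b - c) ≈ a + b - c
    lemma = solve 3 (λ a b c → a :+ (b :- c) := a :+ b :- c) ≈-refl

  -- Every Schur polynomial other than the constant one is homogeneous of positive degree.
  schur-∣ : ∀ {p q} y → q ℕ.< p → ¬ (p ≡ 1 × q ≡ 0) → y ∣ schur p q y y
  schur-∣ {suc zero}    {zero}  y _ h = ⊥-elim (h (≡.refl , ≡.refl))
  schur-∣ {suc (suc p)} {zero}  y _ h = ∣-+ (∣-*ʳ _ ∣-refl) (∣-*ʳ _ ∣-refl)
  schur-∣ {suc p}       {suc q} y _ h = ∣-*ʳ _ (∣-*ʳ y ∣-refl)

  i₀-unique : ∀ {k} → toℕ (hi k) ≡ 1 → toℕ (lo k) ≡ 0 → k ≡ i₀
  i₀-unique p q = injective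
    (Fin.toℕ-injective (≡.trans p (≡.sym (≡.cong toℕ (proj₁ (proj₂ i₀-exists))))))
    (Fin.toℕ-injective (≡.trans q (≡.sym (≡.cong toℕ (proj₂ (proj₂ i₀-exists))))))

  W-∣ : ∀ {f k} → k ≢ i₀ → (lo k ≡ zero → Πx ∣ f) → W k ∣ f
  W-∣ {f} {k} k≢i₀ h = cases (hi k) (lo k) ≡.refl ≡.refl
    where
    cases : ∀ p q → p ≡ hi k → q ≡ lo k → weight (toℕ p) (toℕ q) ∣ f
    cases p             (suc q) _ _ = f , ≈-sym (*-identityˡ f)
    cases (suc (suc p)) zero    _ q = h (≡.sym q)
    cases (suc zero)    zero    p q =
      ⊥-elim (k≢i₀ (i₀-unique (≡.cong toℕ (≡.sym p)) (≡.cong toℕ (≡.sym q))))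
    cases zero          zero    p q = ⊥-elim (Fin.<-irrefl (≡.trans (≡.sym q) p) (ordered k))

  weight-regular : ∀ p q → Regular 0# (weight p q)
  weight-regular p             (suc q) = regular-1
  weight-regular (suc (suc p)) zero    = Πx-regular
  weight-regular (suc zero)    zero    = regular-* Πx-regular (regular-* Πx-regular regular-1)
  weight-regular zero          zero    = regular-* Πx-regular (regular-* Πx-regular regular-1)

  square-regular : Regular 0# (Πx ^ 2)
  square-regular = weight-regular 0 0

  regular⇒≈0 : ∀ {m f} → Regular 0# m → m * f ≈ 0# → f ≈ 0#
  regular⇒≈0 r eq = 0∣⇒≈0 (r (∣-0 eq))

  -- Off the diagonal only the Schur sum with coefficients c̄ remains, so c̄ = 0. The diagonal
  -- entries then reduce to d k x k P k, whence d = 0 and Y d = 0, and finally each c k is killed by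
  -- its regular weight.
  independent : ∀ d c → (∀ i j → total d c i j ≈ 0#) → (∀ k → d k ≈ 0#) × (∀ k → c k ≈ 0#)
  independent d c h = d≈0 , c≈0
    where
    c̄′ : ∀ k → Dec (k ≡ i₀) → Carrier
    c̄′ k (yes _) = c i₀ * Πx ^ 2 - Y d
    c̄′ k (no _)  = c k * W k
    c̄ : Fin size → Carrier
    c̄ k = c̄′ k (k Fin.≟ i₀)
    compatible : Compatible d c c̄
    compatible = (λ {k} → at k) , at₀
      where
      at : ∀ k → k ≢ i₀ → c̄ k ≈ c k * W k
      at k k≢i₀ with k Fin.≟ i₀
      ... | yes eq = ⊥-elim (k≢i₀ eq)
      ... | no _   = ≈-refl
      at₀ : c̄ i₀ ≈ c i₀ * Πx ^ 2 - Y d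
      at₀ with i₀ Fin.≟ i₀
      ... | yes _ = ≈-refl
      ... | no ne = ⊥-elim (ne ≡.refl)
    c̄≈0 : ∀ k → c̄ k ≈ 0#
    c̄≈0 = off-diagonal-independent c̄ λ {i} {j} i≢j →
      ≈-trans (≈-sym (total-off-diagonal {d} {c} {c̄} compatible i≢j)) (h i j)
    schur-sum≈0 : ∀ y z → schur-sum c̄ y z ≈ 0#
    schur-sum≈0 y z = sum-zero (λ k → c̄ k * s k y z) (λ k → ≈-trans (*-congʳ (c̄≈0 k)) (zeroˡ _))
    d≈0 : ∀ k → d k ≈ 0#
    d≈0 k = regular⇒≈0 (regular-* (x-regular k) (P-regular-0 k)) (≈-trans (*-comm _ (d k))
      (≈-trans (≈-sym (+-identityˡ _)) (≈-trans (+-congʳ (≈-sym (schur-sum≈0 (T k) (T k))))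
        (≈-trans (≈-sym (total-diagonal {d} {c} {c̄} compatible k)) (h k k)))))
    Y≈0 : Y d ≈ 0#
    Y≈0 = sum-zero (λ k → d k * (σ * (x k * Πx/x k ^ 2))) (λ k → ≈-trans (*-congʳ (d≈0 k))
      (zeroˡ _))
    c≈0 : ∀ k → c k ≈ 0#
    c≈0 k with k Fin.≟ i₀
    ... | no k≢i₀ = regular⇒≈0 (weight-regular (toℕ (hi k)) (toℕ (lo k)))
      (≈-trans (*-comm _ (c k)) (≈-trans (≈-sym (proj₁ compatible k≢i₀)) (c̄≈0 k)))
    ... | yes ≡.refl = regular⇒≈0 square-regular (≈-trans (*-comm _ (c k))
      (≈-trans (lemma (c k * Πx ^ 2) (Y d))
        (≈-trans (+-cong (≈-trans (≈-sym (proj₂ compatible)) (c̄≈0 k)) Y≈0)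
        (+-identityˡ 0#))))
      where
      lemma : ∀ a b → a ≈ (a - b) + b
      lemma = solve 2 (λ a b → a := (a :- b) :+ b) ≈-refl

  module _ (u g : Fin (2+ n) → Fin (2+ n) → Carrier)
           (symmetric : ∀ i j → u i j ≈ u j i)
           (u-≡-mod : ∀ i j k → q i j ∣ u i k - u j k)
           (divisible : ∀ i j → u i j ≈ x i * (x j * g i j)) where

    module _ (c : Fin size → Carrier) (d : Fin (2+ n) → Carrier)
             (off : ∀ {i j} → i ≢ j → u i j ≈ schur-sum c (T i) (T j))
             (diagonal-spec : ∀ k → u k k ≈ schur-sum c (T k) (T k) + d k * P k) where

      x∣bilinear : ∀ a j → x a ∣ bilinear (matrix c) (T a) (T j)
      x∣bilinear a j = ∣-resp (schur-sum-spec c (T a) (T j)) at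
        where
        at : x a ∣ q a j * schur-sum c (T a) (T j)
        at with a Fin.≟ j
        ... | yes ≡.refl = ∣-0 (≈-trans (*-congʳ (q-refl a)) (zeroˡ _))
        ... | no a≢j = ∣-*ˡ _ (_ , ≈-trans (≈-sym (off a≢j)) (divisible a j))

      -- Put y = T a in the bilinear polynomial: modulo x a only the row of exponent 0 in y remains.
      -- It vanishes at all points T j, also at j = a because of the factor q a j, and these are
      -- distinct modulo x a.
      x∣first-row : ∀ a p → x a ∣ matrix c zero p
      x∣first-row a = vanishing-polynomial T (λ i≢j → x-q a i≢j) (matrix c zero)
        (λ j → ∣-cancel-+ (∣-resp (+-comm _ _) (x∣bilinear a j)) (∣-*ʳ _ (x∣T a)))

      x∣c : ∀ {k} → lo k ≡ zero → ∀ a → x a ∣ c k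
      x∣c {k} eq a = ∣-resp (matrix-entry c k)
        (∣-resp (≈-sym (matrix-antisymmetric c (hi k) (lo k)))
        (∣-neg (≡.subst (λ p → x a ∣ matrix c p (hi k)) (≡.sym eq) (x∣first-row a (hi k)))))

      Πx∣c : ∀ {k} → lo k ≡ zero → Πx ∣ c k
      Πx∣c eq = Πx-∣ (x∣c eq)

      -- Read the diagonal entry modulo T a: the entry is divisible by x a ², and so is every Schur
      -- polynomial at (T a , T a) except the constant one.
      T∣ : ∀ a → T a ∣ c i₀ + d a * P a
      T∣ a = ∣-resp (lemma (u a a) (schur-sum c (T a) (T a)) (c i₀) (d a * P a) (diagonal-spec a))
        (∣-- (g a a , ≈-trans (divisible a a) (assoc (x a) (g a a)))
             (∣-resp (+-congˡ (-‿cong (≈-trans (*-congˡ (s-i₀ (T a) (T a))) (*-identityʳ _))))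
               (∣-sum-single i₀ (λ k → c k * s k (T a) (T a)) (λ k k≢i₀ → ∣-*ˡ (c k)
                 (schur-∣ (T a) (ordered k) (λ (p , q) → k≢i₀ (i₀-unique p q)))))))
        where
        assoc : ∀ x g → x * (x * g) ≈ (x * (x * 1#)) * g
        assoc = solve 2 (λ x g → x :* (x :* g) := (x :* (x :* :1)) :* g) ≈-refl
        lemma : ∀ u s c dP → u ≈ s + dP → u - (s - c) ≈ c + dP
        lemma u s c dP eq = ≈-trans (+-congʳ eq)
          (solve 3 (λ s c dP → (s :+ dP) :- (s :- c) := c :+ dP) ≈-refl s c dP)

      module _ (c′ : Carrier) (c≈ : c i₀ ≈ Πx * c′)
               (d′ : Fin (2+ n) → Carrier) (d≈ : ∀ a → d a ≈ x a * d′ a) where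

        x∣quotient : ∀ a → x a ∣ Πx/x a * c′ + d′ a * P a
        x∣quotient a = let h , eq = T∣ a in h , cancel (x-regular a) (begin
          x a * (Πx/x a * c′ + d′ a * P a)        ≈⟨ lemma₁ (x a) (Πx/x a) c′ (d′ a) (P a) ⟩
          (x a * Πx/x a) * c′ + (x a * d′ a) * P a ≈⟨ +-cong (*-congʳ (Πx≈ a)) (*-congʳ (d≈ a)) ⟨
          Πx * c′ + d a * P a                     ≈⟨ +-congʳ c≈ ⟨
          c i₀ + d a * P a                        ≈⟨ eq ⟩
          T a * h                                 ≈⟨ lemma₂ (x a) h ⟩
          x a * (x a * h)                         ∎)
          where
          lemma₁ : ∀ x y c d p → x * (y * c + d * p) ≈ (x * y) * c + (x * d) * p
          lemma₁ = solve 5 (λ x y c d p → x :* (y :* c :+ d :* p) := (x :* y) :* c :+ (x :* d) :* p)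
            ≈-refl
          lemma₂ : ∀ x h → (x * (x * 1#)) * h ≈ x * (x * h)
          lemma₂ = solve 2 (λ x h → (x :* (x :* :1)) :* h := x :* (x :* h)) ≈-refl

        -- After division by x a, replace P a by its residue modulo x a; both terms then contain
        -- Πx/x a, which is cancelled.
        x∣c′ : ∀ a → x a ∣ c′ + σ * (Πx/x a * d′ a)
        x∣c′ a = Πx/x-regular a (∣-resp (lemma (Πx/x a) c′ (d′ a) (P a) σ)
          (∣-- (x∣quotient a) (∣-*ˡ (d′ a) (P-≡-mod a))))
          where
          lemma : ∀ y c d p s → y * c + d * p - d * (p - s * (y * (y * 1#))) ≈ y * (c + s * (y * d))
          lemma = solve 5 (λ y c d p s → y :* c :+ d :* p :- d :* (p :- s :* (y :* (y :* :1)))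
                                      := y :* (c :+ s :* (y :* d))) ≈-refl

        -- Solves the congruences on c′ for all a at once: modulo x a every summand with b ≠ a
        -- vanishes, because Πx/x b contains x a. As Πx c″ = c i₀ + Y d′, divisibility of c″ by Πx
        -- gives c i₀ the shape demanded by `Compatible`.
        c″ : Carrier
        c″ = c′ + sum (λ a → σ * (Πx/x a * d′ a))

        x∣c″ : ∀ a → x a ∣ c″
        x∣c″ a = ∣-resp (lemma c′ (σ * (Πx/x a * d′ a)) (sum (λ b → σ * (Πx/x b * d′ b))))
          (∣-+ (x∣c′ a)
          (∣-sum-single a (λ b → σ * (Πx/x b * d′ b)) (λ b b≢a →
            ∣-*ˡ σ (∣-*ʳ (d′ b) (x∣Πx/x (b≢a ∘ ≡.sym))))))
          where
          lemma : ∀ c y s → (c + y) + (s - y) ≈ c + s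
          lemma = solve 3 (λ c y s → (c :+ y) :+ (s :- y) := c :+ s) ≈-refl

        Πx∣c″ : Πx ∣ c″
        Πx∣c″ = Πx-∣ x∣c″

        Πx*sum : Πx * sum (λ a → σ * (Πx/x a * d′ a)) ≈ Y d′
        Πx*sum = ≈-trans (*-sumˡ Πx (λ a → σ * (Πx/x a * d′ a)))
          (sum-cong _ (λ a → d′ a * (σ * (x a * Πx/x a ^ 2))) λ a →
            ≈-trans (*-congʳ (Πx≈ a)) (lemma (x a) (Πx/x a) σ (d′ a)))
          where
          lemma : ∀ x y s d → (x * y) * (s * (y * d)) ≈ d * (s * (x * (y * (y * 1#))))
          lemma = solve 4 (λ x y s d → (x :* y) :* (s :* (y :* d)) := d :*
            (s :* (x :* (y :* (y :* :1))))) ≈-refl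

        c≈-from : ∀ {e} → c″ ≈ Πx * e → c i₀ ≈ e * Πx ^ 2 - Y d′
        c≈-from {e} eq = begin
          c i₀                              ≈⟨ c≈ ⟩
          Πx * c′                           ≈⟨ lemma₁ Πx c′ Σ′ ⟩
          Πx * c″ - Πx * Σ′                 ≈⟨ +-cong (*-congˡ eq) (-‿cong Πx*sum) ⟩
          Πx * (Πx * e) - Y d′              ≈⟨ +-congʳ (lemma₂ Πx e) ⟩
          e * Πx ^ 2 - Y d′                 ∎
          where
          Σ′ = sum (λ a → σ * (Πx/x a * d′ a))
          lemma₁ : ∀ x c s → x * c ≈ x * (c + s) - x * s
          lemma₁ = solve 3 (λ x c s → x :* c := x :* (c :+ s) :- x :* s) ≈-refl
          lemma₂ : ∀ x e → x * (x * e) ≈ e * (x * (x * 1#))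
          lemma₂ = solve 2 (λ x e → x :* (x :* e) := e :* (x :* (x :* :1))) ≈-refl

        Combination : Set
        Combination = ∃ λ d → ∃ λ c → ∀ i j → u i j ≈ total d c i j

        combination-from : Πx ∣ c″ → Combination
        combination-from (e , eq) = d′ , (λ k → proj₁ (quotients k)) , at
          where
          -- Carries the outcome of the case distinction in `quotients`: division by the weight away
          -- from i₀, and the prescribed value e at i₀.
          Quotient : Fin size → Carrier → Set
          Quotient k c̃ = (k ≢ i₀ → c k ≈ c̃ * W k) × (k ≡ i₀ → c̃ ≈ e)
          quotients : ∀ k → ∃ (Quotient k)
          quotients k with k Fin.≟ i₀
          ... | yes k≡i₀ = e , (λ k≢i₀ → ⊥-elim (k≢i₀ k≡i₀)) , λ _ → ≈-refl
          ... | no k≢i₀ = let f , eq = W-∣ k≢i₀ Πx∣c in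
            f , (λ _ → ≈-trans eq (*-comm _ f)) , λ k≡i₀ → ⊥-elim (k≢i₀ k≡i₀)
          compatible : Compatible d′ (λ k → proj₁ (quotients k)) c
          compatible = (λ {k} → proj₁ (proj₂ (quotients k))) ,
            ≈-trans (c≈-from eq) (+-congʳ (*-congʳ (≈-sym (proj₂ (proj₂ (quotients i₀)) ≡.refl))))
          at : ∀ i j → u i j ≈ total d′ (λ k → proj₁ (quotients k)) i j
          at i j with i Fin.≟ j
          ... | no i≢j = ≈-trans (off i≢j)
            (≈-sym (total-off-diagonal {d′} {λ k → proj₁ (quotients k)} {c} compatible i≢j))
          ... | yes ≡.refl = ≈-trans (diagonal-spec i) (≈-trans
            (+-congˡ (≈-trans (*-congʳ (≈-trans (d≈ i) (*-comm _ (d′ i))))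
              (*-assoc (d′ i) (x i) (P i))))
            (≈-sym (total-diagonal {d′} {λ k → proj₁ (quotients k)} {c} compatible i)))

      -- x a divides c i₀, since its pair has lo = 0, and it divides c i₀ + d a P a; P a is regular
      -- modulo x a.
      x∣d : ∀ a → x a ∣ d a
      x∣d a = P-regular a (∣-resp (*-comm _ _)
        (∣-cancel-+ (∣-trans (x∣T a) (T∣ a)) (x∣c (proj₂ (proj₂ i₀-exists)) a)))

      abstract
        combination-of : ∃ λ d → ∃ λ c → ∀ i j → u i j ≈ total d c i j
        combination-of = let c′ , c≈ = Πx∣c (proj₂ (proj₂ i₀-exists)) in
          combination-from c′ c≈ (λ a → proj₁ (x∣d a)) (λ a → proj₂ (x∣d a))
            (Πx∣c″ c′ c≈ (λ a → proj₁ (x∣d a)) (λ a → proj₂ (x∣d a)))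

    spanning : ∃ λ d → ∃ λ c → ∀ i j → u i j ≈ total d c i j
    spanning = let c , d , off , diagonal-spec = expansion u symmetric u-≡-mod in
      combination-of c d off diagonal-spec

module BasisMatrices (R : CRing) {n} (G : GenericPoints R (2+ n)) (E : Pairs (2+ n)) where
  open Ring R
  open Solver R
  open Divisibility R
  open Alternants R
  open GenericPoints G
  open Interpolation R G
  open Expansion E
  open Pairs E
  open DivisibleMatrices R G E
  open MatrixBasis R G E

  schur-symmetric : ∀ p r i j → schur p r (T i) (T j) ≈ schur p r (T j) (T i)
  schur-symmetric p r i j with i Fin.≟ j
  ... | yes ≡.refl = ≈-refl
  ... | no i≢j     = cancel (q-regular i≢j)
    (≈-trans (*-comm _ _) (≈-trans (schur-sym {p} {r} (T i) (T j)) (*-comm _ _)))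

  θ-symmetric : ∀ k i j → θ-matrix k i j ≈ θ-matrix k j i
  θ-symmetric k i j = *-congˡ (schur-symmetric (toℕ (hi k)) (toℕ (lo k)) i j)

  θ-≡-mod : ∀ k i j l → q i j ∣ θ-matrix k i l - θ-matrix k j l
  θ-≡-mod k i j l = ≡-mod-* ≡-mod-refl (schur-≡-mod (T l) (ordered k) ∣-refl)

  η-symmetric : ∀ k i j → η-matrix k i j ≈ η-matrix k j i
  η-symmetric k i j = +-congʳ (*-congʳ (*-comm _ _))

  -- The correction term is constant and cancels. What is left is concentrated at (k , k), where P k
  -- contains every T k - T j.
  η-≡-mod : ∀ k i j l → q i j ∣ η-matrix k i l - η-matrix k j l
  η-≡-mod k i j l = ≡-mod-+ at ≡-mod-refl
    where
    q∣P : ∀ {j} → j ≢ k → q k j ∣ P k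
    q∣P {j} j≢k = ∣-Π R (∈-map⁺ (q k) (∈-filter⁺ (λ i → ¬? (i Fin.≟ k)) (∈-allFin j) j≢k))
    q∣P′ : ∀ {i} → i ≢ k → q i k ∣ P k
    q∣P′ {i} i≢k = ∣-respˡ (lemma (T k) (T i)) (∣-negˡ (q∣P i≢k))
      where
      lemma : ∀ a b → - (a - b) ≈ b - a
      lemma = solve 2 (λ a b → :- (a :- b) := b :- a) ≈-refl
    zero-≡ : ∀ {m a b c} → a ≈ 0# → b ≈ 0# → m ∣ a * c - b * c
    zero-≡ {m} {a} {b} {c} p r = ∣-0 (≈-trans (+-cong (*-congʳ p) (-‿cong (*-congʳ r)))
      (solve 1 (λ c → :0 :* c :- :0 :* c := :0) ≈-refl c))
    at : q i j ∣ δ k i * δ k l * (x k * P k) - δ k j * δ k l * (x k * P k)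
    at with k Fin.≟ i | k Fin.≟ j
    ... | yes ≡.refl | yes ≡.refl = ≡-mod-refl
    ... | no _       | no _       = zero-≡ (zeroˡ _) (zeroˡ _)
    ... | yes ≡.refl | no k≢j     = ∣-- (∣-*ˡ _ (∣-*ˡ (x k) (q∣P (k≢j ∘ ≡.sym))))
      (∣-*ˡ _ (∣-*ˡ (x k) (q∣P (k≢j ∘ ≡.sym))))
    ... | no k≢i     | yes ≡.refl = ∣-- (∣-*ˡ _ (∣-*ˡ (x k) (q∣P′ (k≢i ∘ ≡.sym))))
      (∣-*ˡ _ (∣-*ˡ (x k) (q∣P′ (k≢i ∘ ≡.sym))))

  xx∣Πx : ∀ {i j} → i ≢ j → x i * x j ∣ Πx
  xx∣Πx {i} {j} i≢j = coprime-∣ (x-x i≢j) (x∣Πx i) (x∣Πx j)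

  xx∣TT : ∀ i j → x i * x j ∣ T i * T j
  xx∣TT i j = ∣-*-cong (x∣T i) (x∣T j)

  -- For λ₂ ≥ 1 the Schur polynomial contains T i T j. For λ₂ = 0 the weight contains x i x j when i
  -- ≠ j; on the diagonal the positive degree supplies T i, except for λ = (0 , 0), whose weight is
  -- therefore a square.
  weighted-schur-∣ : ∀ p r i j → r ℕ.< p → x i * x j ∣ weight p r * schur p r (T i) (T j)
  weighted-schur-∣ (suc p)       (suc r) i j _ = ∣-*ˡ 1# (∣-*ʳ (schur p r (T i) (T j)) (xx∣TT i j))
  weighted-schur-∣ (suc zero)    zero    i j _ = ∣-*ʳ _ (∣-*-cong (x∣Πx i) (∣-*ʳ 1# (x∣Πx j)))
  weighted-schur-∣ (suc (suc p)) zero    i j _ with i Fin.≟ j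
  ... | no i≢j     = ∣-*ʳ _ (xx∣Πx i≢j)
  ... | yes ≡.refl = ∣-*ˡ Πx (∣-respˡ (*-congˡ (*-identityʳ (x i))) (schur-∣ {suc (suc p)} {zero}
    (T i) (s≤s z≤n) λ ()))

  xx∣θ : ∀ k i j → x i * x j ∣ θ-matrix k i j
  xx∣θ k i j = weighted-schur-∣ (toℕ (hi k)) (toℕ (lo k)) i j (ordered k)

  -- Away from (k , k) the correction term is Πx times Πx/x k up to sign. At (k , k) one factor x k
  -- is explicit, and the other is the congruence `P-≡-mod`.
  xx∣η : ∀ k i j → x i * x j ∣ η-matrix k i j
  xx∣η k i j = cases (i Fin.≟ k) (j Fin.≟ k)
    where
    split : ∀ k → σ * (Πx * Πx/x k) ≈ σ * (x k * Πx/x k ^ 2)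
    split k = *-congˡ (≈-trans (*-congʳ (Πx≈ k)) (lemma (x k) (Πx/x k)))
      where
      lemma : ∀ x y → (x * y) * y ≈ x * (y * (y * 1#))
      lemma = solve 2 (λ x y → (x :* y) :* y := x :* (y :* (y :* :1))) ≈-refl
    off : ¬ (k ≡ i × k ≡ j) → x i * x j ∣ Πx * Πx/x k → x i * x j ∣ η-matrix k i j
    off h p = ∣-- (∣-0 (≈-trans (*-congʳ (δδ-≢ {i = k} {i} {k} {j} h)) (zeroˡ _)))
      (∣-resp (split k) (∣-*ˡ σ p))
    cases : Dec (i ≡ k) → Dec (j ≡ k) → x i * x j ∣ η-matrix k i j
    cases (no i≢k) _ = off (λ (p , _) → i≢k (≡.sym p))
      (∣-resp (*-comm _ _) (∣-*-cong (x∣Πx/x i≢k) (x∣Πx j)))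
    cases (yes _) (no j≢k) = off (λ (_ , p) → j≢k (≡.sym p)) (∣-*-cong (x∣Πx i) (x∣Πx/x j≢k))
    cases (yes ≡.refl) (yes ≡.refl) = ∣-resp
      (≈-trans (lemma (x k) (P k) σ (Πx/x k ^ 2)) (+-congʳ (≈-sym (≈-trans (*-congʳ
        (≈-trans (*-cong (δ-≡ {i = k} ≡.refl) (δ-≡ {i = k} ≡.refl)) (*-identityˡ 1#)))
          (*-identityˡ _)))))
      (∣-*-cong (∣-refl {x k}) (P-≡-mod k))
      where
      lemma : ∀ x p s y → x * (p - s * y) ≈ x * p - s * (x * y)
      lemma = solve 4 (λ x p s y → x :* (p :- s :* y) := x :* p :- s :* (x :* y)) ≈-refl

-- Polynomial rings: evaluation, derivations and division by xᵢ - a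

record IsSemiringHomomorphism (A B : CRing)
                              (f : CommutativeRing.Carrier A → CommutativeRing.Carrier B) : Set where
  private
    module A = CommutativeRing A
    module B = CommutativeRing B
  field
    cong   : ∀ {a b} → a A.≈ b → f a B.≈ f b
    homo-+ : ∀ a b → f (a A.+ b) B.≈ f a B.+ f b
    homo-* : ∀ a b → f (a A.* b) B.≈ f a B.* f b
    homo-0 : f A.0# B.≈ B.0#
    homo-1 : f A.1# B.≈ B.1#

module Evaluation {A B : CRing} {X : Set} {E : Rel (Term (CommutativeRing.Carrier A) X) 0ℓ}
                  {f : CommutativeRing.Carrier A → CommutativeRing.Carrier B}
                  (hom : IsSemiringHomomorphism A B f) {ρ : X → CommutativeRing.Carrier B}
                  (respects : ∀ {p q} → E p q →
                    CommutativeRing._≈_ B (evaluate B f ρ p) (evaluate B f ρ q)) where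
  open Presentation A X E
  open IsSemiringHomomorphism hom
  private module B = Ring B
  open B using (_≈_)

  ⟦_⟧ : Term (CommutativeRing.Carrier A) X → CommutativeRing.Carrier B
  ⟦_⟧ = evaluate B f ρ

  evaluate-cong : ∀ {p q} → p ≋ q → ⟦ p ⟧ ≈ ⟦ q ⟧
  evaluate-cong (relation e)     = respects e
  evaluate-cong ≋-refl           = B.≈-refl
  evaluate-cong (≋-sym p)        = B.≈-sym (evaluate-cong p)
  evaluate-cong (≋-trans p q)    = B.≈-trans (evaluate-cong p) (evaluate-cong q)
  evaluate-cong (⊕-cong p q)     = B.+-cong (evaluate-cong p) (evaluate-cong q)
  evaluate-cong (⊗-cong p q)     = B.*-cong (evaluate-cong p) (evaluate-cong q)
  evaluate-cong (⊝-cong p)       = B.-‿cong (evaluate-cong p)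
  evaluate-cong (con-cong p)     = cong p
  evaluate-cong (con-+ a b)      = homo-+ a b
  evaluate-cong (con-* a b)      = homo-* a b
  evaluate-cong (⊕-assoc p q r)  = B.+-assoc ⟦ p ⟧ ⟦ q ⟧ ⟦ r ⟧
  evaluate-cong (⊕-comm p q)     = B.+-comm ⟦ p ⟧ ⟦ q ⟧
  evaluate-cong (⊕-idˡ p)        = B.≈-trans (B.+-congʳ homo-0) (B.+-identityˡ ⟦ p ⟧)
  evaluate-cong (⊝-invˡ p)       = B.≈-trans (B.-‿inverseˡ ⟦ p ⟧) (B.≈-sym homo-0)
  evaluate-cong (⊗-assoc p q r)  = B.*-assoc ⟦ p ⟧ ⟦ q ⟧ ⟦ r ⟧
  evaluate-cong (⊗-comm p q)     = B.*-comm ⟦ p ⟧ ⟦ q ⟧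
  evaluate-cong (⊗-idˡ p)        = B.≈-trans (B.*-congʳ homo-1) (B.*-identityˡ ⟦ p ⟧)
  evaluate-cong (distribˡ p q r) = B.distribˡ ⟦ p ⟧ ⟦ q ⟧ ⟦ r ⟧

constants : ∀ {A X E} → IsSemiringHomomorphism A (Presentation.algebra A X E) con
constants {A} {X} {E} = record
  { cong = con-cong ; homo-+ = con-+ ; homo-* = con-* ; homo-0 = ≋-refl ; homo-1 = ≋-refl }
  where open Presentation A X E

module _ {ℓ : ℕ} where
  open Ring (S ℓ)
  open Solver (S ℓ)
  open Divisibility (S ℓ)
  open Presentation ℝ-ring (Fin ℓ) (λ _ _ → ⊥) renaming (distribˡ to ⊗-distribˡ)

  record IsEndomorphism (ρ : ∣S∣ ℓ → ∣S∣ ℓ) : Set where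
    field
      cong   : ∀ {p q} → p ≈ q → ρ p ≈ ρ q
      homo-con : ∀ a → ρ (con a) ≈ con a
      homo-⊕ : ∀ p q → ρ (p ⊕ q) ≈ ρ p + ρ q
      homo-⊗ : ∀ p q → ρ (p ⊗ q) ≈ ρ p * ρ q
      homo-⊝ : ∀ p → ρ (⊝ p) ≈ - ρ p

  -- A ρ-derivation D with p = ρ p + π · D p; the latter makes D(pq) symmetric in p and q.
  module TwistedDerivation {ρ} (end : IsEndomorphism ρ) (π : ∣S∣ ℓ) (v : Fin ℓ → ∣S∣ ℓ)
                           (on-variables : ∀ j → var j ≈ ρ (var j) + π * v j) where
    open IsEndomorphism end

    D : ∣S∣ ℓ → ∣S∣ ℓ
    D (con a) = 0#
    D (var j) = v j
    D (p ⊕ q) = D p + D q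
    D (p ⊗ q) = D p * q + ρ p * D q
    D (⊝ p)   = - D p

    decomposition : ∀ p → p ≈ ρ p + π * D p
    decomposition (con a) = ≈-sym (≈-trans (+-cong (homo-con a) (zeroʳ π)) (+-identityʳ _))
    decomposition (var j) = on-variables j
    decomposition (p ⊕ q) = ≈-trans (+-cong (decomposition p) (decomposition q))
      (≈-trans (lemma (ρ p) (ρ q) π (D p) (D q)) (+-congʳ (≈-sym (homo-⊕ p q))))
      where
      lemma : ∀ a b π c d → (a + π * c) + (b + π * d) ≈ (a + b) + π * (c + d)
      lemma = solve 5 (λ a b π c d → (a :+ π :* c) :+ (b :+ π :* d) := (a :+ b) :+ π :* (c :+ d))
        ≈-refl
    decomposition (p ⊗ q) = ≈-trans (*-congʳ (decomposition p))
      (≈-trans (lemma₁ (ρ p) π (D p) q)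
      (≈-trans (+-congʳ (*-congˡ (decomposition q)))
      (≈-trans (lemma₂ (ρ p) (ρ q) π (D q) (D p * q)) (+-congʳ (≈-sym (homo-⊗ p q))))))
      where
      lemma₁ : ∀ a π c q → (a + π * c) * q ≈ a * q + π * (c * q)
      lemma₁ = solve 4 (λ a π c q → (a :+ π :* c) :* q := a :* q :+ π :* (c :* q)) ≈-refl
      lemma₂ : ∀ a b π d e → a * (b + π * d) + π * e ≈ a * b + π * (e + a * d)
      lemma₂ = solve 5 (λ a b π d e → a :* (b :+ π :* d) :+ π :* e := a :* b :+ π :* (e :+ a :* d))
        ≈-refl
    decomposition (⊝ p) = ≈-trans (-‿cong (decomposition p))
      (≈-trans (lemma (ρ p) π (D p)) (+-congʳ (≈-sym (homo-⊝ p))))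
      where
      lemma : ∀ a π c → - (a + π * c) ≈ - a + π * - c
      lemma = solve 3 (λ a π c → :- (a :+ π :* c) := :- a :+ π :* :- c) ≈-refl

    D-cong : ∀ {p q} → p ≋ q → D p ≈ D q
    D-cong ≋-refl           = ≈-refl
    D-cong (≋-sym p)        = ≈-sym (D-cong p)
    D-cong (≋-trans p q)    = ≈-trans (D-cong p) (D-cong q)
    D-cong (⊕-cong p q)     = +-cong (D-cong p) (D-cong q)
    D-cong (⊗-cong p q)     = +-cong (*-cong (D-cong p) q) (*-cong (cong p) (D-cong q))
    D-cong (⊝-cong p)       = -‿cong (D-cong p)
    D-cong (con-cong p)     = ≈-refl
    D-cong (con-+ a b)      = ≈-sym (+-identityʳ 0#)
    D-cong (con-* a b)      = ≈-sym (≈-trans (+-cong (zeroˡ _) (zeroʳ _)) (+-identityʳ 0#))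
    D-cong (⊕-assoc p q r)  = +-assoc _ _ _
    D-cong (⊕-comm p q)     = +-comm _ _
    D-cong (⊕-idˡ p)        = +-identityˡ _
    D-cong (⊝-invˡ p)       = -‿inverseˡ _
    D-cong (⊗-assoc p q r)  = ≈-trans (lemma (D p) q r (ρ p) (D q) (ρ (p ⊗ q)) (D r))
      (+-congˡ (≈-trans (+-congˡ (≈-trans (*-congʳ (homo-⊗ p q)) (*-assoc _ _ _)))
        (≈-sym (distribˡ _ _ _))))
      where
      lemma : ∀ dp q r a dq b dr →
        (dp * q + a * dq) * r + b * dr ≈ dp * (q * r) + (a * (dq * r) + b * dr)
      lemma = solve 7 (λ dp q r a dq b dr → (dp :* q :+ a :* dq) :* r :+ b :* dr
                                         := dp :* (q :* r) :+ (a :* (dq :* r) :+ b :* dr)) ≈-refl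
    D-cong (⊗-comm p q)     = ≈-trans (+-congʳ (*-congˡ (decomposition q)))
      (≈-trans (lemma (D p) (ρ q) π (D q) (ρ p)) (+-congʳ (*-congˡ (≈-sym (decomposition p)))))
      where
      lemma : ∀ dp b π dq a → dp * (b + π * dq) + a * dq ≈ dq * (a + π * dp) + b * dp
      lemma = solve 5 (λ dp b π dq a → dp :* (b :+ π :* dq) :+ a :* dq
                                    := dq :* (a :+ π :* dp) :+ b :* dp) ≈-refl
    D-cong (⊗-idˡ p)        =
      ≈-trans (+-cong (zeroˡ p) (≈-trans (*-congʳ (homo-con _)) (*-identityˡ _)))
                                      (+-identityˡ _)
    D-cong (⊗-distribˡ p q r) = lemma (D p) q r (ρ p) (D q) (D r)
      where
      lemma : ∀ dp q r a dq dr →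
        dp * (q + r) + a * (dq + dr) ≈ (dp * q + a * dq) + (dp * r + a * dr)
      lemma = solve 6 (λ dp q r a dq dr → dp :* (q :+ r) :+ a :* (dq :+ dr)
                                       := (dp :* q :+ a :* dq) :+ (dp :* r :+ a :* dr)) ≈-refl

  -- Substitution xᵢ := a and division by xᵢ - a, where a does not involve xᵢ.
  module Division (i : Fin ℓ) (a : ∣S∣ ℓ) where

    substitution : Fin ℓ → ∣S∣ ℓ
    substitution j = if does (i Fin.≟ j) then a else var j

    ρ : ∣S∣ ℓ → ∣S∣ ℓ
    ρ = evaluate (S ℓ) con substitution

    π : ∣S∣ ℓ
    π = var i - a

    ρ-endomorphism : IsEndomorphism ρ
    ρ-endomorphism = record
      { cong = Evaluation.evaluate-cong {f = con} constants {ρ = substitution} (λ ())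
      ; homo-con = λ _ → ≈-refl ; homo-⊕ = λ _ _ → ≈-refl ; homo-⊗ = λ _ _ → ≈-refl ; homo-⊝ = λ _ →
        ≈-refl }

    indicator : Fin ℓ → ∣S∣ ℓ
    indicator j = if does (i Fin.≟ j) then 1# else 0#

    on-variables : ∀ j → var j ≈ ρ (var j) + π * indicator j
    on-variables j with i Fin.≟ j
    ... | yes ≡.refl = lemma (var i) a
      where
      lemma : ∀ x a → x ≈ a + (x - a) * 1#
      lemma = solve 2 (λ x a → x := a :+ (x :- a) :* :1) ≈-refl
    ... | no _ = ≈-sym (≈-trans (+-congˡ (zeroʳ π)) (+-identityʳ _))

    open TwistedDerivation ρ-endomorphism π indicator on-variables public
    open IsEndomorphism ρ-endomorphism using () renaming (cong to ρ-cong) public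

    ρ-same : ρ (var i) ≈ a
    ρ-same rewrite dec-true (i Fin.≟ i) ≡.refl = ≈-refl

    ρ-other : ∀ {j} → j ≢ i → ρ (var j) ≈ var j
    ρ-other {j} j≢i rewrite dec-false (i Fin.≟ j) (j≢i ∘ ≡.sym) = ≈-refl

    D-same : D (var i) ≈ 1#
    D-same rewrite dec-true (i Fin.≟ i) ≡.refl = ≈-refl

    D-other : ∀ {j} → j ≢ i → D (var j) ≈ 0#
    D-other {j} j≢i rewrite dec-false (i Fin.≟ j) (j≢i ∘ ≡.sym) = ≈-refl

    module _ (ρa≈a : ρ a ≈ a) (Da≈0 : D a ≈ 0#) where

      ρπ≈0 : ρ π ≈ 0#
      ρπ≈0 = ≈-trans (+-cong ρ-same (-‿cong ρa≈a)) (-‿inverseʳ a)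

      -- As ρ π = 0 and D π = 1, the twisted product rule makes D a left inverse of multiplication
      -- by π.
      D-π* : ∀ f → D (π * f) ≈ f
      D-π* f = ≈-trans (+-cong (*-congʳ (+-cong D-same (-‿cong Da≈0))) (*-congʳ ρπ≈0))
        (lemma f (D f))
        where
        lemma : ∀ f d → (1# - 0#) * f + 0# * d ≈ f
        lemma = solve 2 (λ f d → (:1 :- :0) :* f :+ :0 :* d := f) ≈-refl

      π-regular : Regular 0# π
      π-regular {f} p = ∣-0 (≈-trans (≈-sym (D-π* f)) (D-cong (0∣⇒≈0 p)))

      -- If π divides d f, applying ρ gives ρ d · ρ f = 0, so ρ f = 0 and the decomposition of f
      -- leaves π · D f.
      regular-modulo-π : ∀ {d} → Regular 0# (ρ d) → Regular π d
      regular-modulo-π {d} r {f} (g , eq) = D f , ≈-trans (decomposition f)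
        (≈-trans (+-congʳ (0∣⇒≈0
          (r (∣-0 (≈-trans (ρ-cong eq) (≈-trans (*-congʳ ρπ≈0) (zeroˡ _)))))))
          (+-identityˡ _))

  x-regular : ∀ i → Regular 0# (var i)
  x-regular i = regular-resp (lemma (var i)) (Division.π-regular i 0# ≈-refl ≈-refl)
    where
    lemma : ∀ x → x - 0# ≈ x
    lemma = solve 1 (λ x → x :- :0 := x) ≈-refl

  T-regular : ∀ i → Regular 0# (var i ^ 2)
  T-regular i = regular-* (x-regular i) (regular-* (x-regular i) regular-1)

  module _ {i j : Fin ℓ} (i≢j : i ≢ j) where
    private
      module Minus = Division i (var j)
      module Plus = Division i (- var j)

    minus-regular : Regular 0# Minus.π
    minus-regular = Minus.π-regular (Minus.ρ-other (i≢j ∘ ≡.sym)) (Minus.D-other (i≢j ∘ ≡.sym))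

    plus-regular : Regular 0# Plus.π
    plus-regular = Plus.π-regular (-‿cong (Plus.ρ-other (i≢j ∘ ≡.sym)))
      (≈-trans (-‿cong (Plus.D-other (i≢j ∘ ≡.sym))) (solve 1 (λ x → :- :0 := :0) ≈-refl 0#))

    π*π≈factor : Minus.π * Plus.π ≈ factor ℓ i j
    π*π≈factor = lemma (var i) (var j)
      where
      lemma : ∀ x y → (x - y) * (x - (- y)) ≈ x * (x * 1#) - y * (y * 1#)
      lemma = solve 2 (λ x y → (x :- y) :* (x :- (:- y)) := x :* (x :* :1) :- y :* (y :* :1)) ≈-refl

    factor-regular : Regular 0# (factor ℓ i j)
    factor-regular = regular-resp π*π≈factor (regular-* minus-regular plus-regular)

    -- The modulus is (xᵢ - xⱼ) (xᵢ + xⱼ), and regularity modulo each factor is tested by the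
    -- substitution that kills it.
    regular-modulo-factor : ∀ {d} → Regular 0# (Minus.ρ d) → Regular 0# (Plus.ρ d) →
      Regular (factor ℓ i j) d
    regular-modulo-factor r s = regular-respˡ π*π≈factor (regular-modulus-*
      (Minus.regular-modulo-π (Minus.ρ-other (i≢j ∘ ≡.sym)) (Minus.D-other (i≢j ∘ ≡.sym)) r)
      (Plus.regular-modulo-π (-‿cong (Plus.ρ-other (i≢j ∘ ≡.sym)))
        (≈-trans (-‿cong (Plus.D-other (i≢j ∘ ≡.sym))) (solve 1 (λ x → :- :0 := :0) ≈-refl 0#)) s)
      plus-regular)

  ^2-cong : ∀ {a b} → a ≈ b → a ^ 2 ≈ b ^ 2
  ^2-cong eq = *-cong eq (*-congʳ eq)

  module _ (i : Fin ℓ) where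
    private module Zero = Division i 0#

    zero-modulus : Zero.π ≈ var i
    zero-modulus = lemma (var i)
      where
      lemma : ∀ x → x - 0# ≈ x
      lemma = solve 1 (λ x → x :- :0 := x) ≈-refl

    regular-modulo-x : ∀ {d} → Regular 0# (Zero.ρ d) → Regular (var i) d
    regular-modulo-x r = regular-respˡ zero-modulus (Zero.regular-modulo-π ≈-refl ≈-refl r)

    x-modulo-x : ∀ {j} → i ≢ j → Regular (var i) (var j)
    x-modulo-x {j} i≢j = regular-modulo-x (regular-resp (≈-sym (Zero.ρ-other (i≢j ∘ ≡.sym)))
      (x-regular j))

    factor-modulo-x : ∀ {j k} → j ≢ k → Regular (var i) (factor ℓ j k)
    factor-modulo-x {j} {k} j≢k = regular-modulo-x (at (j Fin.≟ i) (k Fin.≟ i))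
      where
      at : Dec (j ≡ i) → Dec (k ≡ i) → Regular 0# (Zero.ρ (factor ℓ j k))
      at (yes ≡.refl) (yes ≡.refl) = ⊥-elim (j≢k ≡.refl)
      at (yes ≡.refl) (no k≢i) = regular-resp
        (≈-trans (lemma (var k))
          (≈-sym (+-cong (^2-cong Zero.ρ-same) (-‿cong (^2-cong (Zero.ρ-other k≢i))))))
        (regular-neg (T-regular k))
        where
        lemma : ∀ y → - (y * (y * 1#)) ≈ 0# * (0# * 1#) - y * (y * 1#)
        lemma = solve 1 (λ y → :- (y :* (y :* :1)) := :0 :* (:0 :* :1) :- y :* (y :* :1)) ≈-refl
      at (no j≢i) (yes ≡.refl) = regular-resp
        (≈-trans (lemma (var j))
          (≈-sym (+-cong (^2-cong (Zero.ρ-other j≢i)) (-‿cong (^2-cong Zero.ρ-same)))))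
        (T-regular j)
        where
        lemma : ∀ y → y * (y * 1#) ≈ y * (y * 1#) - 0# * (0# * 1#)
        lemma = solve 1 (λ y → y :* (y :* :1) := y :* (y :* :1) :- :0 :* (:0 :* :1)) ≈-refl
      at (no j≢i) (no k≢i) = regular-resp
        (≈-sym (+-cong (^2-cong (Zero.ρ-other j≢i)) (-‿cong (^2-cong (Zero.ρ-other k≢i)))))
        (factor-regular j≢k)

  module _ {i j : Fin ℓ} (i≢j : i ≢ j) (a : ∣S∣ ℓ) (a-regular : Regular 0# a) (a²≈ : a ^ 2 ≈ var j ^ 2) where
    private module Sign = Division i a

    ρx-regular : ∀ k → Regular 0# (Sign.ρ (var k))
    ρx-regular k with k Fin.≟ i
    ... | yes ≡.refl = regular-resp (≈-sym Sign.ρ-same) a-regular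
    ... | no k≢i     = regular-resp (≈-sym (Sign.ρ-other k≢i)) (x-regular k)

    -- Since a ² = xⱼ ², the substitution replaces Tᵢ by Tⱼ for both signs of a at once. A
    -- difference of two T stays a difference of distinct ones unless its indices are i and j.
    ρfactor-regular : ∀ {k l} → k ≢ l → ¬ (k ≡ i × l ≡ j) → ¬ (k ≡ j × l ≡ i) →
                      Regular 0# (Sign.ρ (factor ℓ k l))
    ρfactor-regular {k} {l} k≢l h₁ h₂ = at (k Fin.≟ i) (l Fin.≟ i)
      where
      at : Dec (k ≡ i) → Dec (l ≡ i) → Regular 0# (Sign.ρ (factor ℓ k l))
      at (yes ≡.refl) (yes ≡.refl) = ⊥-elim (k≢l ≡.refl)
      at (yes ≡.refl) (no l≢i) = regular-resp
        (≈-sym (+-cong (≈-trans (^2-cong Sign.ρ-same) a²≈) (-‿cong (^2-cong (Sign.ρ-other l≢i)))))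
        (factor-regular {j} {l} (λ j≡l → h₁ (≡.refl , ≡.sym j≡l)))
      at (no k≢i) (yes ≡.refl) = regular-resp
        (≈-sym (+-cong (^2-cong (Sign.ρ-other k≢i)) (-‿cong (≈-trans (^2-cong Sign.ρ-same) a²≈))))
        (factor-regular {k} {j} (λ k≡j → h₂ (k≡j , ≡.refl)))
      at (no k≢i) (no l≢i) = regular-resp
        (≈-sym (+-cong (^2-cong (Sign.ρ-other k≢i)) (-‿cong (^2-cong (Sign.ρ-other l≢i)))))
        (factor-regular k≢l)

  private
    neg² : ∀ x → (- x) * ((- x) * 1#) ≈ x * (x * 1#)
    neg² = solve 1 (λ x → (:- x) :* ((:- x) :* :1) := x :* (x :* :1)) ≈-refl

  con½+con½ : con (fromℚ ℚ.½) + con (fromℚ ℚ.½) ≈ 1#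
  -- The constant sequences ½ + ½ and 1 agree by computation, so reflexivity at 1 proves them equal.
  con½+con½ = ≈-sym (≋-trans (con-cong (cauchy (fromℚ 1ℚ))) (con-+ (fromℚ ℚ.½) (fromℚ ℚ.½)))

  coordinates : GenericPoints (S ℓ) ℓ
  coordinates = record
    { x = var
    ; ½ = con (fromℚ ℚ.½)
    ; ½+½ = con½+con½
    ; x-regular = λ i → x-regular i
    ; q-regular = λ i≢j → factor-regular i≢j
    ; x-x = λ {i} i≢j → x-modulo-x i i≢j
    ; x-q = λ k i≢j → factor-modulo-x k i≢j
    ; q-x = λ {i} {j} k i≢j → regular-modulo-factor i≢j
        (ρx-regular i≢j (var j) (x-regular j) ≈-refl k)
        (ρx-regular i≢j (- var j) (regular-neg (x-regular j)) (neg² (var j)) k)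
    ; q-q = λ {i} {j} i≢j k≢l h₁ h₂ → regular-modulo-factor i≢j
        (ρfactor-regular i≢j (var j) (x-regular j) ≈-refl k≢l h₁ h₂)
        (ρfactor-regular i≢j (- var j) (regular-neg (x-regular j)) (neg² (var j)) k≢l h₁ h₂)
    }

-- Second-order operators

module ListSums (R : CRing) where
  open Ring R
  open Solver R

  Σ-cong : ∀ {A : Set} {f g : A → Carrier} (xs : List A) → (∀ a → f a ≈ g a) →
           Σ[ map f xs ] ≈ Σ[ map g xs ]
  Σ-cong []       eq = ≈-refl
  Σ-cong (a ∷ xs) eq = +-cong (eq a) (Σ-cong xs eq)

  Σ-+ : ∀ {A : Set} (f g : A → Carrier) xs →
        Σ[ map (λ a → f a + g a) xs ] ≈ Σ[ map f xs ] + Σ[ map g xs ]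
  Σ-+ f g []       = ≈-sym (+-identityʳ 0#)
  Σ-+ f g (a ∷ xs) = ≈-trans (+-congˡ (Σ-+ f g xs)) (lemma (f a) (g a) _ _)
    where
    lemma : ∀ a b c d → (a + b) + (c + d) ≈ (a + c) + (b + d)
    lemma = solve 4 (λ a b c d → (a :+ b) :+ (c :+ d) := (a :+ c) :+ (b :+ d)) ≈-refl

  Σ-*ˡ : ∀ {A : Set} c (f : A → Carrier) xs → Σ[ map (λ a → c * f a) xs ] ≈ c * Σ[ map f xs ]
  Σ-*ˡ c f []       = ≈-sym (zeroʳ c)
  Σ-*ˡ c f (a ∷ xs) = ≈-trans (+-congˡ (Σ-*ˡ c f xs)) (≈-sym (distribˡ c _ _))

  Σ-*ʳ : ∀ {A : Set} c (f : A → Carrier) xs → Σ[ map (λ a → f a * c) xs ] ≈ Σ[ map f xs ] * c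
  Σ-*ʳ c f []       = ≈-sym (zeroˡ c)
  Σ-*ʳ c f (a ∷ xs) = ≈-trans (+-congˡ (Σ-*ʳ c f xs)) (≈-sym (distribʳ c _ _))

  Σ-zero : ∀ {A : Set} {f : A → Carrier} {xs} → All (λ a → f a ≈ 0#) xs → Σ[ map f xs ] ≈ 0#
  Σ-zero []       = ≈-refl
  Σ-zero (z ∷ zs) = ≈-trans (+-cong z (Σ-zero zs)) (+-identityʳ 0#)

  Σ-single : ∀ {A : Set} {f : A → Carrier} {a xs} → Unique xs → a ∈ xs →
             (∀ b → b ≢ a → f b ≈ 0#) → Σ[ map f xs ] ≈ f a
  Σ-single (u ∷ us) (here ≡.refl) h =
    ≈-trans (+-congˡ (Σ-zero (All.map (λ a≢b → h _ (a≢b ∘ ≡.sym)) u))) (+-identityʳ _)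
  Σ-single (u ∷ us) (there i)     h =
    ≈-trans (+-cong (h _ (All.lookup u i)) (Σ-single us i h)) (+-identityˡ _)

-- Multi-indices of degree two as unordered pairs

0∷-injective : ∀ {ℓ d} {α β : MultiIndex ℓ d} → (0∷ α) ≡ (0∷ β) → α ≡ β
0∷-injective ≡.refl = ≡.refl

1+-injective : ∀ {ℓ d} {α β : MultiIndex (suc ℓ) d} → (1+ α) ≡ (1+ β) → α ≡ β
1+-injective ≡.refl = ≡.refl

_≟ᵐ_ : ∀ {ℓ d} (α β : MultiIndex ℓ d) → Dec (α ≡ β)
[]     ≟ᵐ []     = yes ≡.refl
(0∷ α) ≟ᵐ (0∷ β) = map′ (≡.cong 0∷_) 0∷-injective (α ≟ᵐ β)
(0∷ α) ≟ᵐ (1+ β) = no λ ()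
(1+ α) ≟ᵐ (0∷ β) = no λ ()
(1+ α) ≟ᵐ (1+ β) = map′ (≡.cong 1+_) 1+-injective (α ≟ᵐ β)

multiIndices-complete : ∀ {ℓ d} (α : MultiIndex ℓ d) → α ∈ multiIndices ℓ d
multiIndices-complete []               = here ≡.refl
multiIndices-complete {d = zero}  (0∷ α) = ∈-map⁺ 0∷_ (multiIndices-complete α)
multiIndices-complete {d = suc d} (0∷ α) = ∈-++⁺ˡ (∈-map⁺ 0∷_ (multiIndices-complete α))
multiIndices-complete {suc ℓ} {suc d} (1+ α) =
  ∈-++⁺ʳ (map 0∷_ (multiIndices ℓ (suc d))) (∈-map⁺ 1+_ (multiIndices-complete α))

multiIndices-unique : ∀ ℓ d → Unique (multiIndices ℓ d)
multiIndices-unique zero    zero    = [] ∷ []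
multiIndices-unique zero    (suc d) = []
multiIndices-unique (suc ℓ) zero    = Unique.map⁺ 0∷-injective (multiIndices-unique ℓ zero)
multiIndices-unique (suc ℓ) (suc d) = Unique.++⁺
  (Unique.map⁺ 0∷-injective (multiIndices-unique ℓ (suc d)))
  (Unique.map⁺ 1+-injective (multiIndices-unique (suc ℓ) d))
  λ (p , q) → disjoint (∈-map⁻ 0∷_ p) (∈-map⁻ 1+_ q)
  where
  disjoint : ∀ {γ : MultiIndex (suc ℓ) (suc d)} →
             (∃ λ α → α ∈ multiIndices ℓ (suc d) × γ ≡ (0∷ α)) →
             (∃ λ β → β ∈ multiIndices (suc ℓ) d × γ ≡ (1+ β)) → ⊥
  disjoint (_ , _ , ≡.refl) (_ , _ , ())

first second : ∀ {ℓ} → MultiIndex ℓ 2 → Fin ℓ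
first  α = Vec.lookup (indices α) zero
second α = Vec.lookup (indices α) (suc zero)

lookup-suc : ∀ {ℓ d} (v : Vec (Fin ℓ) d) i → Vec.lookup (Vec.map Fin.suc v) i ≡ Fin.suc
  (Vec.lookup v i)
lookup-suc v i = Vec.lookup-map i Fin.suc v

first≤second : ∀ {ℓ} (α : MultiIndex ℓ 2) → first α Fin.≤ second α
first≤second (0∷ α) rewrite lookup-suc (indices α) zero | lookup-suc (indices α) (suc zero) =
  s≤s (first≤second α)
first≤second (1+ α) = z≤n

lookup-injective : ∀ {ℓ d} (α β : MultiIndex ℓ d) →
                   (∀ i → Vec.lookup (indices α) i ≡ Vec.lookup (indices β) i) → α ≡ β
lookup-injective []     []     h = ≡.refl
lookup-injective (0∷ α) (0∷ β) h = ≡.cong 0∷_ (lookup-injective α β λ i → Fin.suc-injective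
  (≡.trans (≡.sym (lookup-suc (indices α) i)) (≡.trans (h i) (lookup-suc (indices β) i))))
lookup-injective (0∷ α) (1+ β) h =
  ⊥-elim (Fin.0≢1+n (≡.trans (≡.sym (h zero)) (lookup-suc (indices α) zero)))
lookup-injective (1+ α) (0∷ β) h =
  ⊥-elim (Fin.0≢1+n (≡.trans (h zero) (lookup-suc (indices β) zero)))
lookup-injective (1+ α) (1+ β) h = ≡.cong 1+_ (lookup-injective α β (h ∘ suc))

pair-injective : ∀ {ℓ} {α β : MultiIndex ℓ 2} → first α ≡ first β → second α ≡ second β → α ≡ β
pair-injective {α = α} {β} p q = lookup-injective α β λ { zero → p ; (suc zero) → q }

zeros : ∀ {ℓ} → MultiIndex ℓ 0
zeros {zero}  = []
zeros {suc ℓ} = 0∷ zeros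

single : ∀ {ℓ} → Fin ℓ → MultiIndex ℓ 1
single zero    = 1+ zeros
single (suc i) = 0∷ single i

single-lookup : ∀ {ℓ} (i : Fin ℓ) → Vec.lookup (indices (single i)) zero ≡ i
single-lookup zero    = ≡.refl
single-lookup (suc i) = ≡.trans (lookup-suc (indices (single i)) zero)
  (≡.cong suc (single-lookup i))

-- The indices of a multi-index are listed in increasing order, so for i ≠ j only one of the two
-- orders is attained.
pair-surjective : ∀ {ℓ} (i j : Fin ℓ) → ∃ λ α →
                  (first α ≡ i × second α ≡ j) ⊎ (first α ≡ j × second α ≡ i)
pair-surjective zero    j       = 1+ single j , inj₁ (≡.refl , single-lookup j)
pair-surjective (suc i) zero    = 1+ single (suc i) , inj₂ (≡.refl , single-lookup (suc i))
pair-surjective (suc i) (suc j) with pair-surjective i j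
... | α , inj₁ (p , q) = 0∷ α , inj₁ (≡.trans (lookup-suc (indices α) zero) (≡.cong suc p) ,
                                      ≡.trans (lookup-suc (indices α) (suc zero)) (≡.cong suc q))
... | α , inj₂ (p , q) = 0∷ α , inj₂ (≡.trans (lookup-suc (indices α) zero) (≡.cong suc p) ,
                                      ≡.trans (lookup-suc (indices α) (suc zero)) (≡.cong suc q))

module Derivations (ℓ : ℕ) where
  open Ring (S ℓ)
  open Solver (S ℓ)

  identity-endomorphism : IsEndomorphism {ℓ} (λ p → p)
  identity-endomorphism = record
    { cong = λ p → p ; homo-con = λ _ → ≈-refl ; homo-⊕ = λ _ _ → ≈-refl
    ; homo-⊗ = λ _ _ → ≈-refl ; homo-⊝ = λ _ → ≈-refl }

  module Derivation (v : Fin ℓ → ∣S∣ ℓ) =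
    TwistedDerivation identity-endomorphism 0# v
      (λ j → ≈-sym (≈-trans (+-congˡ (zeroˡ (v j))) (+-identityʳ _)))

  ∂≡D : ∀ i p → ∂ i p ≡ Derivation.D (λ j → ∂ i (var j)) p
  ∂≡D i (con a) = ≡.refl
  ∂≡D i (var j) = ≡.refl
  ∂≡D i (p ⊕ q) = ≡.cong₂ _⊕_ (∂≡D i p) (∂≡D i q)
  ∂≡D i (p ⊗ q) = ≡.cong₂ (λ p′ q′ → p′ ⊗ q ⊕ p ⊗ q′) (∂≡D i p) (∂≡D i q)
  ∂≡D i (⊝ p)   = ≡.cong ⊝_ (∂≡D i p)

  ∂-cong : ∀ i {p q} → p ≈ q → ∂ i p ≈ ∂ i q
  ∂-cong i {p} {q} eq rewrite ∂≡D i p | ∂≡D i q = Derivation.D-cong (λ j → ∂ i (var j)) eq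

module SecondOrder (ℓ : ℕ) (θ : Operator ℓ 2 (∣S∣ ℓ)) where
  open Ring (S ℓ)
  open Solver (S ℓ)
  open Alternants (S ℓ) using (δ; δ-≡; δ-≢; δδ-≢)
  open Divisibility (S ℓ)
  open ListSums (S ℓ)
  open Derivations ℓ
  open SetoidReasoning setoid

  Θ : ∣S∣ ℓ → ∣S∣ ℓ
  Θ f = θ • f

  ∂^≡ : ∀ (α : MultiIndex ℓ 2) f → ∂^ α f ≡ ∂ (first α) (∂ (second α) f)
  ∂^≡ α f = go (indices α)
    where
    go : ∀ v → Vec.foldr _ ∂ f v ≡ ∂ (Vec.lookup v zero) (∂ (Vec.lookup v (suc zero)) f)
    go (a ∷ b ∷ []) = ≡.refl

  -- ∂ₐ∂ᵦ(pq) = ∂ₐ∂ᵦ(p) q + bracket α p q + p ∂ₐ∂ᵦ(q), where α = (a , b).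
  bracket : MultiIndex ℓ 2 → ∣S∣ ℓ → ∣S∣ ℓ → ∣S∣ ℓ
  bracket α p q = ∂ (first α) p * ∂ (second α) q + ∂ (second α) p * ∂ (first α) q

  -- The symmetric biderivation given by the symbol of θ: it measures how far θ is from being a
  -- derivation and carries the first-order part of the problem.
  B : ∣S∣ ℓ → ∣S∣ ℓ → ∣S∣ ℓ
  B p q = Σ[ map (λ α → θ α * bracket α p q) (multiIndices ℓ 2) ]

  Θ-cong : ∀ {p q} → p ≈ q → Θ p ≈ Θ q
  Θ-cong {p} {q} eq = Σ-cong (multiIndices ℓ 2) λ α → *-congˡ (at α)
    where
    at : ∀ α → ∂^ α p ≈ ∂^ α q
    at α rewrite ∂^≡ α p | ∂^≡ α q = ∂-cong (first α) (∂-cong (second α) eq)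

  Θ-* : ∀ p q → Θ (p * q) ≈ Θ p * q + B p q + p * Θ q
  Θ-* p q = begin
    Θ (p * q)
      ≈⟨ Σ-cong (multiIndices ℓ 2) at ⟩
    Σ[ map (λ α → (θ α * ∂^ α p * q + θ α * bracket α p q) + p * (θ α * ∂^ α q)) (multiIndices ℓ 2)
      ]
      ≈⟨ Σ-+ _ _ (multiIndices ℓ 2) ⟩
    Σ[ map (λ α → θ α * ∂^ α p * q + θ α * bracket α p q) (multiIndices ℓ 2) ]
      + Σ[ map (λ α → p * (θ α * ∂^ α q)) (multiIndices ℓ 2) ]
      ≈⟨ +-cong (≈-trans (Σ-+ _ _ (multiIndices ℓ 2)) (+-congʳ (Σ-*ʳ q _ (multiIndices ℓ 2))))
                (Σ-*ˡ p _ (multiIndices ℓ 2)) ⟩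
    Θ p * q + B p q + p * Θ q ∎
    where
    lemma : ∀ θ p q pa pb pab qa qb qab →
      θ * ((pab * q + pb * qa) + (pa * qb + p * qab)) ≈
      (θ * pab * q + θ * (pa * qb + pb * qa)) + p * (θ * qab)
    lemma = solve 9 (λ θ p q pa pb pab qa qb qab →
      θ :* ((pab :* q :+ pb :* qa) :+ (pa :* qb :+ p :* qab)) :=
      (θ :* pab :* q :+ θ :* (pa :* qb :+ pb :* qa)) :+ p :* (θ :* qab)) ≈-refl
    at : ∀ α → θ α * ∂^ α (p * q) ≈ (θ α * ∂^ α p * q + θ α * bracket α p q) + p * (θ α * ∂^ α q)
    at α rewrite ∂^≡ α p | ∂^≡ α q | ∂^≡ α (p * q) =
      lemma (θ α) p q (∂ (first α) p) (∂ (second α) p) (∂ (first α) (∂ (second α) p))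
            (∂ (first α) q) (∂ (second α) q) (∂ (first α) (∂ (second α) q))

  Θ-zero : ∀ {p} → (∀ i → ∂ i p ≈ 0# ⊎ ∂ i p ≈ 1#) → Θ p ≈ 0#
  Θ-zero {p} h = Σ-zero (All.universal at (multiIndices ℓ 2))
    where
    constant : ∀ i {c} → c ≈ 0# ⊎ c ≈ 1# → ∂ i c ≈ 0#
    constant i (inj₁ eq) = ∂-cong i eq
    constant i (inj₂ eq) = ∂-cong i eq
    at : ∀ α → θ α * ∂^ α p ≈ 0#
    at α rewrite ∂^≡ α p = ≈-trans (*-congˡ (constant (first α) (h (second α)))) (zeroʳ _)

  Θ-1 : Θ 1# ≈ 0#
  Θ-1 = Θ-zero {1#} (λ _ → inj₁ ≈-refl)

  Θ-var : ∀ j → Θ (var j) ≈ 0#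
  Θ-var j = Θ-zero {var j} at
    where
    at : ∀ i → ∂ i (var j) ≈ 0# ⊎ ∂ i (var j) ≈ 1#
    at i with does (i Fin.≟ j)
    ... | true  = inj₂ ≈-refl
    ... | false = inj₁ ≈-refl

  Θ-+ : ∀ p q → Θ (p + q) ≈ Θ p + Θ q
  Θ-+ p q = ≈-trans (Σ-cong (multiIndices ℓ 2) at) (Σ-+ _ _ (multiIndices ℓ 2))
    where
    at : ∀ α → θ α * ∂^ α (p + q) ≈ θ α * ∂^ α p + θ α * ∂^ α q
    at α rewrite ∂^≡ α p | ∂^≡ α q | ∂^≡ α (p + q) = distribˡ _ _ _

  Θ-neg : ∀ p → Θ (- p) ≈ - Θ p
  Θ-neg p = ≈-trans (Σ-cong (multiIndices ℓ 2) at)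
    (≈-trans (Σ-*ˡ (- 1#) (λ α → θ α * ∂^ α p) (multiIndices ℓ 2)) (lemma (Θ p)))
    where
    lemma : ∀ a → - 1# * a ≈ - a
    lemma = solve 1 (λ a → :- :1 :* a := :- a) ≈-refl
    lemma′ : ∀ a b → a * (- b) ≈ - 1# * (a * b)
    lemma′ = solve 2 (λ a b → a :* (:- b) := :- :1 :* (a :* b)) ≈-refl
    at : ∀ α → θ α * ∂^ α (- p) ≈ - 1# * (θ α * ∂^ α p)
    at α rewrite ∂^≡ α p | ∂^≡ α (- p) = lemma′ (θ α) _

  B-sym : ∀ p q → B p q ≈ B q p
  B-sym p q = Σ-cong (multiIndices ℓ 2) λ α → *-congˡ
    (≈-trans (+-comm _ _) (+-cong (*-comm _ _) (*-comm _ _)))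

  B-congʳ : ∀ {p q r} → q ≈ r → B p q ≈ B p r
  B-congʳ eq = Σ-cong (multiIndices ℓ 2) λ α → *-congˡ
    (+-cong (*-congˡ (∂-cong (second α) eq)) (*-congˡ (∂-cong (first α) eq)))

  B-congˡ : ∀ {p q r} → p ≈ q → B p r ≈ B q r
  B-congˡ {p} {q} {r} eq = ≈-trans (B-sym p r) (≈-trans (B-congʳ {r} eq) (B-sym r q))

  B-conʳ : ∀ p a → B p (con a) ≈ 0#
  B-conʳ p a = Σ-zero (All.universal (λ α → ≈-trans
    (*-congˡ (≈-trans (+-cong (zeroʳ _) (zeroʳ _)) (+-identityʳ 0#))) (zeroʳ (θ α)))
      (multiIndices ℓ 2))

  B-+ʳ : ∀ p q r → B p (q + r) ≈ B p q + B p r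
  B-+ʳ p q r = ≈-trans (Σ-cong (multiIndices ℓ 2) λ α → lemma (θ α) _ _ _ _ _ _)
    (Σ-+ _ _ (multiIndices ℓ 2))
    where
    lemma : ∀ θ pa pb qa qb ra rb → θ * (pa * (qb + rb) + pb * (qa + ra)) ≈
            θ * (pa * qb + pb * qa) + θ * (pa * rb + pb * ra)
    lemma = solve 7 (λ θ pa pb qa qb ra rb → θ :* (pa :* (qb :+ rb) :+ pb :* (qa :+ ra)) :=
            θ :* (pa :* qb :+ pb :* qa) :+ θ :* (pa :* rb :+ pb :* ra)) ≈-refl

  B-negʳ : ∀ p q → B p (- q) ≈ - B p q
  B-negʳ p q = ≈-trans (Σ-cong (multiIndices ℓ 2) λ α → lemma (θ α) _ _ _ _)
    (≈-trans (Σ-*ˡ (- 1#) _ (multiIndices ℓ 2)) (lemma′ (B p q)))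
    where
    lemma : ∀ θ pa pb qa qb → θ * (pa * (- qb) + pb * (- qa)) ≈ - 1# * (θ * (pa * qb + pb * qa))
    lemma = solve 5 (λ θ pa pb qa qb → θ :* (pa :* (:- qb) :+ pb :* (:- qa)) :=
            :- :1 :* (θ :* (pa :* qb :+ pb :* qa))) ≈-refl
    lemma′ : ∀ a → - 1# * a ≈ - a
    lemma′ = solve 1 (λ a → :- :1 :* a := :- a) ≈-refl

  B-*ʳ : ∀ p q r → B p (q * r) ≈ B p q * r + q * B p r
  B-*ʳ p q r = ≈-trans (Σ-cong (multiIndices ℓ 2) λ α → lemma (θ α) _ _ q r _ _ _ _)
    (≈-trans (Σ-+ _ _ (multiIndices ℓ 2))
      (+-cong (Σ-*ʳ r _ (multiIndices ℓ 2)) (Σ-*ˡ q _ (multiIndices ℓ 2))))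
    where
    lemma : ∀ θ pa pb q r qa qb ra rb → θ * (pa * (qb * r + q * rb) + pb * (qa * r + q * ra)) ≈
            θ * (pa * qb + pb * qa) * r + q * (θ * (pa * rb + pb * ra))
    lemma = solve 9 (λ θ pa pb q r qa qb ra rb → θ :* (pa :* (qb :* r :+ q :* rb) :+ pb :*
      (qa :* r :+ q :* ra)) :=
            θ :* (pa :* qb :+ pb :* qa) :* r :+ q :* (θ :* (pa :* rb :+ pb :* ra))) ≈-refl

  B-*ˡ : ∀ p q r → B (p * q) r ≈ B p r * q + p * B q r
  B-*ˡ p q r = ≈-trans (B-sym (p * q) r) (≈-trans (B-*ʳ r p q)
    (+-cong (*-congʳ (B-sym r p)) (*-congˡ (B-sym r q))))

  G : Fin ℓ → Fin ℓ → ∣S∣ ℓ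
  G i j = B (var i) (var j)

  -- In its second argument `B` is a derivation over the constants, so the variables decide.
  B-divisible : ∀ {q} → (∀ j → q ∣ B q (var j)) → ∀ f → q ∣ B q f
  B-divisible {q} h (con a) = ∣-0 (B-conʳ q a)
  B-divisible {q} h (var j) = h j
  B-divisible {q} h (f ⊕ g) = ∣-resp (≈-sym (B-+ʳ q f g)) (∣-+ (B-divisible h f) (B-divisible h g))
  B-divisible {q} h (f ⊗ g) = ∣-resp (≈-sym (B-*ʳ q f g))
    (∣-+ (∣-*ʳ g (B-divisible h f)) (∣-*ˡ f (B-divisible h g)))
  B-divisible {q} h (⊝ f)   = ∣-resp (≈-sym (B-negʳ q f)) (∣-neg (B-divisible h f))

-- The criterion for D²(𝒟)

-- 1/α! is a constant sequence; its entry at 0 gives access to the rational number.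
rational : ∀ {ℓ d} → MultiIndex ℓ d → ℚ.ℚ
rational α = seq (reciprocalFactorial α) 0

rational-0∷ : ∀ {ℓ d} (α : MultiIndex ℓ d) → rational (0∷ α) ≡ rational α
rational-0∷ α = ℚ.*-identityˡ (rational α)

rational-degree-0 : ∀ {ℓ} (α : MultiIndex ℓ 0) → rational α ≡ 1ℚ
rational-degree-0 []     = ≡.refl
rational-degree-0 (0∷ α) = ≡.trans (rational-0∷ α) (rational-degree-0 α)

rational-degree-1 : ∀ {ℓ} (α : MultiIndex ℓ 1) → rational α ≡ 1ℚ
rational-degree-1 (0∷ α)      = ≡.trans (rational-0∷ α) (rational-degree-1 α)
rational-degree-1 (1+ (0∷ α)) = ≡.trans (ℚ.*-identityˡ (rational α)) (rational-degree-0 α)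

rational-equal : ∀ {ℓ} (α : MultiIndex ℓ 2) → first α ≡ second α → rational α ≡ ℚ.½
rational-equal (0∷ α) eq = ≡.trans (rational-0∷ α) (rational-equal α (Fin.suc-injective
  (≡.trans (≡.sym (lookup-suc (indices α) zero)) (≡.trans eq (lookup-suc (indices α) (suc zero))))))
rational-equal (1+ (1+ (0∷ α))) eq = ≡.trans (≡.cong (ℚ.½ ℚ.*_) (rational-degree-0 α)) ≡.refl
rational-equal (1+ (0∷ α)) eq = ⊥-elim (Fin.0≢1+n (≡.trans eq (lookup-suc (indices α) zero)))

rational-distinct : ∀ {ℓ} (α : MultiIndex ℓ 2) → first α ≢ second α → rational α ≡ 1ℚ
rational-distinct (0∷ α) neq = ≡.trans (rational-0∷ α) (rational-distinct α (λ eq → neq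
  (≡.trans (lookup-suc (indices α) zero)
    (≡.trans (≡.cong suc eq) (≡.sym (lookup-suc (indices α) (suc zero)))))))
rational-distinct (1+ (1+ (0∷ α))) neq = ⊥-elim (neq ≡.refl)
rational-distinct (1+ (0∷ α)) neq = ≡.trans (ℚ.*-identityˡ (rational α)) (rational-degree-1 α)

module Criterion (ℓ : ℕ) where
  open Ring (S ℓ)
  open Solver (S ℓ)
  open Alternants (S ℓ) using (δ; δ-≡; δ-≢; δδ-≢)
  open Divisibility (S ℓ)
  open ListSums (S ℓ)
  open GenericPoints (coordinates {ℓ}) using (x-x; x-q; q-x; q-q; q-regular)
  open SetoidReasoning setoid

  -- This is α!, written in the form which `bracket α` takes on the two variables of α.
  κ : MultiIndex ℓ 2 → ∣S∣ ℓ
  κ α = 1# + δ (second α) (first α) * δ (first α) (second α)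

  κ-inverse : ∀ α → con (reciprocalFactorial α) * κ α ≈ 1#
  κ-inverse α with first α Fin.≟ second α
  ... | yes eq = ≈-trans (*-cong (≈-trans (rewriteℚ (rational-equal α eq)) ≈-refl)
      (+-congˡ (≈-trans (*-congʳ (δ-≡ (≡.sym eq))) (*-identityˡ 1#))))
    (≈-trans (lemma (con (fromℚ ℚ.½))) con½+con½)
    where
    rewriteℚ : ∀ {p q} → p ≡ q → con (fromℚ p) ≈ con (fromℚ q)
    rewriteℚ ≡.refl = ≈-refl
    lemma : ∀ h → h * (1# + 1#) ≈ h + h
    lemma = solve 1 (λ h → h :* (:1 :+ :1) := h :+ h) ≈-refl
  ... | no neq = ≈-trans (*-cong (rewriteℚ (rational-distinct α neq)) (+-congˡ (zeroʳ _)))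
      (lemma 1#)
    where
    rewriteℚ : ∀ {p q} → p ≡ q → con (fromℚ p) ≈ con (fromℚ q)
    rewriteℚ ≡.refl = ≈-refl
    lemma : ∀ x → 1# * (1# + 0#) ≈ 1#
    lemma = solve 1 (λ x → :1 :* (:1 :+ :0) := :1) ≈-refl

  module _ (θ : Operator ℓ 2 (∣S∣ ℓ)) where
    open SecondOrder ℓ θ

    G-entry : ∀ α → G (first α) (second α) ≈ θ α * κ α
    G-entry α = ≈-trans (Σ-single (multiIndices-unique ℓ 2) (multiIndices-complete α) vanish)
      (*-congˡ (+-congʳ (≈-trans (*-cong (δ-≡ {i = first α} ≡.refl) (δ-≡ {i = second α} ≡.refl))
        (*-identityˡ 1#))))
      where
      vanish : ∀ β → β ≢ α → θ β * bracket β (var (first α)) (var (second α)) ≈ 0#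
      vanish β β≢α = ≈-trans (*-congˡ (≈-trans (+-cong
        (δδ-≢ {i = first β} {first α} {second β} {second α} (λ (p , q) → β≢α (pair-injective p q)))
        (δδ-≢ {i = second β} {first α} {first β} {second α} swapped))
        (+-identityʳ 0#))) (zeroʳ (θ β))
        where
        swapped : ¬ (second β ≡ first α × first β ≡ second α)
        swapped (p , q) = β≢α (pair-injective (≡.trans q (≡.sym same)) (≡.trans p same))
          where
          same : first α ≡ second α
          same = Fin.≤-antisym (first≤second α) (≡.subst₂ Fin._≤_ q p (first≤second β))

    -- G is the symmetric matrix with 2θ = Σ Gᵢⱼ ∂ᵢ∂ⱼ.
    u : Fin ℓ → Fin ℓ → ∣S∣ ℓ
    u i j = var i * (var j * G i j)

    u-symmetric : ∀ i j → u i j ≈ u j i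
    u-symmetric i j = ≈-trans (*-congˡ (*-congˡ (B-sym (var i) (var j))))
      (*-swapˡ (var i) (var j) (G j i))

    Admissible : Set
    Admissible = ∀ i j k → factor ℓ i j ∣ u i k - u j k

    B-square : ∀ i f → B (var i ^ 2) f ≈ (var i * B (var i) f) + (var i * B (var i) f)
    B-square i f = begin
      B (var i ^ 2) f
        ≈⟨ B-*ˡ (var i) (var i * 1#) f ⟩
      B (var i) f * (var i * 1#) + var i * B (var i * 1#) f
        ≈⟨ +-congˡ (*-congˡ (B-congˡ {r = f} (*-identityʳ (var i)))) ⟩
      B (var i) f * (var i * 1#) + var i * B (var i) f
        ≈⟨ lemma (var i) (B (var i) f) ⟩
      (var i * B (var i) f) + (var i * B (var i) f) ∎
      where
      lemma : ∀ x b → b * (x * 1#) + x * b ≈ x * b + x * b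
      lemma = solve 2 (λ x b → b :* (x :* :1) :+ x :* b := x :* b :+ x :* b) ≈-refl

    -- The bridge between θ and u: B(xᵢ² , xₖ) is 2 xᵢ Gᵢₖ, and multiplication by xₖ makes it 2 uᵢₖ.
    B-factor : ∀ i j k → var k * B (factor ℓ i j) (var k) ≈ (u i k - u j k) + (u i k - u j k)
    B-factor i j k = begin
      var k * B (factor ℓ i j) (var k)
        ≈⟨ *-congˡ (≈-trans (B-sym (factor ℓ i j) (var k))
             (≈-trans (B-+ʳ (var k) (var i ^ 2) (- var j ^ 2))
             (+-cong (B-sym (var k) (var i ^ 2)) (≈-trans (B-negʳ (var k) (var j ^ 2))
               (-‿cong (B-sym (var k) (var j ^ 2))))))) ⟩
      var k * (B (var i ^ 2) (var k) - B (var j ^ 2) (var k))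
        ≈⟨ *-congˡ (+-cong (B-square i (var k)) (-‿cong (B-square j (var k)))) ⟩
      var k * ((var i * G i k + var i * G i k) - (var j * G j k + var j * G j k))
        ≈⟨ lemma (var i) (var j) (var k) (G i k) (G j k) ⟩
      (u i k - u j k) + (u i k - u j k) ∎
      where
      lemma : ∀ x y z g h → z * ((x * g + x * g) - (y * h + y * h)) ≈
              (x * (z * g) - y * (z * h)) + (x * (z * g) - y * (z * h))
      lemma = solve 5 (λ x y z g h → z :* ((x :* g :+ x :* g) :- (y :* h :+ y :* h)) :=
              (x :* (z :* g) :- y :* (z :* h)) :+ (x :* (z :* g) :- y :* (z :* h))) ≈-refl

    ∣-halve : ∀ {m f} → m ∣ f + f → m ∣ f
    ∣-halve {m} {f} p = ∣-resp (≈-trans (lemma (con (fromℚ ℚ.½)) f) (≈-trans (*-congʳ con½+con½)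
      (*-identityˡ f)))
      (∣-*ˡ (con (fromℚ ℚ.½)) p)
      where
      lemma : ∀ h f → h * (f + f) ≈ (h + h) * f
      lemma = solve 2 (λ h f → h :* (f :+ f) := (h :+ h) :* f) ≈-refl

    Θ-square : ∀ i → Θ (var i ^ 2) ≈ G i i
    Θ-square i = begin
      Θ (var i ^ 2)
        ≈⟨ Θ-cong (*-congˡ (*-identityʳ (var i))) ⟩
      Θ (var i * var i)
        ≈⟨ Θ-* (var i) (var i) ⟩
      Θ (var i) * var i + G i i + var i * Θ (var i)
        ≈⟨ +-cong (+-congʳ (*-congʳ (Θ-var i))) (*-congˡ (Θ-var i)) ⟩
      0# * var i + G i i + var i * 0#
        ≈⟨ lemma (var i) (G i i) ⟩
      G i i ∎
      where
      lemma : ∀ x g → 0# * x + g + x * 0# ≈ g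
      lemma = solve 2 (λ x g → :0 :* x :+ g :+ x :* :0 := g) ≈-refl

    Θ-factor : ∀ i j → Θ (factor ℓ i j) ≈ G i i - G j j
    Θ-factor i j = ≈-trans (Θ-+ (var i ^ 2) (- var j ^ 2))
      (+-cong (Θ-square i) (≈-trans (Θ-neg (var j ^ 2)) (-‿cong (Θ-square j))))

    module _ (admissible : Admissible) {i j : Fin ℓ} (i≢j : i ≢ j) where

      -- Admissibility gives the divisibility of xₖ B(Tᵢ - Tⱼ , xₖ); xₖ is regular modulo Tᵢ - Tⱼ.
      factor∣B : ∀ f → factor ℓ i j ∣ B (factor ℓ i j) f
      factor∣B = B-divisible λ k → q-x k i≢j (∣-resp (≈-sym (B-factor i j k))
        (∣-+ (admissible i j k) (admissible i j k)))

      -- θ(Tᵢ - Tⱼ) is Gᵢᵢ - Gⱼⱼ, and Tᵢ Tⱼ times it is Tⱼ uᵢᵢ - Tᵢ uⱼⱼ. Modulo Tᵢ - Tⱼ this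
      -- vanishes because uᵢᵢ, uᵢⱼ and uⱼⱼ are congruent; the squares xᵢ² and xⱼ² are then
      -- cancelled.
      factor∣Θ : factor ℓ i j ∣ Θ (factor ℓ i j)
      factor∣Θ = ∣-resp (≈-sym (Θ-factor i j)) (square j (square i (∣-resp
        (≈-trans (+-congʳ (+-congʳ (*-congˡ (+-congˡ (-‿cong (u-symmetric j i))))))
          (lemma (var i) (var j) (G i i) (G j j) (u i j)))
        (∣-- (∣-+ (∣-*ˡ (var j ^ 2) (admissible i j i)) (∣-*ˡ (var i ^ 2) (admissible i j j)))
             (∣-*ʳ (u i j) ∣-refl)))))
        where
        square : ∀ k {f} → factor ℓ i j ∣ var k ^ 2 * f → factor ℓ i j ∣ f
        square k p = q-x k i≢j (q-x k i≢j (∣-resp (expand (var k) _) p))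
          where
          expand : ∀ x f → (x * (x * 1#)) * f ≈ x * (x * f)
          expand = solve 2 (λ x f → (x :* (x :* :1)) :* f := x :* (x :* f)) ≈-refl
        lemma : ∀ x y g h v →
          (y * (y * 1#)) * (x * (x * g) - v) + (x * (x * 1#)) * (v - y * (y * h))
            - (x * (x * 1#) - y * (y * 1#)) * v
          ≈ (x * (x * 1#)) * ((y * (y * 1#)) * (g - h))
        lemma = solve 5 (λ x y g h v →
          (y :* (y :* :1)) :* (x :* (x :* g) :- v) :+ (x :* (x :* :1)) :* (v :- y :* (y :* h))
            :- (x :* (x :* :1) :- y :* (y :* :1)) :* v
          := (x :* (x :* :1)) :* ((y :* (y :* :1)) :* (g :- h))) ≈-refl

    Preserving : ∣S∣ ℓ → Set
    Preserving q = q ∣ Θ q × ∀ f → q ∣ B q f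

    -- In θ(q P) the cross term B(q , P) is divisible by q and, by symmetry, by P; coprimality of
    -- the two makes it divisible by q P.
    Π-preserving : ∀ {qs} → AllPairs Coprime qs → All Preserving qs → Preserving Π[ qs ]
    Π-preserving []         []             =
      ∣-0 Θ-1 , λ f → ∣-0 (≈-trans (B-sym 1# f) (B-conʳ f (fromℚ 1ℚ)))
    Π-preserving {q ∷ qs} (cs ∷ css) ((p , b) ∷ ps) =
      let P , b′ = Π-preserving css ps in
      ∣-resp (≈-sym (Θ-* q Π[ qs ]))
        (∣-+ (∣-+ (∣-*-cong p ∣-refl)
                  (coprime-∣ (regular-Π (All.map proj₁ cs)) (b Π[ qs ]) (∣-resp (B-sym Π[ qs ] q)
                    (b′ q))))
             (∣-*-cong ∣-refl P)) ,
      λ f → ∣-resp (≈-sym (B-*ˡ q Π[ qs ] f)) (∣-+ (∣-*-cong (b f) ∣-refl) (∣-*-cong ∣-refl (b′ f)))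

    preserving⇒preserves : ∀ {Q} → Preserving Q → Preserves Q θ
    preserving⇒preserves {Q} (p , b) f = ∣-resp (≈-sym (Θ-* Q f)) (∣-+ (∣-+ (∣-*ʳ f p) (b f))
      (∣-*ʳ (Θ f) ∣-refl))

    -- Test the defining property of D² on f = 1 and f = xₖ; the product rule isolates the bracket.
    preserves⇒bracket : ∀ {Q} → Preserves Q θ → ∀ k → Q ∣ B Q (var k)
    preserves⇒bracket {Q} h k = ∣-resp (lemma (Θ Q * var k) (B Q (var k)) (Q * Θ (var k)))
      (∣-- (∣-- (∣-resp (Θ-* Q (var k)) (h (var k))) (∣-*ʳ (var k) Q∣ΘQ)) (∣-*ʳ (Θ (var k)) ∣-refl))
      where
      Q∣ΘQ : Q ∣ Θ Q
      Q∣ΘQ = ∣-resp (Θ-cong (*-identityʳ Q)) (h 1#)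
      lemma : ∀ a b c → a + b + c - a - c ≈ b
      lemma = solve 3 (λ a b c → a :+ b :+ c :- a :- c := b) ≈-refl

    -- Modulo q only Q′ B(q , r) is left of B(q Q′ , r), and Q′ is regular there.
    bracket-factor : ∀ {Q q Q′ r} → Q ≈ q * Q′ → Regular q Q′ → Q ∣ B Q r → q ∣ B q r
    bracket-factor {Q} {q} {Q′} {r} eq regular h =
      regular (∣-resp (*-comm _ _) (∣-cancel-+ {f = q * B Q′ r}
      (∣-resp (≈-trans (B-congˡ {r = r} eq) (≈-trans (B-*ˡ q Q′ r) (+-comm _ _)))
        (∣-trans (Q′ , eq) h)) (∣-*ʳ _ ∣-refl)))

  pairs : List (Fin ℓ × Fin ℓ)
  pairs = filter (λ (i , j) → i Fin.<? j) (cartesianProduct (allFin ℓ) (allFin ℓ))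

  pairs-ordered : All (λ (i , j) → i Fin.< j) pairs
  pairs-ordered = All.all-filter (λ (i , j) → i Fin.<? j) (cartesianProduct (allFin ℓ) (allFin ℓ))

  pairs-unique : Unique pairs
  pairs-unique = Unique.filter⁺ (λ (i , j) → i Fin.<? j)
    (Unique.cartesianProduct⁺ (Unique.allFin⁺ ℓ) (Unique.allFin⁺ ℓ))

  ∈-pairs : ∀ {i j} → i Fin.< j → (i , j) ∈ pairs
  ∈-pairs {i} {j} i<j = ∈-filter⁺ (λ (i , j) → i Fin.<? j) (∈-cartesianProduct⁺ (∈-allFin i)
    (∈-allFin j)) i<j

  factors-coprime : AllPairs Coprime (map (λ (i , j) → factor ℓ i j) pairs)
  factors-coprime = AllPairs-map⁺ {P = λ (i , j) → i Fin.< j} {_≢_}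
    (λ i<j k<l neq → coprime i<j k<l neq , coprime k<l i<j (neq ∘ ≡.sym)) pairs-ordered pairs-unique
    where
    coprime : ∀ {i j k l : Fin ℓ} → i Fin.< j → k Fin.< l → (i , j) ≢ (k , l) →
              Regular (factor ℓ i j) (factor ℓ k l)
    coprime i<j k<l neq = q-q (Fin.<⇒≢ i<j) (Fin.<⇒≢ k<l)
      (λ { (≡.refl , ≡.refl) → neq ≡.refl })
      (λ { (≡.refl , ≡.refl) → Fin.<-asym i<j k<l })

  module _ (θ : Operator ℓ 2 (∣S∣ ℓ)) where
    open SecondOrder ℓ θ

    admissible⇒D²𝒟 : Admissible θ → D²𝒟 ℓ θ
    admissible⇒D²𝒟 admissible = preserving⇒preserves θ (Π-preserving θ factors-coprime
      (All.map⁺ (All.map (λ i<j → factor∣Θ θ admissible (Fin.<⇒≢ i<j) , factor∣B θ admissible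
        (Fin.<⇒≢ i<j))
        pairs-ordered)))

    D²𝒟⇒ordered : D²𝒟 ℓ θ → ∀ {i j} k → i Fin.< j → factor ℓ i j ∣ u θ i k - u θ j k
    D²𝒟⇒ordered h {i} {j} k i<j =
      let Q′ , eq , regular = Π-split factors-coprime (∈-map⁺ (λ (i , j) → factor ℓ i j) (∈-pairs i<j)) in
      ∣-halve θ (∣-resp (B-factor θ i j k) (∣-*ˡ (var k)
        (bracket-factor θ {r = var k} eq regular (preserves⇒bracket θ h k))))

    D²𝒟⇒admissible : D²𝒟 ℓ θ → Admissible θ
    D²𝒟⇒admissible h i j k with Fin.<-cmp i j
    ... | tri≈ _ ≡.refl _ = ≡-mod-refl
    ... | tri< i<j _ _ = D²𝒟⇒ordered h k i<j
    ... | tri> _ _ j<i = ∣-respˡ (lemma (var j ^ 2) (var i ^ 2))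
      (∣-negˡ (∣-sym (D²𝒟⇒ordered h k j<i)))
      where
      lemma : ∀ a b → - (a - b) ≈ b - a
      lemma = solve 2 (λ a b → :- (a :- b) := b :- a) ≈-refl

-- Bases of operators from matrices

-- `IsBasis` indexes coefficients by positions in a list, the matrix argument by two families over
-- `Fin`. The position maps below translate between them without transport along equations of
-- lengths.
module Families {A : Set} where

  tabulateIndex : ∀ {n} (g : Fin n → A) → Fin n → Fin (length (tabulate g))
  tabulateIndex g zero    = zero
  tabulateIndex g (suc i) = suc (tabulateIndex (g ∘ suc) i)

  inl : ∀ {m} (f : Fin m → A) ys → Fin m → Fin (length (tabulate f ++ ys))
  inl f ys zero    = zero
  inl f ys (suc i) = suc (inl (f ∘ suc) ys i)

  inr : ∀ {m} (f : Fin m → A) ys → Fin (length ys) → Fin (length (tabulate f ++ ys))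
  inr {zero}  f ys j = j
  inr {suc m} f ys j = suc (inr (f ∘ suc) ys j)

  lookup-tabulate : ∀ {n} (g : Fin n → A) i → lookup (tabulate g) (tabulateIndex g i) ≡ g i
  lookup-tabulate g zero    = ≡.refl
  lookup-tabulate g (suc i) = lookup-tabulate (g ∘ suc) i

  lookup-inl : ∀ {m} (f : Fin m → A) ys i → lookup (tabulate f ++ ys) (inl f ys i) ≡ f i
  lookup-inl f ys zero    = ≡.refl
  lookup-inl f ys (suc i) = lookup-inl (f ∘ suc) ys i

  lookup-inr : ∀ {m} (f : Fin m → A) ys j → lookup (tabulate f ++ ys) (inr f ys j) ≡ lookup ys j
  lookup-inr {zero}  f ys j = ≡.refl
  lookup-inr {suc m} f ys j = lookup-inr (f ∘ suc) ys j

  tabulate-elim : ∀ {n} (g : Fin n → A) (P : Fin (length (tabulate g)) → Set) →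
                  (∀ i → P (tabulateIndex g i)) → ∀ i → P i
  tabulate-elim {suc n} g P h zero    = h zero
  tabulate-elim {suc n} g P h (suc i) = tabulate-elim (g ∘ suc) (P ∘ suc) (h ∘ suc) i

  ++-elim : ∀ {m} (f : Fin m → A) ys (P : Fin (length (tabulate f ++ ys)) → Set) →
            (∀ i → P (inl f ys i)) → (∀ j → P (inr f ys j)) → ∀ i → P i
  ++-elim {zero}  f ys P h₁ h₂ i       = h₂ i
  ++-elim {suc m} f ys P h₁ h₂ zero    = h₁ zero
  ++-elim {suc m} f ys P h₁ h₂ (suc i) = ++-elim (f ∘ suc) ys (P ∘ suc) (h₁ ∘ suc) h₂ i

  tabulateFunction : ∀ {n} {C : Set} (g : Fin n → A) → (Fin n → C) → Fin (length (tabulate g)) → C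
  tabulateFunction {suc n} g c zero    = c zero
  tabulateFunction {suc n} g c (suc i) = tabulateFunction (g ∘ suc) (c ∘ suc) i

  tabulateFunction-index : ∀ {n} {C : Set} (g : Fin n → A) (c : Fin n → C) i →
                           tabulateFunction g c (tabulateIndex g i) ≡ c i
  tabulateFunction-index g c zero    = ≡.refl
  tabulateFunction-index g c (suc i) = tabulateFunction-index (g ∘ suc) (c ∘ suc) i

  join : ∀ {m} {C : Set} (f : Fin m → A) ys → (Fin m → C) → (Fin (length ys) → C) →
         Fin (length (tabulate f ++ ys)) → C
  join {zero}  f ys c d i       = d i
  join {suc m} f ys c d zero    = c zero
  join {suc m} f ys c d (suc i) = join (f ∘ suc) ys (c ∘ suc) d i

  join-inl : ∀ {m} {C : Set} (f : Fin m → A) ys (c : Fin m → C) d i → join f ys c d (inl f ys i) ≡ c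
    i
  join-inl f ys c d zero    = ≡.refl
  join-inl f ys c d (suc i) = join-inl (f ∘ suc) ys (c ∘ suc) d i

  join-inr : ∀ {m} {C : Set} (f : Fin m → A) ys (c : Fin m → C) d j → join f ys c d (inr f ys j) ≡ d
    j
  join-inr {zero}  f ys c d j = ≡.refl
  join-inr {suc m} f ys c d j = join-inr (f ∘ suc) ys (c ∘ suc) d j

  module _ (R : CRing) where
    open Ring R

    sum-tabulate : ∀ {n} (g : Fin n → A) (φ : Fin (length (tabulate g)) → Carrier) →
                   sum φ ≈ sum (λ i → φ (tabulateIndex g i))
    sum-tabulate {zero}  g φ = ≈-refl
    sum-tabulate {suc n} g φ = +-congˡ (sum-tabulate (g ∘ suc) (φ ∘ suc))

    sum-++ : ∀ {m} (f : Fin m → A) ys (φ : Fin (length (tabulate f ++ ys)) → Carrier) →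
             sum φ ≈ sum (λ i → φ (inl f ys i)) + sum (λ j → φ (inr f ys j))
    sum-++ {zero}  f ys φ = ≈-sym (+-identityˡ _)
    sum-++ {suc m} f ys φ = ≈-trans (+-congˡ (sum-++ (f ∘ suc) ys (φ ∘ suc)))
      (≈-sym (+-assoc _ _ _))

-- Characterises the matrices u of the operators in D²(𝒟); the last field is what allows the
-- coefficients to be recovered.
record IsOperatorMatrix (ℓ : ℕ) (U : Fin ℓ → Fin ℓ → ∣S∣ ℓ) : Set where
  open Ring (S ℓ)
  open Divisibility (S ℓ)
  field
    symmetric  : ∀ i j → U i j ≈ U j i
    admissible : ∀ i j k → factor ℓ i j ∣ U i k - U j k
    xx∣        : ∀ i j → var i * var j ∣ U i j

module OperatorFromMatrix (ℓ : ℕ) where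
  open Ring (S ℓ)
  open Solver (S ℓ)
  open Divisibility (S ℓ)
  open Criterion ℓ

  -- xᵢ xⱼ α!, the ratio between an entry of u and the coefficient of θ at α.
  multiplier : MultiIndex ℓ 2 → ∣S∣ ℓ
  multiplier α = var (first α) * (var (second α) * κ α)

  multiplier-regular : ∀ α → Regular 0# (multiplier α)
  multiplier-regular α = regular-* (x-regular (first α)) (regular-* (x-regular (second α))
    λ {f} p → ∣-resp (≈-trans (lemma (con (reciprocalFactorial α)) (κ α) f)
      (≈-trans (*-congʳ (κ-inverse α)) (*-identityˡ f))) (∣-*ˡ (con (reciprocalFactorial α)) p))
    where
    lemma : ∀ a b c → a * (b * c) ≈ (a * b) * c
    lemma a b c = ≈-sym (*-assoc a b c)

  multiplier-* : ∀ θ α → multiplier α * θ α ≈ u θ (first α) (second α)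
  multiplier-* θ α = ≈-trans (lemma (var (first α)) (var (second α)) (κ α) (θ α))
    (*-congˡ (*-congˡ (≈-sym (G-entry θ α))))
    where
    lemma : ∀ x y k t → x * (y * k) * t ≈ x * (y * (t * k))
    lemma = solve 4 (λ x y k t → x :* (y :* k) :* t := x :* (y :* (t :* k))) ≈-refl

  module _ (U : Fin ℓ → Fin ℓ → ∣S∣ ℓ)
           (isOperatorMatrix : IsOperatorMatrix ℓ U) where
    open IsOperatorMatrix isOperatorMatrix

    abstract
      operator : Operator ℓ 2 (∣S∣ ℓ)
      operator α = proj₁ (xx∣ (first α) (second α)) * con (reciprocalFactorial α)

      operator-u-entry : ∀ α → u operator (first α) (second α) ≈ U (first α) (second α)
      operator-u-entry α = ≈-trans (≈-sym (multiplier-* operator α))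
        (≈-trans (lemma (var (first α)) (var (second α)) (κ α) (con (reciprocalFactorial α))
          (proj₁ (xx∣ (first α) (second α))))
        (≈-trans (*-congʳ (κ-inverse α))
          (≈-trans (*-identityˡ _) (≈-sym (proj₂ (xx∣ (first α) (second α)))))))
        where
        lemma : ∀ x y k r g → x * (y * k) * (g * r) ≈ (r * k) * (x * y * g)
        lemma = solve 5 (λ x y k r g → x :* (y :* k) :* (g :* r) := (r :* k) :* (x :* y :* g))
          ≈-refl

    operator-u : ∀ i j → u operator i j ≈ U i j
    operator-u i j = at (pair-surjective i j)
      where
      at : (∃ λ α → (first α ≡ i × second α ≡ j) ⊎ (first α ≡ j × second α ≡ i)) →
        u operator i j ≈ U i j
      at (α , inj₁ (≡.refl , ≡.refl)) = operator-u-entry α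
      at (α , inj₂ (≡.refl , ≡.refl)) = ≈-trans (u-symmetric operator (second α) (first α))
        (≈-trans (operator-u-entry α) (symmetric (first α) (second α)))

    multiplier-operator : ∀ α → multiplier α * operator α ≈ U (first α) (second α)
    multiplier-operator α = ≈-trans (multiplier-* operator α) (operator-u (first α) (second α))

    operator∈D²𝒟 : D²𝒟 ℓ operator
    operator∈D²𝒟 = admissible⇒D²𝒟 operator λ i j k →
      ∣-resp (+-cong (≈-sym (operator-u i k)) (-‿cong (≈-sym (operator-u j k)))) (admissible i j k)

module FamilyBasis {ℓ d m k : ℕ} (M : Operator ℓ d (∣S∣ ℓ) → Set)
                   (f : Fin m → Operator ℓ d (∣S∣ ℓ)) (g : Fin k → Operator ℓ d (∣S∣ ℓ)) where
  open Ring (S ℓ)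
  open Sums (S ℓ)
  open Families {Operator ℓ d (∣S∣ ℓ)}

  familyCombination : (Fin m → ∣S∣ ℓ) → (Fin k → ∣S∣ ℓ) → MultiIndex ℓ d → ∣S∣ ℓ
  familyCombination a b α = sum (λ i → a i * f i α) + sum (λ j → b j * g j α)

  private
    family : List (Operator ℓ d (∣S∣ ℓ))
    family = tabulate f ++ tabulate g

    left : Fin m → Fin (length family)
    left = inl f (tabulate g)

    right : Fin k → Fin (length family)
    right j = inr f (tabulate g) (tabulateIndex g j)

    combination-family : ∀ c α → combination family c α ≈ familyCombination (c ∘ left) (c ∘ right) α
    combination-family c α = ≈-trans (sum-++ (S ℓ) f (tabulate g) (λ i → c i * lookup family i α))
      (+-cong
        (sum-cong (λ i → c (left i) * lookup family (left i) α) (λ i → c (left i) * f i α) λ i →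
          *-congˡ (reflexive (≡.cong (λ θ → θ α) (lookup-inl f (tabulate g) i))))
        (≈-trans (sum-tabulate (S ℓ) g _)
          (sum-cong (λ j → c (right j) * lookup family (right j) α) (λ j → c (right j) * g j α)
            λ j →
            *-congˡ (reflexive (≡.cong (λ θ → θ α)
              (≡.trans (lookup-inr f (tabulate g) (tabulateIndex g j)) (lookup-tabulate g j)))))))

  module _ (f∈M : ∀ i → M (f i)) (g∈M : ∀ j → M (g j))
           (spans : ∀ θ → M θ → ∃ λ a → ∃ λ b → ∀ α → θ α ≈ familyCombination a b α)
           (independent : ∀ a b → (∀ α → familyCombination a b α ≈ 0#) →
                          (∀ i → a i ≈ 0#) × (∀ j → b j ≈ 0#)) where

    isFamilyBasis : IsBasis M (tabulate f ++ tabulate g)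
    isFamilyBasis = record
      { belongs = All.++⁺ (All.tabulate⁺ f∈M) (All.tabulate⁺ g∈M)
      ; spans = λ θ θ∈M → let a , b , eq = spans θ θ∈M in
          join f (tabulate g) a (tabulateFunction g b) , λ α → ≈-trans (eq α) (≈-sym
            (≈-trans (combination-family _ α) (joined a b α)))
      ; independent = λ c h →
          let a≈0 , b≈0 = independent (c ∘ left) (c ∘ right)
                            (λ α → ≈-trans (≈-sym (combination-family c α)) (h α)) in
          ++-elim f (tabulate g) (λ i → c i ≈ 0#) a≈0
            (tabulate-elim g (λ j → c (inr f (tabulate g) j) ≈ 0#) b≈0)
      }
      where
      joined : ∀ a b α → familyCombination (join f (tabulate g) a (tabulateFunction g b) ∘ left)
                                           (join f (tabulate g) a (tabulateFunction g b) ∘ right) α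
                         ≈ familyCombination a b α
      joined a b α = +-cong
        (sum-cong _ (λ i → a i * f i α) λ i →
          *-congʳ (reflexive (join-inl f (tabulate g) a (tabulateFunction g b) i)))
        (sum-cong _ (λ j → b j * g j α) λ j → *-congʳ (reflexive (≡.trans
          (join-inr f (tabulate g) a (tabulateFunction g b) (tabulateIndex g j))
            (tabulateFunction-index g b j))))

module MatrixFamily {ℓ m k : ℕ} (H : Fin m → Fin ℓ → Fin ℓ → ∣S∣ ℓ) (K : Fin k → Fin ℓ → Fin ℓ → ∣S∣ ℓ)
                    (H-matrix : ∀ i → IsOperatorMatrix ℓ (H i))
                    (K-matrix : ∀ j → IsOperatorMatrix ℓ (K j)) where
  open Ring (S ℓ)
  open Solver (S ℓ)
  open Sums (S ℓ)
  open Divisibility (S ℓ)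
  open Criterion ℓ
  open OperatorFromMatrix ℓ
  open IsOperatorMatrix
  open SetoidReasoning setoid

  matrixTotal : (Fin m → ∣S∣ ℓ) → (Fin k → ∣S∣ ℓ) → Fin ℓ → Fin ℓ → ∣S∣ ℓ
  matrixTotal a b p q = sum (λ i → a i * H i p q) + sum (λ j → b j * K j p q)

  H-operator : Fin m → Operator ℓ 2 (∣S∣ ℓ)
  H-operator i = operator (H i) (H-matrix i)

  K-operator : Fin k → Operator ℓ 2 (∣S∣ ℓ)
  K-operator j = operator (K j) (K-matrix j)

  open FamilyBasis (D²𝒟 ℓ) H-operator K-operator

  scaled-sum : ∀ {m} (c : Fin m → ∣S∣ ℓ) (f M : Fin m → ∣S∣ ℓ) a → (∀ k → a * f k ≈ M k) →
               a * sum (λ k → c k * f k) ≈ sum (λ k → c k * M k)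
  scaled-sum c f M a h = ≈-trans (*-sumˡ a (λ k → c k * f k))
    (sum-cong (λ k → a * (c k * f k)) (λ k → c k * M k) (λ k → ≈-trans (*-swapˡ a (c k) (f k))
      (*-congˡ (h k))))

  -- Turns a linear combination of operators into the same combination of matrices. As the
  -- multiplier is regular, spanning and independence transfer.
  multiplier-combination : ∀ a b α → multiplier α * familyCombination a b α ≈ matrixTotal a b
    (first α) (second α)
  multiplier-combination a b α = ≈-trans (distribˡ (multiplier α) _ _) (+-cong
    (scaled-sum a (λ i → H-operator i α) (λ i → H i (first α) (second α)) (multiplier α) (λ i →
      multiplier-operator (H i) (H-matrix i) α))
    (scaled-sum b (λ j → K-operator j α) (λ j → K j (first α) (second α)) (multiplier α) (λ j →
      multiplier-operator (K j) (K-matrix j) α)))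

  matrixTotal-symmetric : ∀ a b p q → matrixTotal a b p q ≈ matrixTotal a b q p
  matrixTotal-symmetric a b p q = +-cong
    (sum-cong (λ i → a i * H i p q) (λ i → a i * H i q p)
      (λ i → *-congˡ (symmetric (H-matrix i) p q)))
    (sum-cong (λ j → b j * K j p q) (λ j → b j * K j q p)
      (λ j → *-congˡ (symmetric (K-matrix j) p q)))

  module _
    (matrices-span : (U G : Fin ℓ → Fin ℓ → ∣S∣ ℓ) → (∀ i j → U i j ≈ U j i) →
      (∀ i j k → factor ℓ i j ∣ U i k - U j k) → (∀ i j → U i j ≈ var i * (var j * G i j)) →
      ∃ λ a → ∃ λ b → ∀ i j → U i j ≈ matrixTotal a b i j)
    (matrices-independent : ∀ a b → (∀ i j → matrixTotal a b i j ≈ 0#) →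
      (∀ i → a i ≈ 0#) × (∀ j → b j ≈ 0#)) where

    operators-span : ∀ θ → D²𝒟 ℓ θ → ∃ λ a → ∃ λ b → ∀ α → θ α ≈ familyCombination a b α
    operators-span θ θ∈ = from
      (matrices-span (u θ) (SecondOrder.G ℓ θ) (u-symmetric θ) (D²𝒟⇒admissible θ θ∈)
        (λ i j → ≈-refl))
      where
      from : (∃ λ a → ∃ λ b → ∀ i j → u θ i j ≈ matrixTotal a b i j) →
             ∃ λ a → ∃ λ b → ∀ α → θ α ≈ familyCombination a b α
      from (a , b , eq) = a , b , λ α → cancel (multiplier-regular α) (begin
        multiplier α * θ α                      ≈⟨ multiplier-* θ α ⟩
        u θ (first α) (second α)                ≈⟨ eq (first α) (second α) ⟩
        matrixTotal a b (first α) (second α)    ≈⟨ multiplier-combination a b α ⟨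
        multiplier α * familyCombination a b α  ∎)

    operators-independent : ∀ a b → (∀ α → familyCombination a b α ≈ 0#) →
                            (∀ i → a i ≈ 0#) × (∀ j → b j ≈ 0#)
    operators-independent a b h = matrices-independent a b (λ i j → at (pair-surjective i j))
      where
      at-α : ∀ α → matrixTotal a b (first α) (second α) ≈ 0#
      at-α α = ≈-trans (≈-sym (multiplier-combination a b α)) (≈-trans (*-congˡ (h α)) (zeroʳ _))
      at : ∀ {i j} → (∃ λ α → (first α ≡ i × second α ≡ j) ⊎ (first α ≡ j × second α ≡ i)) →
           matrixTotal a b i j ≈ 0#
      at (α , inj₁ (≡.refl , ≡.refl)) = at-α α
      at (α , inj₂ (≡.refl , ≡.refl)) = ≈-trans (matrixTotal-symmetric a b (second α) (first α))
        (at-α α)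

    isMatrixBasis : IsBasis (D²𝒟 ℓ) (tabulate H-operator ++ tabulate K-operator)
    isMatrixBasis = isFamilyBasis
      (λ i → operator∈D²𝒟 (H i) (H-matrix i))
      (λ j → operator∈D²𝒟 (K j) (K-matrix j))
      operators-span operators-independent

module Basis {n : ℕ} (E : Pairs (2+ n)) where
  open Pairs E
  open DivisibleMatrices (S (2+ n)) coordinates E using (θ-matrix; η-matrix)
  open MatrixBasis (S (2+ n)) coordinates E using (independent; spanning)
  open BasisMatrices (S (2+ n)) coordinates E

  η-isOperatorMatrix : ∀ k → IsOperatorMatrix (2+ n) (η-matrix k)
  η-isOperatorMatrix k = record { symmetric = η-symmetric k ; admissible = η-≡-mod k ; xx∣ =
    xx∣η k }

  θ-isOperatorMatrix : ∀ k → IsOperatorMatrix (2+ n) (θ-matrix k)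
  θ-isOperatorMatrix k = record { symmetric = θ-symmetric k ; admissible = θ-≡-mod k ; xx∣ =
    xx∣θ k }

  open MatrixFamily η-matrix θ-matrix η-isOperatorMatrix θ-isOperatorMatrix public
    using () renaming (H-operator to η-operator; K-operator to θ-operator)

  isBasis : IsBasis (D²𝒟 (2+ n)) (tabulate η-operator ++ tabulate θ-operator)
  isBasis = MatrixFamily.isMatrixBasis η-matrix θ-matrix η-isOperatorMatrix θ-isOperatorMatrix
    spanning independent

-- Laurent polynomials

lookup-unique : ∀ {A : Set} {xs : List A} → Unique xs → ∀ {i j} → lookup xs i ≡ lookup xs j → i ≡ j
lookup-unique (u ∷ us) {zero}  {zero}  eq = ≡.refl
lookup-unique {xs = x ∷ xs} (u ∷ us) {zero}  {suc j} eq =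
  ⊥-elim (All.lookup u (∈-lookup {xs = xs} j) eq)
lookup-unique {xs = x ∷ xs} (u ∷ us) {suc i} {zero}  eq =
  ⊥-elim (All.lookup u (∈-lookup {xs = xs} i) (≡.sym eq))
lookup-unique (u ∷ us) {suc i} {suc j} eq = ≡.cong suc (lookup-unique us eq)

-- The pair q < p stands for the partition (p - 1 , q).
record EnumeratesΛ (n : ℕ) (xs : List (ℕ × ℕ)) : Set where
  field
    inRange  : All (λ (a , b) → a ℕ.≤ n × b ℕ.≤ a) xs
    unique   : Unique xs
    complete : ∀ {a b} → a ℕ.≤ n → b ℕ.≤ a → (a , b) ∈ xs

  range : ∀ k → proj₁ (lookup xs k) ℕ.≤ n × proj₂ (lookup xs k) ℕ.≤ proj₁ (lookup xs k)
  range k = All.lookup inRange (∈-lookup k)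

  -- The shift λ₁ + 1 is the staircase (1 , 0) added to λ in the determinant of the numerator; λ₁ ≤
  -- ℓ - 2 keeps it below ℓ.
  hi< : ∀ k → suc (proj₁ (lookup xs k)) ℕ.< 2+ n
  hi< k = s≤s (s≤s (proj₁ (range k)))

  lo< : ∀ k → proj₂ (lookup xs k) ℕ.< 2+ n
  lo< k = s≤s (ℕ.≤-trans (proj₂ (range k)) (ℕ.≤-trans (proj₁ (range k)) (ℕ.n≤1+n n)))

  pairsΛ : Pairs (2+ n)
  pairsΛ = record
    { size = length xs
    ; hi = hi
    ; lo = lo
    ; ordered = λ k → ≡.subst₂ ℕ._<_ (≡.sym (Fin.toℕ-fromℕ< (lo< k)))
      (≡.sym (Fin.toℕ-fromℕ< (hi< k)))
        (s≤s (proj₂ (range k)))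
    ; index = λ {p} {q} q<p → find p q q<p
    ; injective = λ {k} {l} p q → lookup-unique unique (≡.cong₂ _,_
        (ℕ.suc-injective (≡.trans (≡.sym (Fin.toℕ-fromℕ< (hi< k)))
          (≡.trans (≡.cong toℕ p) (Fin.toℕ-fromℕ< (hi< l)))))
        (≡.trans (≡.sym (Fin.toℕ-fromℕ< (lo< k)))
          (≡.trans (≡.cong toℕ q) (Fin.toℕ-fromℕ< (lo< l)))))
    }
    where
    hi lo : Fin (length xs) → Fin (2+ n)
    hi k = Fin.fromℕ< (hi< k)
    lo k = Fin.fromℕ< (lo< k)
    find : ∀ p q → q Fin.< p → ∃ λ k → hi k ≡ p × lo k ≡ q
    find (suc p) q (s≤s q≤p) = Any.index i ,
      Fin.toℕ-injective (≡.trans (Fin.toℕ-fromℕ< (hi< (Any.index i)))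
        (≡.cong (suc ∘ proj₁) (≡.sym eq))) ,
      Fin.toℕ-injective (≡.trans (Fin.toℕ-fromℕ< (lo< (Any.index i))) (≡.cong proj₂ (≡.sym eq)))
      where
      i : (toℕ p , toℕ q) ∈ xs
      i = complete (ℕ.≤-pred (Fin.toℕ<n p)) q≤p
      eq : (toℕ p , toℕ q) ≡ lookup xs (Any.index i)
      eq = Any.lookup-index i

  toℕ-hi : ∀ k → toℕ (Pairs.hi pairsΛ k) ≡ suc (proj₁ (lookup xs k))
  toℕ-hi k = Fin.toℕ-fromℕ< (hi< k)

  toℕ-lo : ∀ k → toℕ (Pairs.lo pairsΛ k) ≡ proj₂ (lookup xs k)
  toℕ-lo k = Fin.toℕ-fromℕ< (lo< k)

module Laurent (ℓ : ℕ) where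
  open Ring (L ℓ)
  open Solver (L ℓ)
  private
    module S = Ring (S ℓ)

  ι-cong : ∀ {p q} → p S.≈ q → ι {ℓ} p ≈ ι q
  ι-cong = Evaluation.evaluate-cong {f = con} constants {ρ = var ∘ inj₁} (λ ())

  ι-^ : ∀ p n → ι {ℓ} (p S.^ n) ≡ ι p ^ n
  ι-^ p zero    = ≡.refl
  ι-^ p (suc n) = ≡.cong (ι p *_) (ι-^ p n)

  ι-Π : ∀ {A : Set} (f : A → ∣S∣ ℓ) xs → ι S.Π[ map f xs ] ≡ Π[ map (ι ∘ f) xs ]
  ι-Π f []       = ≡.refl
  ι-Π f (a ∷ xs) = ≡.cong (ι (f a) *_) (ι-Π f xs)

  xˡ x⁻¹ : Fin ℓ → Carrier
  xˡ i = var (inj₁ i)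
  x⁻¹ i = var (inj₂ i)

  x-inverse : ∀ i → xˡ i * x⁻¹ i ≈ 1#
  x-inverse i = Presentation.relation (inverse i)

  module _ (α : MultiIndex ℓ 2) where
    open Alternants (S ℓ) using (schur)
    private
      module S₂ = Ring (laurentRing (S ℓ) 2)
      t₁ t₂ : S₂.Carrier
      t₁ = Schur.t (S ℓ) zero S₂.^ 2
      t₂ = Schur.t (S ℓ) (suc zero) S₂.^ 2
      T₁ T₂ : ∣S∣ ℓ
      T₁ = var (first α) S.^ 2
      T₂ = var (second α) S.^ 2

    module _ (ρ : Fin 2 ⊎ Fin 2 → Carrier)
             (ρ₁ : ρ (inj₁ zero) ≡ xˡ (first α)) (ρ₂ : ρ (inj₁ (suc zero)) ≡ xˡ (second α)) where

      evaluate-t₁ : evaluate (L ℓ) ι ρ t₁ ≡ ι T₁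
      evaluate-t₁ = ≡.cong (_^ 2) ρ₁

      evaluate-t₂ : evaluate (L ℓ) ι ρ t₂ ≡ ι T₂
      evaluate-t₂ = ≡.cong (_^ 2) ρ₂

      evaluate-t₁^ : ∀ n → evaluate (L ℓ) ι ρ (t₁ S₂.^ n) ≡ ι (T₁ S.^ n)
      evaluate-t₁^ zero    = ≡.refl
      evaluate-t₁^ (suc n) = ≡.cong₂ _*_ evaluate-t₁ (evaluate-t₁^ n)

      -- Both sides unfold by the same recursion, so they are equal as terms and not merely in the
      -- quotient ring.
      evaluate-schur : ∀ p q → q ℕ.< p →
        evaluate (L ℓ) ι ρ (proj₁ (alternating (laurentRing (S ℓ) 2) t₁ t₂ p q)) ≡ ι
          (schur p q T₁ T₂)
      evaluate-schur (suc zero)    zero    _       = ≡.cong (λ t → con (fromℚ 1ℚ) + t * con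
        (fromℚ 0ℚ)) evaluate-t₂
      evaluate-schur (suc (suc p)) zero    _       = ≡.cong₂ _+_ (evaluate-t₁^ (suc p))
        (≡.cong₂ _*_ evaluate-t₂ (evaluate-schur (suc p) zero (s≤s z≤n)))
      evaluate-schur (suc p)       (suc q) (s≤s h) =
        ≡.cong₂ _*_ (≡.cong₂ _*_ evaluate-t₁ evaluate-t₂) (evaluate-schur p q h)

    s-at : ∀ a b → b ℕ.≤ a → (s[_]at_ ℓ (a , b) α) ≡ x⁻¹ (first α) * x⁻¹ (second α) * ι
      (schur (suc a) b T₁ T₂)
    s-at a b b≤a = ≡.cong (x⁻¹ (first α) * x⁻¹ (second α) *_) (≡.trans
      (evaluate-schur _ ≡.refl ≡.refl (a ℕ.+ 1) (b ℕ.+ 0)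
        (≡.subst₂ ℕ._<_ (≡.sym (ℕ.+-identityʳ b)) (ℕ.+-comm 1 a) (s≤s b≤a)))
      (≡.cong₂ (λ p q → ι (schur p q T₁ T₂)) (ℕ.+-comm a 1) (ℕ.+-identityʳ b)))

    open Criterion ℓ using (κ; κ-inverse)
    open OperatorFromMatrix ℓ using (multiplier)

    private
      x y x′ y′ r k : Carrier
      x = xˡ (first α)
      y = xˡ (second α)
      x′ = x⁻¹ (first α)
      y′ = x⁻¹ (second α)
      r = con (reciprocalFactorial α)
      k = ι (κ α)

    -- The multiplier is a unit among Laurent polynomials, so identities of coefficients can be
    -- checked after clearing the denominators.
    inverse-multiplier : x′ * y′ * r * ι (multiplier α) ≈ 1#
    inverse-multiplier = ≈-trans (rearrange x y k x′ y′ r)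
      (≈-trans (*-cong (*-cong (x-inverse (first α)) (x-inverse (second α))) (ι-cong (κ-inverse α)))
        (collapse 1#))
      where
      rearrange : ∀ x y k x′ y′ r → x′ * y′ * r * (x * (y * k)) ≈ (x * x′) * (y * y′) * (r * k)
      rearrange = solve 6 (λ x y k x′ y′ r → x′ :* y′ :* r :* (x :* (y :* k)) := (x :* x′) :*
        (y :* y′) :* (r :* k)) ≈-refl
      collapse : ∀ x → 1# * 1# * 1# ≈ 1#
      collapse = solve 1 (λ x → :1 :* :1 :* :1 := :1) ≈-refl

    multiplier-cancel : ∀ {a b} → ι (multiplier α) * a ≈ ι (multiplier α) * b → a ≈ b
    multiplier-cancel {a} {b} eq = ≈-trans (expand a) (≈-trans (*-congˡ eq) (≈-sym (expand b)))
      where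
      expand : ∀ a → a ≈ x′ * y′ * r * (ι (multiplier α) * a)
      expand a = ≈-trans (≈-sym (*-identityˡ a)) (≈-trans (*-congʳ (≈-sym inverse-multiplier))
        (*-assoc _ _ a))

    multiplier-θ : ∀ a b → b ℕ.≤ a → ι (multiplier α) * θ ℓ (a , b) α ≈ ι (schur (suc a) b T₁ T₂)
    multiplier-θ a b b≤a = ≈-trans (*-congˡ (*-congʳ (reflexive (s-at a b b≤a))))
      (≈-trans (rearrange (ι (multiplier α)) x′ y′ (ι (schur (suc a) b T₁ T₂)) r)
      (≈-trans (*-congʳ inverse-multiplier) (*-identityˡ _)))
      where
      rearrange : ∀ m x′ y′ s r → m * (x′ * y′ * s * r) ≈ (x′ * y′ * r * m) * s
      rearrange = solve 5 (λ m x′ y′ s r → m :* (x′ :* y′ :* s :* r) := (x′ :* y′ :* r :* m) :* s)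
        ≈-refl

  indices≡ : ∀ (α : MultiIndex ℓ 2) → indices α ≡ first α ∷ second α ∷ []
  indices≡ α = go (indices α)
    where
    go : ∀ (v : Vec (Fin ℓ) 2) → v ≡ Vec.lookup v zero ∷ Vec.lookup v (suc zero) ∷ []
    go (a ∷ b ∷ []) = ≡.refl

  ∂²-same : ∀ {k} (α : MultiIndex ℓ 2) → first α ≡ k → second α ≡ k → ∂²[_] ℓ k α ≡ 1#
  ∂²-same {k} α p q = ≡.cong (λ b → if b then 1# else 0#)
    (dec-true (Vec.≡-dec Fin._≟_ (indices α) (k ∷ k ∷ []))
      (≡.trans (indices≡ α) (≡.cong₂ (λ a b → a ∷ b ∷ []) p q)))

  ∂²-other : ∀ {k} (α : MultiIndex ℓ 2) → ¬ (k ≡ first α × k ≡ second α) → ∂²[_] ℓ k α ≡ 0#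
  ∂²-other {k} α neq = ≡.cong (λ b → if b then 1# else 0#)
    (dec-false (Vec.≡-dec Fin._≟_ (indices α) (k ∷ k ∷ [])) λ eq → neq
      (≡.sym (≡.cong (λ v → Vec.lookup v zero) eq) ,
        ≡.sym (≡.cong (λ v → Vec.lookup v (suc zero)) eq)))

  multiplier-∂² : ∀ k (α : MultiIndex ℓ 2) P →
    ι (OperatorFromMatrix.multiplier ℓ α) * (ι P * (con (fromℚ ℚ.½) * x⁻¹ k) * ∂²[_] ℓ k α) ≈
    ι (Alternants.δ (S ℓ) k (first α) S.* Alternants.δ (S ℓ) k (second α) S.* (var k S.* P))
  multiplier-∂² k α P with first α Fin.≟ k | second α Fin.≟ k
  ... | no p | _ = ≈-trans (*-congˡ (*-congˡ (reflexive (∂²-other α (λ (eq , _) → p (≡.sym eq))))))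
      (≈-trans (lemma (ι (OperatorFromMatrix.multiplier ℓ α)) _) (≈-sym (≈-trans (*-congʳ (ι-cong
        (Alternants.δδ-≢ (S ℓ) {i = k} {first α} {k} {second α} (λ (eq , _) → p (≡.sym eq)))))
          (zeroˡ _))))
    where
    lemma : ∀ a b → a * (b * 0#) ≈ 0#
    lemma = solve 2 (λ a b → a :* (b :* :0) := :0) ≈-refl
  ... | yes _ | no q = ≈-trans
    (*-congˡ (*-congˡ (reflexive (∂²-other α (λ (_ , eq) → q (≡.sym eq))))))
      (≈-trans (lemma (ι (OperatorFromMatrix.multiplier ℓ α)) _) (≈-sym (≈-trans (*-congʳ (ι-cong
        (Alternants.δδ-≢ (S ℓ) {i = k} {first α} {k} {second α} (λ (_ , eq) → q (≡.sym eq)))))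
          (zeroˡ _))))
    where
    lemma : ∀ a b → a * (b * 0#) ≈ 0#
    lemma = solve 2 (λ a b → a :* (b :* :0) := :0) ≈-refl
  ... | yes p | yes q = ≈-trans
      (*-cong (*-cong (reflexive (≡.cong xˡ p)) (*-congʳ (reflexive (≡.cong xˡ q))))
        (*-congˡ (reflexive (∂²-same α p q))))
      (≈-trans (rearrange (xˡ k) (ι κα) (ι P) (con (fromℚ ℚ.½)) (x⁻¹ k))
      (≈-trans (*-congʳ (*-cong (x-inverse k) half)) (≈-sym (≈-trans (*-congʳ
        (≈-trans (ι-cong (S.*-cong (Alternants.δ-≡ (S ℓ) (≡.sym p))
          (Alternants.δ-≡ (S ℓ) (≡.sym q)))) ≈-refl)) ≈-refl))))
    where
    κα : ∣S∣ ℓ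
    κα = Criterion.κ ℓ α
    half : con (fromℚ ℚ.½) * ι κα ≈ 1#
    half = ≈-trans (*-congʳ
      (reflexive (≡.cong (con ∘ fromℚ) (≡.sym (rational-equal α (≡.trans p (≡.sym q)))))))
      (ι-cong (Criterion.κ-inverse ℓ α))
    rearrange : ∀ x k p h x′ → x * (x * k) * (p * (h * x′) * 1#) ≈ (x * x′) * (h * k) * (x * p)
    rearrange = solve 5 (λ x k p h x′ → x :* (x :* k) :* (p :* (h :* x′) :* :1) := (x :* x′) :*
      (h :* k) :* (x :* p)) ≈-refl

  operator-represents : ∀ U isOperatorMatrix {χ} →
    (∀ α → ι (OperatorFromMatrix.multiplier ℓ α) * χ α ≈ ι (U (first α) (second α))) →
    OperatorFromMatrix.operator ℓ U isOperatorMatrix Represents χ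
  operator-represents U isOperatorMatrix h α = multiplier-cancel α
    (≈-trans (ι-cong {multiplier α S.* operator U isOperatorMatrix α} {U (first α) (second α)}
      (multiplier-operator U isOperatorMatrix α)) (≈-sym (h α)))
    where open OperatorFromMatrix ℓ

module Representation {n : ℕ} {xs : List (ℕ × ℕ)} (enumerates : EnumeratesΛ n xs) where
  open EnumeratesΛ enumerates
  open Ring (L (2+ n))
  open Solver (L (2+ n))
  open Laurent (2+ n)
  open OperatorFromMatrix (2+ n) using (multiplier)
  open Pairs pairsΛ
  open Basis pairsΛ
  open DivisibleMatrices (S (2+ n)) coordinates pairsΛ using (weight; θ-matrix; η-matrix; Πx; Πx/x; Πx≈; σ)
  open Alternants (S (2+ n)) using (schur; schur-1-0; δ; δ-≡; δδ-≢)
  private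
    module S = Ring (S (2+ n))

  ι-Πx : ι {2+ n} Πx ≡ X (2+ n)
  ι-Πx = ι-Π var (allFin (2+ n))

  schurᵀ : MultiIndex (2+ n) 2 → ℕ → ℕ → ∣S∣ (2+ n)
  schurᵀ α p q = schur p q (var (first α) S.^ 2) (var (second α) S.^ 2)

  multiplier-θ𝒟 : ∀ α lam → proj₂ lam ℕ.≤ proj₁ lam → ι (multiplier α) * θ𝒟 (2+ n) lam α ≈
    ι (weight (suc (proj₁ lam)) (proj₂ lam) S.* schurᵀ α (suc (proj₁ lam)) (proj₂ lam))
  multiplier-θ𝒟 α (a     , suc b) b≤a = ≈-trans (multiplier-θ α a (suc b) b≤a)
    (≈-sym (*-identityˡ _))
  multiplier-θ𝒟 α (suc a , zero)  b≤a = ≈-trans (*-swapˡ (ι (multiplier α)) (X (2+ n))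
    (θ (2+ n) (suc a , zero) α))
    (*-cong (reflexive (≡.sym ι-Πx)) (multiplier-θ α (suc a) zero b≤a))
  multiplier-θ𝒟 α (zero  , zero)  b≤a = ≈-trans (*-swapˡ (ι (multiplier α)) (X (2+ n) ^ 2)
    (θ (2+ n) (zero , zero) α))
    (*-cong (reflexive (≡.trans (≡.cong (_^ 2) (≡.sym ι-Πx)) (≡.sym (ι-^ Πx 2))))
      (multiplier-θ α zero zero b≤a))

  θ-represents : ∀ k → θ-operator k Represents θ𝒟 (2+ n) (lookup xs k)
  θ-represents k = operator-represents (θ-matrix k) (θ-isOperatorMatrix k) λ α →
    ≈-trans (multiplier-θ𝒟 α (lookup xs k) (proj₂ (range k)))
      (reflexive (≡.sym (≡.cong₂ (λ p q → ι (weight p q S.* schurᵀ α p q)) (toℕ-hi k) (toℕ-lo k))))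

  private
    ι-σ : ι {2+ n} σ ≡ (- 1#) ^ suc n
    ι-σ = ι-^ (S.- S.1#) (suc n)

    X≈ : ∀ k → X (2+ n) ≈ xˡ k * ι (Πx/x k)
    X≈ k = ≈-trans (reflexive (≡.sym ι-Πx)) (ι-cong {Πx} {var k S.* Πx/x k} (Πx≈ k))

  multiplier-θ𝒟-0 : ∀ α → ι (multiplier α) * θ𝒟 (2+ n) (0 , 0) α ≈ X (2+ n) ^ 2
  multiplier-θ𝒟-0 α = ≈-trans (multiplier-θ𝒟 α (0 , 0) z≤n) (≈-trans
    (*-cong (reflexive (≡.trans (ι-^ Πx 2) (≡.cong (_^ 2) ι-Πx)))
      (ι-cong {schurᵀ α 1 0} {S.1#} (schur-1-0 (var (first α) S.^ 2) (var (second α) S.^ 2))))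
        (*-identityʳ _))

  -- Cleared of denominators, θ for λ = (0 , 0) is the square of x₁⋯x_ℓ; dividing it by x_k leaves
  -- x_k times the square of the product of the other variables.
  η-represents : ∀ k → η-operator k Represents η𝒟 (2+ n) k
  η-represents k = operator-represents (η-matrix k) (η-isOperatorMatrix k) λ α →
    ≈-trans (distribute (ι (multiplier α)) (ι (h𝒟 (2+ n) k) * (con (fromℚ ℚ.½) * x⁻¹ k) * ∂²[_]
      (2+ n) k α)
                        ((- 1#) ^ suc n) (x⁻¹ k) (θ𝒟 (2+ n) (0 , 0) α))
    (+-cong (multiplier-∂² k α (h𝒟 (2+ n) k)) (-‿cong (≈-trans (*-congˡ (multiplier-θ𝒟-0 α))
      (≈-trans (*-congˡ (*-cong (X≈ k) (*-congʳ (X≈ k))))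
      (≈-trans (cancel-x ((- 1#) ^ suc n) (xˡ k) (x⁻¹ k) (ι (Πx/x k)) (x-inverse k))
        (*-congʳ (reflexive (≡.sym ι-σ))))))))
    where
    distribute : ∀ m a s x′ t → m * (a - s * x′ * t) ≈ m * a - s * x′ * (m * t)
    distribute = solve 5 (λ m a s x′ t → m :* (a :- s :* x′ :* t) := m :* a :- s :* x′ :* (m :* t))
      ≈-refl
    cancel-x : ∀ s x x′ y → x * x′ ≈ 1# →
      s * x′ * ((x * y) * ((x * y) * 1#)) ≈ s * (x * (y * (y * 1#)))
    cancel-x s x x′ y eq = ≈-trans (lemma s x x′ y) (≈-trans (*-congʳ eq) (*-identityˡ _))
      where
      lemma : ∀ s x x′ y → s * x′ * ((x * y) * ((x * y) * 1#)) ≈ (x * x′)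
        * (s * (x * (y * (y * 1#))))
      lemma = solve 4 (λ s x x′ y → s :* x′ :* ((x :* y) :* ((x :* y) :* :1)) := (x :* x′) :*
        (s :* (x :* (y :* (y :* :1))))) ≈-refl

  basis-represents : Pointwise _Represents_ (tabulate η-operator ++ tabulate θ-operator)
                       (map (η𝒟 (2+ n)) (allFin (2+ n)) ++ map (θ𝒟 (2+ n)) xs)
  basis-represents = Pointwise.++⁺
    (≡.subst (Pointwise _Represents_ (tabulate η-operator))
      (≡.sym (List.map-tabulate (λ k → k) (η𝒟 (2+ n))))
      (Pointwise.tabulate⁺ {f = η-operator} {η𝒟 (2+ n)} η-represents))
    (≡.subst (Pointwise _Represents_ (tabulate θ-operator))
      (≡.trans (≡.sym (List.map-tabulate (lookup xs) (θ𝒟 (2+ n)))) (≡.cong (map (θ𝒟 (2+ n)))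
        (List.tabulate-lookup xs)))
      (Pointwise.tabulate⁺ {f = θ-operator} {θ𝒟 (2+ n) ∘ lookup xs} θ-represents))

-- Homogeneity

insert : ∀ {ℓ d} → Fin ℓ → MultiIndex ℓ d → MultiIndex ℓ (suc d)
insert zero    β      = 1+ β
insert (suc i) (0∷ β) = 0∷ insert i β
insert (suc i) (1+ β) = 1+ insert (suc i) β

module Homogeneity (ℓ : ℕ) where
  open Ring (S ℓ)
  open Solver (S ℓ)
  open Divisibility (S ℓ)
  open ListSums (S ℓ)
  open Presentation ℝ-ring (Fin ℓ) (λ _ _ → ⊥) using (con-+; con-*; con-cong)

  Homogeneous : ℕ → ∣S∣ ℓ → Set
  Homogeneous = HomogeneousOrZero {ℓ} {2}

  variables : ∀ {d} → Vec (Fin ℓ) d → ∣S∣ ℓ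
  variables v = Vec.foldr _ _*_ 1# (Vec.map var v)

  -- The embedding φ is arbitrary because each step under `0∷_` composes it with `suc`.
  variables-insert : ∀ {k d} (φ : Fin k → Fin ℓ) i (β : MultiIndex k d) →
    variables (Vec.map φ (indices (insert i β))) ≈ var (φ i) * variables (Vec.map φ (indices β))
  variables-insert φ zero    β      = ≈-refl
  variables-insert φ (suc i) (0∷ β)
    rewrite ≡.sym (Vec.map-∘ φ suc (indices (insert i β))) | ≡.sym (Vec.map-∘ φ suc (indices β)) =
    variables-insert (φ ∘ suc) i β
  variables-insert φ (suc i) (1+ β) = ≈-trans (*-congˡ (variables-insert φ (suc i) β))
    (*-swapˡ _ _ _)

  monomial-insert : ∀ {d} i (β : MultiIndex ℓ d) → monomial {ℓ} {2} (insert i β) ≈ var i * monomial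
    {ℓ} {2} β
  monomial-insert i β = ≡.subst₂ (λ v w → variables v ≈ var i * variables w)
    (Vec.map-id (indices (insert i β))) (Vec.map-id (indices β)) (variables-insert (λ i → i) i β)

  term : ∀ {d} → (MultiIndex ℓ d → ℝ) → MultiIndex ℓ d → ∣S∣ ℓ
  term c β = con (c β) * monomial {ℓ} {2} β

  homogeneous-cong : ∀ {d f g} → f ≈ g → Homogeneous d f → Homogeneous d g
  homogeneous-cong eq (c , p) = c , ≈-trans (≈-sym eq) p

  homogeneous-+ : ∀ {d f g} → Homogeneous d f → Homogeneous d g → Homogeneous d (f + g)
  homogeneous-+ {d} (a , p) (b , q) = (λ β → a β +ℝ b β) , ≈-trans (+-cong p q)
    (≈-trans (≈-sym (Σ-+ (term a) (term b) (multiIndices ℓ d)))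
      (Σ-cong (multiIndices ℓ d) λ β → ≈-trans (≈-sym (distribʳ _ _ _))
        (*-congʳ (≈-sym (con-+ (a β) (b β))))))

  homogeneous-con* : ∀ {d f} a → Homogeneous d f → Homogeneous d (con a * f)
  homogeneous-con* {d} a (c , p) = (λ β → a *ℝ c β) , ≈-trans (*-congˡ p)
    (≈-trans (≈-sym (Σ-*ˡ (con a) (term c) (multiIndices ℓ d)))
      (Σ-cong (multiIndices ℓ d) λ β → ≈-trans (≈-sym (*-assoc _ _ _))
        (*-congʳ (≈-sym (con-* a (c β))))))

  homogeneous-0 : ∀ {d f} → f ≈ 0# → Homogeneous d f
  homogeneous-0 {d} eq = (λ _ → fromℚ 0ℚ) ,
    ≈-trans eq (≈-sym (Σ-zero (All.universal (λ β → zeroˡ _) (multiIndices ℓ d))))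

  homogeneous-neg : ∀ {d f} → Homogeneous d f → Homogeneous d (- f)
  homogeneous-neg {d} {f} h = homogeneous-cong (≈-trans (*-congʳ minus-one) (lemma f))
    (homogeneous-con* (-ℝ (fromℚ 1ℚ)) h)
    where
    minus-one : con (-ℝ (fromℚ 1ℚ)) ≈ - 1#
    minus-one = ≈-trans (shift _ 1#)
      (≈-trans (+-congʳ (≈-trans (≈-sym (con-+ (-ℝ (fromℚ 1ℚ)) (fromℚ 1ℚ)))
      (con-cong { -ℝ (fromℚ 1ℚ) +ℝ fromℚ 1ℚ} {fromℚ 0ℚ} (CommutativeRing.-‿inverseˡ ℝ-ring
        (fromℚ 1ℚ))))) (+-identityˡ _))
      where
      shift : ∀ a b → a ≈ (a + b) + (- b)
      shift = solve 2 (λ a b → a := (a :+ b) :+ (:- b)) ≈-refl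
    lemma : ∀ f → - 1# * f ≈ - f
    lemma = solve 1 (λ f → :- :1 :* f := :- f) ≈-refl

  homogeneous-Σ : ∀ {d} {A : Set} (f : A → ∣S∣ ℓ) xs → (∀ a → Homogeneous d (f a)) →
    Homogeneous d Σ[ map f xs ]
  homogeneous-Σ f []       h = homogeneous-0 ≈-refl
  homogeneous-Σ f (a ∷ xs) h = homogeneous-+ (h a) (homogeneous-Σ f xs h)

  homogeneous-monomial : ∀ {d} (β : MultiIndex ℓ d) → Homogeneous d (monomial {ℓ} {2} β)
  homogeneous-monomial {d} β = c , ≈-sym (≈-trans
      (Σ-single (multiIndices-unique ℓ d) (multiIndices-complete β) other)
        (≈-trans (*-congʳ same) (*-identityˡ _)))
    where
    c : MultiIndex ℓ d → ℝ
    c γ = if does (γ ≟ᵐ β) then fromℚ 1ℚ else fromℚ 0ℚ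
    same : con (c β) ≈ 1#
    same rewrite dec-true (β ≟ᵐ β) ≡.refl = ≈-refl
    other : ∀ γ → γ ≢ β → con (c γ) * monomial {ℓ} {2} γ ≈ 0#
    other γ γ≢β rewrite dec-false (γ ≟ᵐ β) γ≢β = zeroˡ _

  homogeneous-var* : ∀ {d f} i → Homogeneous d f → Homogeneous (suc d) (var i * f)
  homogeneous-var* {d} i (c , p) = homogeneous-cong
    (≈-sym (≈-trans (*-congˡ p) (≈-trans (≈-sym (Σ-*ˡ (var i) (term c) (multiIndices ℓ d)))
      (Σ-cong (multiIndices ℓ d) λ β → ≈-trans (*-swapˡ (var i) (con (c β)) _)
        (*-congˡ (≈-sym (monomial-insert i β)))))))
    (homogeneous-Σ (λ β → con (c β) * monomial {ℓ} {2} (insert i β)) (multiIndices ℓ d)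
      (λ β → homogeneous-con* (c β) (homogeneous-monomial (insert i β))))

  homogeneous-variables* : ∀ {k d f} (v : Vec (Fin ℓ) k) → Homogeneous d f → Homogeneous (k ℕ.+ d)
    (variables v * f)
  homogeneous-variables* []      h = homogeneous-cong (≈-sym (*-identityˡ _)) h
  homogeneous-variables* (i ∷ v) h = homogeneous-cong (≈-sym (*-assoc _ _ _))
    (homogeneous-var* i (homogeneous-variables* v h))

  homogeneous-* : ∀ {k d f g} → Homogeneous k f → Homogeneous d g → Homogeneous (k ℕ.+ d) (f * g)
  homogeneous-* {k} {d} {f} {g} (c , p) h = homogeneous-cong
    (≈-sym (≈-trans (*-congʳ p) (≈-trans (≈-sym (Σ-*ʳ g (term c) (multiIndices ℓ k)))
      (Σ-cong (multiIndices ℓ k) λ β → *-assoc _ _ _))))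
    (homogeneous-Σ (λ β → con (c β) * (monomial {ℓ} {2} β * g)) (multiIndices ℓ k)
      (λ β → homogeneous-con* (c β) (homogeneous-variables* (indices β) h)))

  homogeneous-con : ∀ a → Homogeneous 0 (con a)
  homogeneous-con a = homogeneous-cong (≈-trans (*-congˡ (monomial-zeros zeros)) (*-identityʳ _))
    (homogeneous-con* a (homogeneous-monomial zeros))
    where
    monomial-zeros : (β : MultiIndex ℓ 0) → monomial {ℓ} {2} β ≈ 1#
    monomial-zeros β = go (indices β)
      where
      go : (v : Vec (Fin ℓ) 0) → variables v ≈ 1#
      go [] = ≈-refl

  homogeneous-var : ∀ i → Homogeneous 1 (var i)
  homogeneous-var i = homogeneous-cong (*-identityʳ _)
    (homogeneous-var* i (homogeneous-con (fromℚ 1ℚ)))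

  homogeneous-^ : ∀ {d f} n → Homogeneous d f → Homogeneous (n ℕ.* d) (f ^ n)
  homogeneous-^ zero    h = homogeneous-con (fromℚ 1ℚ)
  homogeneous-^ (suc n) h = homogeneous-* h (homogeneous-^ n h)

  homogeneous-Π : ∀ {d} {A : Set} (f : A → ∣S∣ ℓ) xs → (∀ a → Homogeneous d (f a)) →
                  Homogeneous (length xs ℕ.* d) Π[ map f xs ]
  homogeneous-Π f []       h = homogeneous-con (fromℚ 1ℚ)
  homogeneous-Π f (a ∷ xs) h = homogeneous-* (h a) (homogeneous-Π f xs h)

  module _ (i : Fin ℓ) where
    private
      module Zero = Division i 0#

    -- Here D f is f minus its value at xᵢ = 0, divided by xᵢ. On a monomial this is either the
    -- monomial divided by xᵢ or 0, of degree one less in both cases.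
    homogeneous-quotient : ∀ {d} (v : Vec (Fin ℓ) (suc d)) → Homogeneous d (Zero.D (variables v))
    homogeneous-quotient {d} (j ∷ v) = homogeneous-+ (first-part (i Fin.≟ j))
      (second-part (j Fin.≟ i) v)
      where
      first-part : ∀ (dec : Dec (i ≡ j)) → Homogeneous d ((if does dec then 1# else 0#) * variables
        v)
      first-part (yes _) = homogeneous-cong (*-congˡ (*-identityʳ _))
        (homogeneous-con* (fromℚ 1ℚ) (≡.subst (λ k → Homogeneous k (variables v * 1#))
          (ℕ.+-identityʳ d)
          (homogeneous-variables* v (homogeneous-con (fromℚ 1ℚ)))))
      first-part (no _)  = homogeneous-0 (zeroˡ _)
      second-part : ∀ {d} → Dec (j ≡ i) → (v : Vec (Fin ℓ) d) → Homogeneous d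
        (Zero.ρ (var j) * Zero.D (variables v))
      second-part _          []      = homogeneous-0 (zeroʳ _)
      second-part (yes ≡.refl) (_ ∷ _) = homogeneous-0 (≈-trans (*-congʳ Zero.ρ-same) (zeroˡ _))
      second-part (no j≢i)   (k ∷ v) = homogeneous-cong (*-congʳ (≈-sym (Zero.ρ-other j≢i)))
        (homogeneous-var* j (homogeneous-quotient (k ∷ v)))

    D-Σ : ∀ {A : Set} (f : A → ∣S∣ ℓ) xs → Zero.D Σ[ map f xs ] ≈ Σ[ map (Zero.D ∘ f) xs ]
    D-Σ f []       = ≈-refl
    D-Σ f (a ∷ xs) = +-congˡ (D-Σ f xs)

    -- D is a left inverse of multiplication by xᵢ, so f is obtained by applying D to each monomial
    -- of xᵢ f.
    homogeneous-cancel-var : ∀ {d f} → Homogeneous (suc d) (var i * f) → Homogeneous d f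
    homogeneous-cancel-var {d} {f} (c , p) = homogeneous-cong
      (≈-sym (≈-trans f≈ (≈-trans (Zero.D-cong p) (≈-trans (D-Σ (term c) (multiIndices ℓ (suc d)))
        (Σ-cong (multiIndices ℓ (suc d)) λ β → ≈-trans (+-congʳ (zeroˡ _)) (+-identityˡ _))))))
      (homogeneous-Σ (λ β → con (c β) * Zero.D (monomial {ℓ} {2} β)) (multiIndices ℓ (suc d))
        (λ β → homogeneous-con* (c β) (homogeneous-quotient (indices β))))
      where
      f≈ : f ≈ Zero.D (var i * f)
      f≈ = ≈-trans (≈-sym (Zero.D-π* ≈-refl ≈-refl f)) (Zero.D-cong (*-congʳ (zero-modulus i)))

  module _ (U : Fin ℓ → Fin ℓ → ∣S∣ ℓ) (isOperatorMatrix : IsOperatorMatrix ℓ U) where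
    open OperatorFromMatrix ℓ
    open Criterion ℓ using (κ; κ-inverse)

    operator-homogeneous : ∀ {d} → (∀ i j → Homogeneous (suc (suc d)) (U i j)) →
                           ∀ α → Homogeneous d (operator U isOperatorMatrix α)
    operator-homogeneous h α = homogeneous-cong
      (≈-trans (≈-sym (*-assoc _ _ _)) (≈-trans (*-congʳ (κ-inverse α)) (*-identityˡ _)))
      (homogeneous-con* (reciprocalFactorial α) (homogeneous-cancel-var (second α)
        (homogeneous-cancel-var (first α)
        (homogeneous-cong (≈-trans (≈-sym (multiplier-operator U isOperatorMatrix α))
          (≈-trans (*-assoc _ _ _) (*-congˡ (*-assoc _ _ _)))) (h (first α) (second α))))))

degreeΛ : ℕ → ℕ × ℕ → ℕ
degreeΛ ℓ (a     , suc b) = 2 ℕ.* a ℕ.+ 2 ℕ.* suc b ℕ.∸ 2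
degreeΛ ℓ (suc a , zero)  = 2 ℕ.* suc a ℕ.∸ 2 ℕ.+ ℓ
degreeΛ ℓ (zero  , zero)  = 2 ℕ.* ℓ ℕ.∸ 2

module BasisDegrees {n : ℕ} {xs : List (ℕ × ℕ)} (enumerates : EnumeratesΛ n xs) where
  open EnumeratesΛ enumerates
  open Ring (S (2+ n))
  open Pairs pairsΛ
  open Basis pairsΛ
  open Homogeneity (2+ n)
  open DivisibleMatrices (S (2+ n)) coordinates pairsΛ using (weight; θ-matrix; η-matrix; Πx; Πx/x; σ)
  open Alternants (S (2+ n)) using (schur; δ)

  private
    T : Fin (2+ n) → Carrier
    T i = var i ^ 2

  homogeneous-≡ : ∀ {d e f} → d ≡ e → Homogeneous d f → Homogeneous e f
  homogeneous-≡ ≡.refl h = h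

  homogeneous-T : ∀ i → Homogeneous 2 (T i)
  homogeneous-T i = homogeneous-^ 2 (homogeneous-var i)

  homogeneous-schur : ∀ a b i j → b ℕ.≤ a → Homogeneous (2 ℕ.* a ℕ.+ 2 ℕ.* b)
    (schur (suc a) b (T i) (T j))
  homogeneous-schur zero    zero    i j _ =
    homogeneous-+ (homogeneous-con (fromℚ 1ℚ)) (homogeneous-0 (zeroʳ (T j)))
  homogeneous-schur (suc a) zero    i j _ = homogeneous-+
    (homogeneous-≡ (≡.trans (ℕ.*-comm (suc a) 2) (≡.sym (ℕ.+-identityʳ _)))
      (homogeneous-^ (suc a) (homogeneous-T i)))
    (homogeneous-≡ (≡.trans (≡.sym (ℕ.+-assoc 2 (2 ℕ.* a) 0))
      (≡.cong (ℕ._+ 0) (≡.sym (ℕ.*-suc 2 a))))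
      (homogeneous-* (homogeneous-T j) (homogeneous-schur a zero i j z≤n)))
  homogeneous-schur (suc a) (suc b) i j (s≤s b≤a) = homogeneous-≡ (arithmetic a b)
    (homogeneous-* (homogeneous-* (homogeneous-T i) (homogeneous-T j))
      (homogeneous-schur a b i j b≤a))
    where
    open ℕ.+-*-Solver using (solve; _:=_; _:+_; _:*_) renaming (con to lit)
    arithmetic : ∀ a b → 2 ℕ.+ 2 ℕ.+ (2 ℕ.* a ℕ.+ 2 ℕ.* b) ≡ 2 ℕ.* suc a ℕ.+ 2 ℕ.* suc b
    arithmetic = solve 2 (λ a b → lit 4 :+ (lit 2 :* a :+ lit 2 :* b)
                               := lit 2 :* (lit 1 :+ a) :+ lit 2 :* (lit 1 :+ b)) ≡.refl

  homogeneous-Πx : Homogeneous (2+ n) Πx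
  homogeneous-Πx = homogeneous-≡ (≡.trans (ℕ.*-identityʳ _) (List.length-tabulate {n = 2+ n}
    (λ i → i)))
    (homogeneous-Π var (allFin (2+ n)) homogeneous-var)

  homogeneous-weighted : ∀ lam i j → proj₂ lam ℕ.≤ proj₁ lam →
    Homogeneous (suc (suc (degreeΛ (2+ n) lam)))
      (weight (suc (proj₁ lam)) (proj₂ lam) * schur (suc (proj₁ lam)) (proj₂ lam) (T i) (T j))
  homogeneous-weighted (a , suc b) i j b≤a = homogeneous-≡ (arithmetic a b)
    (homogeneous-* (homogeneous-con (fromℚ 1ℚ)) (homogeneous-schur a (suc b) i j b≤a))
    where
    arithmetic : ∀ a b → 2 ℕ.* a ℕ.+ 2 ℕ.* suc b ≡ suc (suc (2 ℕ.* a ℕ.+ 2 ℕ.* suc b ℕ.∸ 2))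
    arithmetic a b = ≡.sym
      (ℕ.m+[n∸m]≡n {2} (ℕ.≤-trans (ℕ.m≤m*n 2 (suc b)) (ℕ.m≤n+m (2 ℕ.* suc b) (2 ℕ.* a))))
  homogeneous-weighted (suc a , zero) i j b≤a = homogeneous-≡ (arithmetic a)
    (homogeneous-* homogeneous-Πx (homogeneous-schur (suc a) zero i j b≤a))
    where
    arithmetic : ∀ a → 2+ n ℕ.+ (2 ℕ.* suc a ℕ.+ 0) ≡ suc (suc (2 ℕ.* suc a ℕ.∸ 2 ℕ.+ 2+ n))
    arithmetic a = ≡.trans (ℕ.+-comm (2+ n) (2 ℕ.* suc a ℕ.+ 0)) (≡.cong (ℕ._+ 2+ n)
      (≡.trans (ℕ.+-identityʳ _) (≡.sym (ℕ.m+[n∸m]≡n {2} (ℕ.m≤m*n 2 (suc a))))))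
  homogeneous-weighted (zero , zero) i j b≤a = homogeneous-≡ arithmetic
    (homogeneous-* (homogeneous-^ 2 homogeneous-Πx) (homogeneous-schur zero zero i j b≤a))
    where
    arithmetic : 2 ℕ.* 2+ n ℕ.+ 0 ≡ suc (suc (2 ℕ.* 2+ n ℕ.∸ 2))
    arithmetic = ≡.trans (ℕ.+-identityʳ _) (≡.sym (ℕ.m+[n∸m]≡n {2} (ℕ.m≤m*n 2 (2+ n))))

  θ-homogeneous : ∀ k α → Homogeneous (degreeΛ (2+ n) (lookup xs k)) (θ-operator k α)
  θ-homogeneous k = operator-homogeneous (θ-matrix k) (θ-isOperatorMatrix k) λ i j →
    homogeneous-cong (reflexive (≡.sym (≡.cong₂ (λ p q → weight p q * schur p q (T i) (T j))
      (toℕ-hi k) (toℕ-lo k))))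
      (homogeneous-weighted (lookup xs k) i j (proj₂ (range k)))

  homogeneous-cofactor : ∀ {d} (f : Fin (2+ n) → Carrier) k → (∀ i → Homogeneous d (f i)) →
    Homogeneous (suc n ℕ.* d) Π[ GenericPoints.cofactor (coordinates {2+ n}) f k ]
  homogeneous-cofactor {d} f k h = homogeneous-≡
    (≡.cong (ℕ._* d) (ℕ.suc-injective (≡.trans
      (≡.sym (Cofactors.length-without (S (2+ n)) var (Unique.allFin⁺ (2+ n)) (∈-allFin k)))
      (List.length-tabulate {n = 2+ n} (λ i → i)))))
    (homogeneous-Π f (filter (λ i → ¬? (i Fin.≟ k)) (allFin (2+ n))) h)

  homogeneous-δ : ∀ {m} (i j : Fin m) → Homogeneous 0 (δ i j)
  homogeneous-δ i j with does (i Fin.≟ j)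
  ... | true  = homogeneous-con (fromℚ 1ℚ)
  ... | false = homogeneous-con (fromℚ 0ℚ)

  η-matrix-homogeneous : ∀ k i j → Homogeneous (suc (suc n ℕ.* 2)) (η-matrix k i j)
  η-matrix-homogeneous k i j = homogeneous-+
    (homogeneous-* (homogeneous-* (homogeneous-δ k i) (homogeneous-δ k j))
      (homogeneous-* (homogeneous-var k) (homogeneous-cofactor (factor (2+ n) k) k λ b →
        homogeneous-+ (homogeneous-T k) (homogeneous-neg (homogeneous-T b)))))
    (homogeneous-neg (homogeneous-* (homogeneous-≡ (ℕ.*-zeroʳ (suc n))
        (homogeneous-^ (suc n) (homogeneous-neg (homogeneous-con (fromℚ 1ℚ)))))
      (homogeneous-≡ (≡.cong suc (arithmetic n))
        (homogeneous-* (homogeneous-var k)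
          (homogeneous-^ 2 (homogeneous-cofactor var k homogeneous-var))))))
    where
    arithmetic : ∀ n → 2 ℕ.* (suc n ℕ.* 1) ≡ suc n ℕ.* 2
    arithmetic n = ≡.trans (≡.cong (2 ℕ.*_) (ℕ.*-identityʳ (suc n))) (ℕ.*-comm 2 (suc n))

  -- The matrix entries have degree 1 + 2 (ℓ - 1), and the passage to coefficients divides by two
  -- variables.
  η-homogeneous : ∀ k α → Homogeneous (2 ℕ.* 2+ n ℕ.∸ 3) (η-operator k α)
  η-homogeneous k = operator-homogeneous (η-matrix k) (η-isOperatorMatrix k) λ i j →
    homogeneous-≡ (arithmetic n) (η-matrix-homogeneous k i j)
    where
    arithmetic : ∀ n → suc (suc n ℕ.* 2) ≡ suc (suc (2 ℕ.* 2+ n ℕ.∸ 3))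
    arithmetic n = ≡.trans (≡.cong (λ m → suc (suc (suc m))) (ℕ.*-comm n 2))
      (≡.cong (λ m → suc (suc (m ℕ.∸ 3)))
        (≡.sym (≡.trans (ℕ.*-suc 2 (suc n)) (≡.cong (2 ℕ.+_) (ℕ.*-suc 2 n)))))

-- Uniqueness of the exponents

module Naturals (R : CRing) where
  open Ring R
  open Solver R

  nat : ℕ → Carrier
  nat zero    = 0#
  nat (suc n) = 1# + nat n

  nat-+ : ∀ m n → nat (m ℕ.+ n) ≈ nat m + nat n
  nat-+ zero    n = ≈-sym (+-identityˡ _)
  nat-+ (suc m) n = ≈-trans (+-congˡ (nat-+ m n)) (≈-sym (+-assoc _ _ _))

  indicator : ∀ {A : Set} → Dec A → Carrier
  indicator d = if does d then 1# else 0#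

  PositiveInvertible Nontrivial : Set
  PositiveInvertible = ∀ n → ∃ λ r → r * nat (suc n) ≈ 1#
  Nontrivial = ¬ 1# ≈ 0#

  module CharacteristicZero (nat-inverse : PositiveInvertible) (1≉0 : Nontrivial) where

    positive-cancel : ∀ n {p} → nat (suc n) * p ≈ 0# → p ≈ 0#
    positive-cancel n {p} eq = let r , r-inverse = nat-inverse n in
      ≈-trans (≈-sym (*-identityˡ p)) (≈-trans (*-congʳ (≈-sym r-inverse))
        (≈-trans (*-assoc r (nat (suc n)) p) (≈-trans (*-congˡ eq) (zeroʳ r))))

    nat-cancel-< : ∀ {a b p} → a ℕ.< b → nat a * p ≈ nat b * p → p ≈ 0#
    nat-cancel-< {a} {p = p} a<b eq with ℕ.m≤n⇒∃[o]m+o≡n a<b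
    ... | k , ≡.refl = positive-cancel k (≈-trans (lemma (nat a) (nat (suc k)) p)
      (≈-trans (+-congʳ (≈-trans (*-congʳ (≈-sym suc-+)) (≈-sym eq))) (-‿inverseʳ _)))
      where
      lemma : ∀ a b p → b * p ≈ (a + b) * p - a * p
      lemma = solve 3 (λ a b p → b :* p := (a :+ b) :* p :- a :* p) ≈-refl
      suc-+ : nat (suc a ℕ.+ k) ≈ nat a + nat (suc k)
      suc-+ = ≡.subst (λ m → nat m ≈ nat a + nat (suc k)) (ℕ.+-suc a k) (nat-+ a (suc k))

    nat-cancel : ∀ {a b p} → a ≢ b → nat a * p ≈ nat b * p → p ≈ 0#
    nat-cancel {a} {b} a≢b eq with ℕ.<-cmp a b
    ... | tri< a<b _ _ = nat-cancel-< a<b eq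
    ... | tri≈ _ a≡b _ = ⊥-elim (a≢b a≡b)
    ... | tri> _ _ b<a = nat-cancel-< b<a (≈-sym eq)

    nat-injective : ∀ {a b} → nat a ≈ nat b → a ≡ b
    nat-injective {a} {b} eq with a ℕ.≟ b
    ... | yes a≡b = a≡b
    ... | no a≢b  = ⊥-elim (1≉0 (nat-cancel a≢b (*-congʳ eq)))

count : ℕ → List ℕ → ℕ
count e []       = 0
count e (d ∷ ds) = if does (d ℕ.≟ e) then suc (count e ds) else count e ds

count-++ : ∀ e xs ys → count e (xs ++ ys) ≡ count e xs ℕ.+ count e ys
count-++ e []       ys = ≡.refl
count-++ e (x ∷ xs) ys with does (x ℕ.≟ e)
... | true  = ≡.cong suc (count-++ e xs ys)
... | false = count-++ e xs ys

count-same : ∀ e xs → count e (e ∷ xs) ≡ suc (count e xs)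
count-same e xs rewrite dec-true (e ℕ.≟ e) ≡.refl = ≡.refl

count-∷ : ∀ e d xs → count e (d ∷ xs) ≡ count e (d ∷ []) ℕ.+ count e xs
count-∷ e d xs = count-++ e (d ∷ []) xs

count-∈ : ∀ e xs → 0 ℕ.< count e xs → e ∈ xs
count-∈ e (d ∷ xs) h with d ℕ.≟ e
... | yes ≡.refl = here ≡.refl
... | no d≢e rewrite dec-false (d ℕ.≟ e) d≢e = there (count-∈ e xs h)

counts⇒↭ : ∀ xs ys → (∀ e → count e xs ≡ count e ys) → xs ↭ ys
counts⇒↭ []       []       h = Perm.↭-refl
counts⇒↭ []       (y ∷ ys) h = ⊥-elim (ℕ.0≢1+n (≡.trans (h y) (count-same y ys)))
counts⇒↭ (x ∷ xs) ys       h =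
  from (∈-∃++ (count-∈ x ys (≡.subst (0 ℕ.<_) (≡.trans (≡.sym (count-same x xs)) (h x)) (s≤s z≤n))))
  where
  from : (∃ λ as → ∃ λ bs → ys ≡ as ++ x ∷ bs) → x ∷ xs ↭ ys
  from (as , bs , ≡.refl) = Perm.↭-trans (Perm.prep x (counts⇒↭ xs (as ++ bs) rest))
    (Perm.↭-sym (Perm.shift x as bs))
    where
    rest : ∀ e → count e xs ≡ count e (as ++ bs)
    rest e = ℕ.+-cancelˡ-≡ (count e (x ∷ [])) _ _ (≡.trans (≡.sym (count-∷ e x xs))
      (≡.trans (h e) (begin
      count e (as ++ x ∷ bs)                              ≡⟨ count-++ e as (x ∷ bs) ⟩
      count e as ℕ.+ count e (x ∷ bs)                     ≡⟨ ≡.cong (count e as ℕ.+_)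
        (count-∷ e x bs) ⟩
      count e as ℕ.+ (count e (x ∷ []) ℕ.+ count e bs)    ≡⟨ ℕ.+-assoc (count e as) _ _ ⟨
      count e as ℕ.+ count e (x ∷ []) ℕ.+ count e bs      ≡⟨ ≡.cong (ℕ._+ count e bs)
        (ℕ.+-comm (count e as) _) ⟩
      count e (x ∷ []) ℕ.+ count e as ℕ.+ count e bs      ≡⟨ ℕ.+-assoc (count e (x ∷ [])) _ _ ⟩
      count e (x ∷ []) ℕ.+ (count e as ℕ.+ count e bs)    ≡⟨ ≡.cong (count e (x ∷ []) ℕ.+_)
        (count-++ e as bs) ⟨
      count e (x ∷ []) ℕ.+ count e (as ++ bs)             ∎)))
      where open ≡.≡-Reasoning

module Trace (R : CRing) where
  open Ring R
  open Solver R
  open Sums R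
  open Naturals R

  sum-indicator : ∀ {n} (d : Fin n → ℕ) e → sum (λ i → indicator (d i ℕ.≟ e)) ≈ nat
    (count e (tabulate d))
  sum-indicator {zero}  d e = ≈-refl
  sum-indicator {suc n} d e with does (d zero ℕ.≟ e)
  ... | true  = +-congˡ (sum-indicator (d ∘ suc) e)
  ... | false = ≈-trans (+-identityˡ _) (sum-indicator (d ∘ suc) e)

  -- Both sides are the trace of the blocks of degree e of the products pq and qp.
  graded-trace : ∀ {m n} (d : Fin m → ℕ) (d′ : Fin n → ℕ)
    (p : Fin m → Fin n → Carrier) (q : Fin n → Fin m → Carrier) →
    (∀ i → sum (λ j → p i j * q j i) ≈ 1#) → (∀ j → sum (λ i → p i j * q j i) ≈ 1#) →
    (∀ i j → d i ≢ d′ j → p i j ≈ 0#) →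
    ∀ e → nat (count e (tabulate d)) ≈ nat (count e (tabulate d′))
  graded-trace {m} {n} d d′ p q pq qp graded e = begin
    nat (count e (tabulate d))
      ≈⟨ sum-indicator d e ⟨
    sum (λ i → δ i)
      ≈⟨ sum-cong δ (λ i → sum (λ j → δ i * (p i j * q j i)))
           (λ i → ≈-trans (≈-sym (*-identityʳ (δ i)))
           (≈-trans (*-congˡ (≈-sym (pq i))) (*-sumˡ (δ i) (λ j → p i j * q j i)))) ⟩
    sum (λ i → sum (λ j → δ i * (p i j * q j i)))
      ≈⟨ sum-swap (λ i j → δ i * (p i j * q j i)) ⟩
    sum (λ j → sum (λ i → δ i * (p i j * q j i)))
      ≈⟨ sum-cong _ δ′ (λ j → ≈-trans
           (sum-cong (λ i → δ i * (p i j * q j i)) (λ i → δ′ j * (p i j * q j i)) (λ i → same i j))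
           (≈-trans (≈-sym (*-sumˡ (δ′ j) (λ i → p i j * q j i))) (≈-trans (*-congˡ (qp j))
             (*-identityʳ (δ′ j))))) ⟩
    sum (λ j → δ′ j)
      ≈⟨ sum-indicator d′ e ⟩
    nat (count e (tabulate d′)) ∎
    where
    open SetoidReasoning setoid
    δ : Fin m → Carrier
    δ i = indicator (d i ℕ.≟ e)
    δ′ : Fin n → Carrier
    δ′ j = indicator (d′ j ℕ.≟ e)
    same : ∀ i j → δ i * (p i j * q j i) ≈ δ′ j * (p i j * q j i)
    same i j with d i ℕ.≟ d′ j
    ... | yes eq = reflexive (≡.cong (λ k → indicator (k ℕ.≟ e) * (p i j * q j i)) eq)
    ... | no neq = ≈-trans (vanish (δ i)) (≈-sym (vanish (δ′ j)))
      where
      vanish : ∀ c → c * (p i j * q j i) ≈ 0#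
      vanish c = ≈-trans (*-congˡ (≈-trans (*-congʳ (graded i j neq)) (zeroˡ _))) (zeroʳ c)

module RealNaturals where
  open Ring ℝ-ring
  open Solver ℝ-ring
  open Naturals ℝ-ring

  natℚ : ℕ → ℚ.ℚ
  natℚ zero    = 0ℚ
  natℚ (suc n) = 1ℚ ℚ.+ natℚ n

  natℚ-nonneg : ∀ n → 0ℚ ℚ.≤ natℚ n
  natℚ-nonneg zero    = ℚ.≤-refl
  natℚ-nonneg (suc n) = ≡.subst (ℚ._≤ natℚ (suc n)) (ℚ.+-identityˡ 0ℚ)
    (ℚ.+-mono-≤ (ℚ.<⇒≤ (ℚ.positive⁻¹ 1ℚ)) (natℚ-nonneg n))

  natℚ-pos : ∀ n → 0ℚ ℚ.< natℚ (suc n)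
  natℚ-pos n = ≡.subst (ℚ._< natℚ (suc n)) (ℚ.+-identityˡ 0ℚ)
    (ℚ.+-mono-<-≤ (ℚ.positive⁻¹ 1ℚ) (natℚ-nonneg n))

  fromℚ-cong : ∀ {p q} → p ≡ q → fromℚ p ≈ fromℚ q
  fromℚ-cong {p} ≡.refl = cauchy (fromℚ p)

  nat≈fromℚ : ∀ n → nat n ≈ fromℚ (natℚ n)
  nat≈fromℚ zero    = cauchy (fromℚ 0ℚ)
  nat≈fromℚ (suc n) = +-cong {1#} {1#} {nat n} {fromℚ (natℚ n)} (cauchy (fromℚ 1ℚ)) (nat≈fromℚ n)

  nat-inverse : ∀ n → ∃ λ r → r * nat (suc n) ≈ 1#
  nat-inverse n = fromℚ (ℚ.1/ natℚ (suc n)) ,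
    ≈-trans {i} {fromℚ (ℚ.1/ natℚ (suc n)) * fromℚ (natℚ (suc n))} {1#}
      (*-congˡ {fromℚ (ℚ.1/ natℚ (suc n))} {nat (suc n)} {fromℚ (natℚ (suc n))} (nat≈fromℚ (suc n)))
      (fromℚ-cong (ℚ.*-inverseˡ (natℚ (suc n))))
    where
    instance
      _ = ℚ.positive (natℚ-pos n)
      _ = ℚ.pos⇒nonZero (natℚ (suc n))
    i : ℝ
    i = fromℚ (ℚ.1/ natℚ (suc n)) * nat (suc n)

  1≉0 : ¬ 1# ≈ 0#
  1≉0 eq = let N , h = eq (ℚ.positive⁻¹ ℚ.½) in
    ℚ.<-irrefl ≡.refl (ℚ.≤-<-trans (toWitness {a? = ℚ.½ ℚ.≤? ℚ.∣ 1ℚ ℚ.- 0ℚ ∣} _)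
      (h {N} {N} ℕ.≤-refl ℕ.≤-refl))

  open CharacteristicZero nat-inverse 1≉0 public

-- Euler's formula and the comparison of two homogeneous bases

module Euler (ℓ : ℕ) where
  open Ring (S ℓ)
  open Solver (S ℓ)
  open ListSums (S ℓ)
  open Naturals (S ℓ)
  open Derivations ℓ
  open Homogeneity ℓ using (Homogeneous; variables; term)

  open Derivation var public using () renaming (D to euler; D-cong to euler-cong)

  euler-variables : ∀ {d} (v : Vec (Fin ℓ) d) → euler (variables v) ≈ nat d * variables v
  euler-variables []      = ≈-sym (zeroˡ 1#)
  euler-variables {suc d} (i ∷ v) = ≈-trans (+-congˡ (*-congˡ (euler-variables v)))
    (lemma (var i) (variables v) (nat d))
    where
    lemma : ∀ x y n → x * y + x * (n * y) ≈ (1# + n) * (x * y)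
    lemma = solve 3 (λ x y n → x :* y :+ x :* (n :* y) := (:1 :+ n) :* (x :* y)) ≈-refl

  euler-Σ : ∀ {A : Set} (f : A → ∣S∣ ℓ) xs → euler Σ[ map f xs ] ≡ Σ[ map (euler ∘ f) xs ]
  euler-Σ f []       = ≡.refl
  euler-Σ f (a ∷ xs) = ≡.cong (euler (f a) +_) (euler-Σ f xs)

  euler-sum : ∀ {n} (f : Fin n → ∣S∣ ℓ) → euler (sum f) ≡ sum (euler ∘ f)
  euler-sum {zero}  f = ≡.refl
  euler-sum {suc n} f = ≡.cong (euler (f zero) +_) (euler-sum (f ∘ suc))

  euler-homogeneous : ∀ {d f} → Homogeneous d f → euler f ≈ nat d * f
  euler-homogeneous {d} (c , p) = ≈-trans (euler-cong p)
    (≈-trans (reflexive (euler-Σ (term c) (multiIndices ℓ d)))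
    (≈-trans (Σ-cong (multiIndices ℓ d) λ β →
      ≈-trans (+-congˡ (*-congˡ (euler-variables (indices β))))
        (lemma (con (c β)) (variables (indices β)) (nat d)))
    (≈-trans (Σ-*ˡ (nat d) (term c) (multiIndices ℓ d)) (*-congˡ (≈-sym p)))))
    where
    lemma : ∀ c m n → 0# * m + c * (n * m) ≈ n * (c * m)
    lemma = solve 3 (λ c m n → :0 :* m :+ c :* (n :* m) := n :* (c :* m)) ≈-refl

module AtZero (ℓ : ℕ) (B : CRing) {f : ℝ → CommutativeRing.Carrier B}
              (hom : IsSemiringHomomorphism ℝ-ring B f) where
  open Ring B
  open IsSemiringHomomorphism hom
  open Naturals B
  private module S = Ring (S ℓ)

  at0 : ∣S∣ ℓ → Carrier
  at0 = evaluate B f (λ _ → 0#)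

  at0-cong : ∀ {p q} → p S.≈ q → at0 p ≈ at0 q
  at0-cong = Evaluation.evaluate-cong hom {ρ = λ _ → 0#} (λ ())

  at0-nat : ∀ n → at0 (Naturals.nat (S ℓ) n) ≈ nat n
  at0-nat zero    = homo-0
  at0-nat (suc n) = +-cong homo-1 (at0-nat n)

  at0-sum : ∀ {n} (f : Fin n → ∣S∣ ℓ) → at0 (S.sum f) ≈ sum (at0 ∘ f)
  at0-sum {zero}  f = homo-0
  at0-sum {suc n} f = +-congˡ (at0-sum (f ∘ suc))

  -- Each variable is sent to itself by the Euler derivation, so every summand of the result keeps a
  -- factor that vanishes at 0.
  at0-euler : ∀ p → at0 (Euler.euler ℓ p) ≈ 0#
  at0-euler (con a) = homo-0
  at0-euler (var i) = ≈-refl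
  at0-euler (p ⊕ q) = ≈-trans (+-cong (at0-euler p) (at0-euler q)) (+-identityʳ 0#)
  at0-euler (p ⊗ q) = ≈-trans (+-cong (≈-trans (*-congʳ (at0-euler p)) (zeroˡ _))
                                      (≈-trans (*-congˡ (at0-euler q)) (zeroʳ _))) (+-identityʳ 0#)
  at0-euler (⊝ p)   = ≈-trans (-‿cong (at0-euler p)) (RingProperties.-0#≈0# ring)

module HomogeneousBases {ℓ : ℕ} (M : Operator ℓ 2 (∣S∣ ℓ) → Set) where
  open Ring (S ℓ)
  open Solver (S ℓ)
  open Sums (S ℓ)
  open Naturals (S ℓ)
  open Euler ℓ
  open Alternants (S ℓ) using (δ; δ-≡; δ-≢)
  open Homogeneity ℓ using (Homogeneous)
  open IsBasis
  open SetoidReasoning setoid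

  member : ∀ {B : List (Operator ℓ 2 (∣S∣ ℓ))} → IsBasis M B → ∀ i → M (lookup B i)
  member {B} isBasis i = All.lookup (belongs isBasis) (∈-lookup {xs = B} i)

  combination-δ : ∀ (B : List (Operator ℓ 2 (∣S∣ ℓ))) k α → combination B (δ k) α ≈ lookup B k α
  combination-δ B k α = ≈-trans (sum-single k (λ i → δ k i * lookup B i α)
      (λ i i≢k → ≈-trans (*-congʳ (δ-≢ (i≢k ∘ ≡.sym))) (zeroˡ _)))
    (≈-trans (*-congʳ (δ-≡ {i = k} ≡.refl)) (*-identityˡ _))

  -- A zero member would satisfy the relation with coefficient 1 at k. Homogeneous operators are
  -- nonzero by definition, so this has to be supplied.
  nonzero : ¬ 1# ≈ 0# → ∀ {B : List (Operator ℓ 2 (∣S∣ ℓ))} → IsBasis M B → ∀ k →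
    ¬ (∀ α → lookup B k α ≈ 0#)
  nonzero 1≉0 {B} isBasis k h = 1≉0 (≈-trans (≈-sym (δ-≡ {i = k} ≡.refl))
    (independent isBasis (δ k) (λ α → ≈-trans (combination-δ B k α) (h α)) k))

  combination-- : ∀ (B : List (Operator ℓ 2 (∣S∣ ℓ))) c d α → combination B (λ i → c i - d i)
    α ≈ combination B c α - combination B d α
  combination-- B c d α = ≈-trans (sum-cong (λ i → (c i - d i) * lookup B i α)
      (λ i → c i * lookup B i α - d i * lookup B i α) (λ i → lemma (c i) (d i) (lookup B i α)))
    (sum-- (λ i → c i * lookup B i α) (λ i → d i * lookup B i α))
    where
    lemma : ∀ a b x → (a - b) * x ≈ a * x - b * x
    lemma = solve 3 (λ a b x → (a :- b) :* x := a :* x :- b :* x) ≈-refl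

  combination-unique : ∀ {B : List (Operator ℓ 2 (∣S∣ ℓ))} → IsBasis M B → ∀ c d →
    (∀ α → combination B c α ≈ combination B d α) → ∀ i → c i ≈ d i
  combination-unique {B} isBasis c d h i = move (independent isBasis (λ i → c i - d i)
    (λ α → ≈-trans (combination-- B c d α) (≈-trans (+-congʳ (h α)) (-‿inverseʳ _))) i)
    where
    move : ∀ {a b} → a - b ≈ 0# → a ≈ b
    move {a} {b} eq = ≈-trans (lemma a b) (≈-trans (+-congʳ eq) (+-identityˡ b))
      where
      lemma : ∀ a b → a ≈ (a - b) + b
      lemma = solve 2 (λ a b → a := (a :- b) :+ b) ≈-refl

  combination-combination : ∀ (B : List (Operator ℓ 2 (∣S∣ ℓ))) {n} (c : Fin n → ∣S∣ ℓ) (p : Fin n →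
    Fin (length B) → ∣S∣ ℓ) α →
    combination B (λ i → sum (λ j → c j * p j i)) α ≈ sum (λ j → c j * combination B (p j) α)
  combination-combination B c p α = begin
    combination B (λ i → sum (λ j → c j * p j i)) α
      ≈⟨ sum-cong _ (λ i → sum (λ j → c j * (p j i * lookup B i α))) (λ i → ≈-trans
           (*-sumʳ (lookup B i α) (λ j → c j * p j i))
           (sum-cong (λ j → c j * p j i * lookup B i α) (λ j → c j * (p j i * lookup B i α))
             (λ j → *-assoc _ _ _))) ⟩
    sum (λ i → sum (λ j → c j * (p j i * lookup B i α)))
      ≈⟨ sum-swap (λ i j → c j * (p j i * lookup B i α)) ⟩
    sum (λ j → sum (λ i → c j * (p j i * lookup B i α)))
      ≈⟨ sum-cong _ (λ j → c j * combination B (p j) α)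
           (λ j → ≈-sym (*-sumˡ (c j) (λ i → p j i * lookup B i α))) ⟩
    sum (λ j → c j * combination B (p j) α) ∎

  module _ {B B′ : List (Operator ℓ 2 (∣S∣ ℓ))} (isBasis : IsBasis M B)
           (p : Fin (length B′) → Fin (length B) → ∣S∣ ℓ)
           (p-spec : ∀ j α → lookup B′ j α ≈ combination B (p j) α) where

    inverse-coordinates : (q : Fin (length B) → Fin (length B′) → ∣S∣ ℓ) →
      (∀ i α → lookup B i α ≈ combination B′ (q i) α) →
      ∀ k i → sum (λ j → q k j * p j i) ≈ δ k i
    inverse-coordinates q q-spec k = combination-unique isBasis (λ i → sum (λ j → q k j * p j i))
      (δ k) λ α → begin
      combination B (λ i → sum (λ j → q k j * p j i)) α
        ≈⟨ combination-combination B (q k) p α ⟩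
      sum (λ j → q k j * combination B (p j) α)
        ≈⟨ sum-cong (λ j → q k j * combination B (p j) α) (λ j → q k j * lookup B′ j α)
             (λ j → *-congˡ (≈-sym (p-spec j α))) ⟩
      combination B′ (q k) α
        ≈⟨ q-spec k α ⟨
      lookup B k α
        ≈⟨ combination-δ B k α ⟨
      combination B (δ k) α ∎

    module _ (d : Fin (length B) → ℕ) (d′ : Fin (length B′) → ℕ)
             (homogeneous : ∀ i α → Homogeneous (d i) (lookup B i α))
             (homogeneous′ : ∀ j α → Homogeneous (d′ j) (lookup B′ j α)) where

      -- Apply the Euler derivation to the expansion of a member of B′ in B. Both bases consist of
      -- eigenvectors, and coordinates are unique.
      euler-coordinates : ∀ j i → euler (p j i) + p j i * nat (d i) ≈ nat (d′ j) * p j i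
      euler-coordinates j = combination-unique isBasis (λ i → euler (p j i) + p j i * nat (d i))
        (λ i → nat (d′ j) * p j i) λ α → begin
        combination B (λ i → euler (p j i) + p j i * nat (d i)) α
          ≈⟨ sum-cong _ (λ i → euler (p j i * lookup B i α)) (λ i → ≈-trans
               (lemma (euler (p j i)) (p j i) (nat (d i)) (lookup B i α))
               (+-congˡ (*-congˡ (≈-sym (euler-homogeneous (homogeneous i α)))))) ⟩
        sum (λ i → euler (p j i * lookup B i α))
          ≡⟨ euler-sum (λ i → p j i * lookup B i α) ⟨
        euler (combination B (p j) α)
          ≈⟨ euler-cong (p-spec j α) ⟨
        euler (lookup B′ j α)
          ≈⟨ euler-homogeneous (homogeneous′ j α) ⟩
        nat (d′ j) * lookup B′ j α
          ≈⟨ *-congˡ (p-spec j α) ⟩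
        nat (d′ j) * combination B (p j) α
          ≈⟨ ≈-trans (*-sumˡ (nat (d′ j)) (λ i → p j i * lookup B i α))
               (sum-cong (λ i → nat (d′ j) * (p j i * lookup B i α))
                 (λ i → nat (d′ j) * p j i * lookup B i α) (λ i → ≈-sym (*-assoc _ _ _))) ⟩
        combination B (λ i → nat (d′ j) * p j i) α ∎
        where
        lemma : ∀ e p n b → (e + p * n) * b ≈ e * b + p * (n * b)
        lemma = solve 4 (λ e p n b → (e :+ p :* n) :* b := e :* b :+ p :* (n :* b)) ≈-refl

module UniqueDegrees {ℓ : ℕ} (M : Operator ℓ 2 (∣S∣ ℓ) → Set) (A : CRing)
    {f : ℝ → CommutativeRing.Carrier A} (hom : IsSemiringHomomorphism ℝ-ring A f)
    (nat-inverse : Naturals.PositiveInvertible A) (1≉0 : Naturals.Nontrivial A) where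
  open Ring A
  open Sums A
  open Naturals A
  open CharacteristicZero nat-inverse 1≉0
  open AtZero ℓ A hom
  open HomogeneousBases {ℓ} M
  open IsSemiringHomomorphism hom
  open Homogeneity ℓ using (Homogeneous)
  private module S = Ring (S ℓ)

  1≉0ˢ : ¬ S.1# S.≈ S.0#
  1≉0ˢ eq = 1≉0 (≈-trans (≈-sym homo-1) (≈-trans (at0-cong {S.1#} {S.0#} eq) homo-0))

  module _ {B B′ : List (Operator ℓ 2 (∣S∣ ℓ))} (isBasis : IsBasis M B) (isBasis′ : IsBasis M B′)
           (d : Fin (length B) → ℕ) (d′ : Fin (length B′) → ℕ)
           (homogeneous : ∀ i α → Homogeneous (d i) (lookup B i α))
           (homogeneous′ : ∀ j α → Homogeneous (d′ j) (lookup B′ j α)) where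
    private
      P : ∀ j → ∃ λ c → ∀ α → lookup B′ j α S.≈ combination B c α
      P j = IsBasis.spans isBasis (lookup B′ j) (member isBasis′ j)

      Q : ∀ i → ∃ λ c → ∀ α → lookup B i α S.≈ combination B′ c α
      Q i = IsBasis.spans isBasis′ (lookup B i) (member isBasis i)

      p : Fin (length B′) → Fin (length B) → ∣S∣ ℓ
      p j = proj₁ (P j)

      q : Fin (length B) → Fin (length B′) → ∣S∣ ℓ
      q i = proj₁ (Q i)

      at0-δ : ∀ {n} (i : Fin n) → at0 (Alternants.δ (S ℓ) i i) ≈ 1#
      at0-δ i = ≈-trans (at0-cong (Alternants.δ-≡ (S ℓ) {i = i} ≡.refl)) homo-1

      pq : ∀ i → sum (λ j → at0 (p j i) * at0 (q i j)) ≈ 1#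
      pq i = ≈-trans (sum-cong (λ j → at0 (p j i) * at0 (q i j)) (λ j → at0 (q i j) * at0 (p j i))
        (λ j → *-comm _ _))
        (≈-trans (≈-sym (at0-sum (λ j → q i j S.* p j i)))
        (≈-trans (at0-cong (inverse-coordinates {B} {B′} isBasis p (λ j → proj₂ (P j)) q
          (λ i → proj₂ (Q i)) i i)) (at0-δ i)))

      qp : ∀ j → sum (λ i → at0 (p j i) * at0 (q i j)) ≈ 1#
      qp j = ≈-trans (≈-sym (at0-sum (λ i → p j i S.* q i j)))
        (≈-trans (at0-cong (inverse-coordinates {B′} {B} isBasis′ q (λ i → proj₂ (Q i)) p
          (λ j → proj₂ (P j)) j j)) (at0-δ j))

      -- At 0 the Euler term of `euler-coordinates` drops out, leaving d i p = d′ j p; distinct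
      -- naturals differ by an invertible element.
      graded : ∀ i j → d i ≢ d′ j → at0 (p j i) ≈ 0#
      graded i j neq = nat-cancel neq
        (≈-trans (*-comm _ _)
          (≈-trans (≈-sym (≈-trans (+-cong (at0-euler (p j i)) (*-congˡ (at0-nat (d i))))
            (+-identityˡ _)))
        (≈-trans (at0-cong (euler-coordinates {B} {B′} isBasis p (λ j → proj₂ (P j)) d d′
          homogeneous homogeneous′ j i))
          (*-congʳ (at0-nat (d′ j))))))

    degrees-↭ : tabulate d′ ↭ tabulate d
    degrees-↭ = counts⇒↭ (tabulate d′) (tabulate d) λ e → nat-injective (≈-sym
      (Trace.graded-trace A d d′ (λ i j → at0 (p j i)) (λ j i → at0 (q i j)) pq qp graded e))

-- Two enumerations of Λ and the exponents

Λ-enumerates : ∀ n → EnumeratesΛ n (Λ (2+ n))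
Λ-enumerates n = record
  { inRange = All.all-filter (λ (a , b) → (a ℕ.≤? n) ×-dec (b ℕ.≤? a))
    (cartesianProduct (upTo (2+ n)) (upTo (2+ n)))
  ; unique = Unique.filter⁺ (λ (a , b) → (a ℕ.≤? n) ×-dec (b ℕ.≤? a))
      (Unique.cartesianProduct⁺ (Unique.upTo⁺ (2+ n)) (Unique.upTo⁺ (2+ n)))
  ; complete = λ {a} {b} a≤n b≤a → ∈-filter⁺ (λ (a , b) → (a ℕ.≤? n) ×-dec (b ℕ.≤? a))
      (∈-cartesianProduct⁺ (∈-upTo⁺ (s≤s (ℕ.m≤n⇒m≤1+n a≤n)))
        (∈-upTo⁺ (s≤s (ℕ.m≤n⇒m≤1+n (ℕ.≤-trans b≤a a≤n)))))
      (a≤n , b≤a)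
  }

-- Λ in the order in which its elements contribute to exponents𝒟.
Λ₊ Λ₀ Λ′ : ℕ → List (ℕ × ℕ)
Λ₊ n = filter (λ (_ , b) → 1 ℕ.≤? b) (Λ (2+ n))
Λ₀ n = map (_, 0) (filter (λ a → (1 ℕ.≤? a) ×-dec (a ℕ.≤? n)) (upTo (2+ n)))
Λ′ n = Λ₊ n ++ Λ₀ n ++ [ (0 , 0) ]

module _ (n : ℕ) where
  private
    module E = EnumeratesΛ (Λ-enumerates n)

    rows : List ℕ
    rows = filter (λ a → (1 ℕ.≤? a) ×-dec (a ℕ.≤? n)) (upTo (2+ n))

    rows-range : All (λ a → 1 ℕ.≤ a × a ℕ.≤ n) rows
    rows-range = All.all-filter (λ a → (1 ℕ.≤? a) ×-dec (a ℕ.≤? n)) (upTo (2+ n))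

    Λ₊-positive : All (λ lam → 1 ℕ.≤ proj₂ lam) (Λ₊ n)
    Λ₊-positive = All.all-filter (λ (_ , b) → 1 ℕ.≤? b) (Λ (2+ n))

    Λ₀-zero : All (λ lam → proj₂ lam ≡ 0 × 1 ℕ.≤ proj₁ lam) (Λ₀ n)
    Λ₀-zero = All.map⁺ (All.map (λ (1≤a , _) → ≡.refl , 1≤a) rows-range)

  Λ′-enumerates : EnumeratesΛ n (Λ′ n)
  Λ′-enumerates = record
    { inRange = All.++⁺ (All.filter⁺ (λ (_ , b) → 1 ℕ.≤? b) E.inRange)
        (All.++⁺ (All.map⁺ (All.map (λ (_ , a≤n) → a≤n , z≤n) rows-range)) ((z≤n , z≤n) ∷ []))
    ; unique = Unique.++⁺ (Unique.filter⁺ (λ (_ , b) → 1 ℕ.≤? b) E.unique)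
        (Unique.++⁺ (Unique.map⁺ (λ { ≡.refl → ≡.refl })
            (Unique.filter⁺ (λ a → (1 ℕ.≤? a) ×-dec (a ℕ.≤? n)) (Unique.upTo⁺ (2+ n))))
          ([] ∷ []) λ { (i , here ≡.refl) → ℕ.1+n≰n (proj₂ (All.lookup Λ₀-zero i)) })
        λ (i , j) → ℕ.1+n≰n (≡.subst (1 ℕ.≤_) (zero-part j) (All.lookup Λ₊-positive i))
    ; complete = complete
    }
    where
    zero-part : ∀ {lam} → lam ∈ Λ₀ n ++ [ (0 , 0) ] → proj₂ lam ≡ 0
    zero-part = All.lookup (All.++⁺ (All.map proj₁ Λ₀-zero) (≡.refl ∷ []))
    complete : ∀ {a b} → a ℕ.≤ n → b ℕ.≤ a → (a , b) ∈ Λ′ n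
    complete {a} {suc b} a≤n b≤a =
      ∈-++⁺ˡ (∈-filter⁺ (λ (_ , b) → 1 ℕ.≤? b) (E.complete a≤n b≤a) (s≤s z≤n))
    complete {suc a} {zero} a≤n b≤a = ∈-++⁺ʳ (Λ₊ n) (∈-++⁺ˡ (∈-map⁺ (_, 0)
      (∈-filter⁺ (λ a → (1 ℕ.≤? a) ×-dec (a ℕ.≤? n)) (∈-upTo⁺ (s≤s (ℕ.m≤n⇒m≤1+n a≤n)))
        (s≤s z≤n , a≤n))))
    complete {zero} {zero} a≤n b≤a = ∈-++⁺ʳ (Λ₊ n) (∈-++⁺ʳ (Λ₀ n) (here ≡.refl))

  degrees-Λ′ : replicate (2+ n) (2 ℕ.* 2+ n ℕ.∸ 3) ++ map (degreeΛ (2+ n)) (Λ′ n) ≡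
               exponents𝒟 (2+ n)
  degrees-Λ′ = ≡.cong (replicate (2+ n) (2 ℕ.* 2+ n ℕ.∸ 3) ++_)
    (≡.trans (List.map-++ (degreeΛ (2+ n)) (Λ₊ n) (Λ₀ n ++ [ (0 , 0) ]))
    (≡.cong₂ _++_ (List.map-cong-local (All.map (λ {lam} → positive {lam}) Λ₊-positive))
    (≡.trans (List.map-++ (degreeΛ (2+ n)) (Λ₀ n) [ (0 , 0) ]) (≡.cong (_++ [ 2 ℕ.* 2+ n ℕ.∸ 2 ])
      (≡.trans (≡.sym (List.map-∘ rows)) (List.map-cong-local (All.map zero-row rows-range)))))))
    where
    positive : ∀ {lam} → 1 ℕ.≤ proj₂ lam →
               degreeΛ (2+ n) lam ≡ 2 ℕ.* proj₁ lam ℕ.+ 2 ℕ.* proj₂ lam ℕ.∸ 2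
    positive {a , suc b} _ = ≡.refl
    zero-row : ∀ {a} → 1 ℕ.≤ a × a ℕ.≤ n → degreeΛ (2+ n) (a , 0) ≡ 2 ℕ.* a ℕ.∸ 2 ℕ.+ 2+ n
    zero-row {suc a} _ = ≡.refl

module _ {ℓ : ℕ} where
  open Ring (S ℓ)
  open Homogeneity ℓ using (Homogeneous)

  HomogeneousCoefficients : Operator ℓ 2 (∣S∣ ℓ) → ℕ → Set
  HomogeneousCoefficients θ d = ∀ α → Homogeneous d (θ α)

  isHomogeneous : ∀ {B : List (Operator ℓ 2 (∣S∣ ℓ))} {ds} → Pointwise HomogeneousCoefficients B
    ds →
                  (∀ k → ¬ (∀ α → lookup B k α ≈ 0#)) → Pointwise IsHomogeneous B ds
  isHomogeneous []       h = []
  isHomogeneous (p ∷ ps) h = (h zero , p) ∷ isHomogeneous ps (h ∘ suc)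

  degrees : ∀ {B : List (Operator ℓ 2 (∣S∣ ℓ))} {ds} → Pointwise IsHomogeneous B ds →
            ∃ λ (d : Fin (length B) → ℕ) → ds ≡ tabulate d × ∀ i → HomogeneousCoefficients
              (lookup B i) (d i)
  degrees []             = (λ ()) , ≡.refl , λ ()
  degrees {ds = e ∷ _} ((_ , p) ∷ ps) = let d , eq , h = degrees ps in
    (λ { zero → e ; (suc i) → d i }) , ≡.cong (e ∷_) eq , λ { zero → p ; (suc i) → h i }

ℝ-identity : IsSemiringHomomorphism ℝ-ring ℝ-ring (λ a → a)
ℝ-identity = record
  { cong = λ p → p ; homo-+ = λ a b → cauchy (a +ℝ b) ; homo-* = λ a b → cauchy (a *ℝ b)
  ; homo-0 = cauchy (fromℚ 0ℚ) ; homo-1 = cauchy (fromℚ 1ℚ) }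

module _ {ℓ : ℕ} (M : Operator ℓ 2 (∣S∣ ℓ) → Set) where
  open UniqueDegrees {ℓ} M ℝ-ring ℝ-identity RealNaturals.nat-inverse RealNaturals.1≉0

  basis-nonzero : ∀ {B} → IsBasis M B → ∀ k → ¬ (∀ α → CommutativeRing._≈_ (S ℓ) (lookup B k α)
    (CommutativeRing.0# (S ℓ)))
  basis-nonzero {B} isBasis = HomogeneousBases.nonzero {ℓ} M 1≉0ˢ {B} isBasis

  hasExponents : ∀ {B ds} → IsBasis M B → Pointwise (HomogeneousCoefficients {ℓ}) B ds →
    HasExponents M ds
  hasExponents {B} {ds} isBasis homogeneous = record
    { exists = B , isBasis , isHomogeneous homogeneous (basis-nonzero isBasis)
    ; unique = λ B′ ds′ (isBasis′ , homogeneous′) → compare B′ isBasis′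
        (degrees (isHomogeneous homogeneous (basis-nonzero isBasis))) (degrees homogeneous′)
    }
    where
    compare : ∀ B′ {ds′} → IsBasis M B′ →
      (∃ λ (d : Fin (length B) → ℕ) → ds ≡ tabulate d × ∀ i → HomogeneousCoefficients (lookup B i)
        (d i)) →
      (∃ λ (d : Fin (length B′) → ℕ) → ds′ ≡ tabulate d × ∀ i → HomogeneousCoefficients
        (lookup B′ i) (d i)) →
      ds′ ↭ ds
    compare B′ isBasis′ (d , ≡.refl , h) (d′ , ≡.refl , h′) = degrees-↭ {B} {B′} isBasis isBasis′ d
      d′ h h′

basis-homogeneous : ∀ n → let open Basis (EnumeratesΛ.pairsΛ (Λ′-enumerates n)) in
  Pointwise HomogeneousCoefficients (tabulate η-operator ++ tabulate θ-operator) (exponents𝒟 (2+ n))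
basis-homogeneous n = ≡.subst (Pointwise HomogeneousCoefficients
  (tabulate η-operator ++ tabulate θ-operator)) (degrees-Λ′ n)
  (Pointwise.++⁺
    (≡.subst (Pointwise HomogeneousCoefficients (tabulate η-operator)) (tabulate-replicate (2+ n))
      (Pointwise.tabulate⁺ {f = η-operator} {λ _ → 2 ℕ.* 2+ n ℕ.∸ 3} η-homogeneous))
    (≡.subst (Pointwise HomogeneousCoefficients (tabulate θ-operator))
      (≡.trans (≡.sym (List.map-tabulate (lookup (Λ′ n)) (degreeΛ (2+ n))))
        (≡.cong (map (degreeΛ (2+ n))) (List.tabulate-lookup (Λ′ n))))
      (Pointwise.tabulate⁺ {f = θ-operator} {degreeΛ (2+ n) ∘ lookup (Λ′ n)} θ-homogeneous)))
  where
  open Basis (EnumeratesΛ.pairsΛ (Λ′-enumerates n))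
  open BasisDegrees (Λ′-enumerates n)
  tabulate-replicate : ∀ m {d : ℕ} → tabulate {n = m} (λ _ → d) ≡ replicate m d
  tabulate-replicate zero    = ≡.refl
  tabulate-replicate (suc m) = ≡.cong (_ ∷_) (tabulate-replicate m)

theorem5p3 : (ℓ : ℕ) → 2 ≤ ℓ →
    (∃ λ B → Pointwise _Represents_ B (C𝒟 ℓ) × IsBasis (D²𝒟 ℓ) B)
    × HasExponents (D²𝒟 ℓ) (exponents𝒟 ℓ)
theorem5p3 (2+ n) _ =
  (_ , Representation.basis-represents (Λ-enumerates n) , Basis.isBasis
    (EnumeratesΛ.pairsΛ (Λ-enumerates n))) ,
  -- The construction is repeated for the order Λ′, so that the degrees agree with `exponents𝒟`
  -- entry by entry.
  hasExponents (D²𝒟 (2+ n)) (Basis.isBasis (EnumeratesΛ.pairsΛ (Λ′-enumerates n)))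
    (basis-homogeneous n)
theorem5p3 (suc zero) (s≤s ())
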